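{- For all $0<\varepsilon,\delta<1$ there exists $n_0$ such that the following holds for every $n\ge n_0$. Let $k\ge 2$ and let $G$ be a $k$-partite graph with parts $V_1,\ldots,V_k$, each of size exactly $n$. If the partite minimum degree of $G$ is at least $\left(1-\frac{1-\delta}{k}\right)n$, then $G$ contains at least $(1-\varepsilon)n$ pairwise vertex-disjoint copies of the complete graph $K_k$.
   Context: A $k$-partite graph with parts $V_1,\ldots,V_k$ is a graph on the disjoint union $V_1\cup\cdots\cup V_k$ with no edges inside any part. The partite minimum degree of such a graph is the largest $d$ such that every vertex has at least $d$ neighbours in each part other than its own. Quantities such as $(1-\varepsilon)n$ are understood up to rounding. -}

module Defs where

open import Data.Nat using (ℕ; zero; suc)
open import Data.Fin using (Fin; zero; suc)
open import Data.Bool using (Bool; true; false)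
open import Data.Product using (_×_; _,_; proj₁; proj₂)
open import Data.Integer using (+_)
open import Data.Rational using (ℚ; _-_; _*_; _/_; 0ℚ; 1ℚ)
import Data.Rational as Q
open import Relation.Binary.PropositionalEquality using (_≡_; _≢_)

ℕtoℚ : ℕ → ℚ
ℕtoℚ n = (+ n) / 1

-- Vertex set of a k-partite graph with k parts of size n:
-- vertex (i , x) is the x-th vertex of part V_i.
Vertex : ℕ → ℕ → Set
Vertex k n = Fin k × Fin n

record PartiteGraph (k n : ℕ) : Set where
  field
    adj       : Vertex k n → Vertex k n → Bool
    adj-sym   : ∀ u v → adj u v ≡ adj v u
    no-inside : ∀ i x y → adj (i , x) (i , y) ≡ false
open PartiteGraph public

count : ∀ {n} → (Fin n → Bool) → ℕ
count {zero}  f = 0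
count {suc n} f with f zero
... | true  = suc (count (λ x → f (suc x)))
... | false = count (λ x → f (suc x))

degIn : ∀ {k n} → PartiteGraph k n → Vertex k n → Fin k → ℕ
degIn G v j = count (λ x → adj G v (j , x))

partiteMinDeg≥ : ∀ {k n} → PartiteGraph k n → ℚ → Set
partiteMinDeg≥ {k} {n} G b =
  ∀ (v : Vertex k n) (j : Fin k) → j ≢ proj₁ v → b Q.≤ ℕtoℚ (degIn G v j)

-- (1 - (1 - δ)/k) n ; the k = 0 case is irrelevant (k ≥ 2 in the theorem)
degBound : ℚ → ℕ → ℕ → ℚ
degBound δ zero    n = 0ℚ
degBound δ (suc m) n = (1ℚ - (1ℚ - δ) * ((+ 1) / suc m)) * ℕtoℚ n

record DisjointCliques {k n : ℕ} (G : PartiteGraph k n) (m : ℕ) : Set where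
  field
    f        : Fin m → Fin k → Vertex k n
    distinct : ∀ a b i j → f a i ≡ f b j → (a ≡ b) × (i ≡ j)
    clique   : ∀ a i j → i ≢ j → adj G (f a i) (f a j) ≡ true

{-# OPTIONS --safe #-}
-- Cliques are extracted one at a time.  For a vertex x and a block b of B consecutive parts let F(x,b) be the number of
-- surviving vertices of the block not adjacent to x.  The potential Φ, the sum over all (x,b) of the falling factorial
-- F(F−1)⋯(F−p+1) with p ≈ log n, would shrink by the factor 1 − p/N if every vertex of the surviving parts (of size N)
-- were removed with probability 1/N.  As long as each step achieves nearly this factor, every F stays proportional to N
-- until N ≤ εn, so the degree condition survives.  The required clique is a deterministic choice with respect to the vertex
-- weights given by the derivative of Φ.
--   * If k² is at most a constant times n, take single parts as blocks.  Process the parts in each of the k cyclic orders,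
--     always choosing the heaviest available vertex; on average over the orders this clique has at least average weight.
--   * If k² is larger, take a bounded number of blocks and build the clique by a random process, derandomised: v_j is drawn
--     from a weight function ρ_j on V_j, and every later ρ_m is set to 0 on the vertices not adjacent to v_j and divided by the
--     survival probability elsewhere.  Each ρ_m(x) is a martingale, so the clique meets all vertices almost uniformly; sixth
--     moments keep every total mass |ρ_m| close to N, and the degree condition on blocks keeps ρ bounded.
module Submission where

open import Data.Nat using (ℕ; zero; suc)
open import Data.Fin using (Fin; zero; suc)
open import Algebra.Structures using (IsCommutativeSemiring)
open import Relation.Binary.PropositionalEquality using (_≡_; refl; sym; trans; cong; cong₂; module ≡-Reasoning)

-- The order of the moment has to grow with `log n` because there are up to `R = n ^ 3` tests: `Φ`
-- controls a single `F(x,b)` only up to a factor `R ^ (1/p)`, which is close to 1 if `p = s * q`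
-- with `2 ^ q > R` and `s` a large constant. Each step then only has to realise the exponent
-- `p′ = p − q`; over the whole process this costs a further factor `(n/N) ^ (1/s) ≤ E ^ (1/s)`. The
-- reserve `q` pays for all losses inside the steps. The order six is forced by the need for the two
-- constructions to overlap. The greedy one needs `N / k` well above `log n`. In the random one a
-- mass `|ρ_m|` makes up to `k` moves of size `O(n/k)`, so its `2j`-th moment relative to `N` is of
-- order `k ^ (−j)`. Summed over `k` parts and scaled by the total weight `P`, the penalty is about
-- `P * k ^ (1−j)`, while an average clique gains only `P / N`. Fourth moments would thus require
-- `k` of order `n`; sixth moments require only `k²` of order `n`.

module Summation {A : Set} (_+_ _*_ : A → A → A) (0# 1# : A) (isCS : IsCommutativeSemiring _≡_ _+_ _*_ 0# 1#) where
  private module R = IsCommutativeSemiring isCS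

  ∑ : ∀ {n} → (Fin n → A) → A
  ∑ {zero}  f = 0#
  ∑ {suc n} f = f zero + ∑ (λ i → f (suc i))

  ∑-cong : ∀ {n} {f g : Fin n → A} → (∀ i → f i ≡ g i) → ∑ f ≡ ∑ g
  ∑-cong {zero}  f≡g = refl
  ∑-cong {suc n} f≡g = cong₂ _+_ (f≡g zero) (∑-cong λ i → f≡g (suc i))

  ∑-0 : ∀ n → ∑ {n} (λ _ → 0#) ≡ 0#
  ∑-0 zero    = refl
  ∑-0 (suc n) = trans (R.+-identityˡ _) (∑-0 n)

  +-interchange : ∀ a b c d → (a + b) + (c + d) ≡ (a + c) + (b + d)
  +-interchange a b c d = begin
    (a + b) + (c + d)  ≡⟨ R.+-assoc a b (c + d) ⟩
    a + (b + (c + d))  ≡⟨ cong (a +_) (sym (R.+-assoc b c d)) ⟩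
    a + ((b + c) + d)  ≡⟨ cong (λ z → a + (z + d)) (R.+-comm b c) ⟩
    a + ((c + b) + d)  ≡⟨ cong (a +_) (R.+-assoc c b d) ⟩
    a + (c + (b + d))  ≡⟨ sym (R.+-assoc a c (b + d)) ⟩
    (a + c) + (b + d)  ∎
    where open ≡-Reasoning

  ∑-+ : ∀ {n} (f g : Fin n → A) → ∑ (λ i → f i + g i) ≡ ∑ f + ∑ g
  ∑-+ {zero}  f g = sym (R.+-identityˡ _)
  ∑-+ {suc n} f g = trans (cong ((f zero + g zero) +_) (∑-+ (λ i → f (suc i)) (λ i → g (suc i))))
    (+-interchange (f zero) (g zero) _ _)

  ∑-*ˡ : ∀ {n} c (f : Fin n → A) → ∑ (λ i → c * f i) ≡ c * ∑ f
  ∑-*ˡ {zero}  c f = sym (R.zeroʳ c)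
  ∑-*ˡ {suc n} c f = trans (cong ((c * f zero) +_) (∑-*ˡ c (λ i → f (suc i)))) (sym (R.distribˡ c _ _))

  ∑-*ʳ : ∀ {n} c (f : Fin n → A) → ∑ (λ i → f i * c) ≡ ∑ f * c
  ∑-*ʳ c f = trans (∑-cong λ i → R.*-comm (f i) c) (trans (∑-*ˡ c f) (R.*-comm c _))

  ∑-swap : ∀ {m n} (f : Fin m → Fin n → A) → ∑ (λ i → ∑ (f i)) ≡ ∑ (λ j → ∑ (λ i → f i j))
  ∑-swap {zero} {n} f = sym (∑-0 n)
  ∑-swap {suc m} f = trans (cong (∑ (f zero) +_) (∑-swap (λ i → f (suc i)))) (sym (∑-+ (f zero) _))

  -- Only pairs `i < j`, each once. Peeling off the first index suits both inductions that use it: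
  -- inclusion-exclusion over the parts, and the process that fixes one part at a time.
  pairSum : ∀ {r} → (Fin r → Fin r → A) → A
  pairSum {zero}  f = 0#
  pairSum {suc r} f = ∑ (λ m → f zero (suc m)) + pairSum (λ i j → f (suc i) (suc j))

  pairSum-cong : ∀ {r} {f g : Fin r → Fin r → A} → (∀ i j → f i j ≡ g i j) → pairSum f ≡ pairSum g
  pairSum-cong {zero}  h = refl
  pairSum-cong {suc r} h = cong₂ _+_ (∑-cong λ m → h zero (suc m)) (pairSum-cong λ i j → h (suc i) (suc j))

  pairSum-∑ : ∀ {r n} (f : Fin n → Fin r → Fin r → A) →
    pairSum (λ i j → ∑ λ t → f t i j) ≡ ∑ (λ t → pairSum (f t))
  pairSum-∑ {zero}  {n} f = sym (∑-0 n)
  pairSum-∑ {suc r} f = trans (cong₂ _+_ (∑-swap (λ m t → f t zero (suc m))) (pairSum-∑ (λ t i j → f t (suc i) (suc j))))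
    (sym (∑-+ (λ t → ∑ λ m → f t zero (suc m)) (λ t → pairSum (λ i j → f t (suc i) (suc j)))))

  pairSum-*ʳ : ∀ {r} c (f : Fin r → Fin r → A) → pairSum (λ i j → f i j * c) ≡ pairSum f * c
  pairSum-*ʳ {zero}  c f = sym (R.zeroˡ c)
  pairSum-*ʳ {suc r} c f = trans (cong₂ _+_ (∑-*ʳ c (λ m → f zero (suc m))) (pairSum-*ʳ c (λ i j → f (suc i) (suc j))))
    (sym (R.distribʳ c _ _))

module Combinatorics where
  open import Data.Nat
  open import Data.Nat.Properties
  open import Data.Nat.DivMod
  open import Data.Nat.Tactic.RingSolver using (solve-∀)
  open import Data.Fin as Fin using (Fin; zero; suc; toℕ; fromℕ<; opposite; combine; remQuot)
  import Data.Fin.Properties as Fin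
  open import Data.Fin.Properties using (toℕ-fromℕ<; toℕ-injective; toℕ<n; opposite-involutive; opposite-prop)
  open import Data.Bool using (Bool; true; false; _∧_; not; T)
  open import Data.Unit using (tt)
  open import Data.Product using (∃; _×_; _,_; proj₁; proj₂; map₂)
  open import Data.Sum using (_⊎_; inj₁; inj₂)
  open import Function using (_∘_)
  open import Relation.Binary.PropositionalEquality
  open import Relation.Binary.Definitions using (tri<; tri≈; tri>)
  open import Relation.Nullary using (does; yes; no; contradiction)

  open Summation _+_ _*_ 0 1 +-*-isCommutativeSemiring public


  -- Sums of naturals and of bits

  ∑-mono : ∀ {n} {f g : Fin n → ℕ} → (∀ i → f i ≤ g i) → ∑ f ≤ ∑ g
  ∑-mono {zero}  h = z≤n
  ∑-mono {suc n} h = +-mono-≤ (h zero) (∑-mono λ i → h (suc i))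

  term≤∑ : ∀ {n} (f : Fin n → ℕ) i → f i ≤ ∑ f
  term≤∑ f zero  = m≤m+n _ _
  term≤∑ f (suc i) = ≤-trans (term≤∑ (λ i → f (suc i)) i) (m≤n+m _ _)

  ∑-const : ∀ n c → ∑ {n} (λ _ → c) ≡ n * c
  ∑-const zero  c = refl
  ∑-const (suc n) c = cong (c +_) (∑-const n c)

  bit : Bool → ℕ
  bit true  = 1
  bit false = 0

  bit≤1 : ∀ b → bit b ≤ 1
  bit≤1 true  = ≤-refl
  bit≤1 false = z≤n

  ∑-delta : ∀ {n} (v : Fin n) (f : Fin n → ℕ) → ∑ (λ y → f y * bit (does (y Fin.≟ v))) ≡ f v
  ∑-delta {suc n} zero f = trans (cong₂ _+_ (*-identityʳ (f zero)) (trans (∑-cong λ y → *-zeroʳ (f (suc y))) (∑-0 n))) (+-identityʳ (f zero))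
  ∑-delta {suc n} (suc v) f = cong₂ _+_ (*-zeroʳ (f zero)) (∑-delta v (λ y → f (suc y)))

  <ᵇ-true : ∀ {m n} → m < n → (m <ᵇ n) ≡ true
  <ᵇ-true {m} {n} m<n with m <ᵇ n | <⇒<ᵇ m<n
  ... | true | _ = refl

  ≡ᵇ-refl : ∀ n → (n ≡ᵇ n) ≡ true
  ≡ᵇ-refl zero    = refl
  ≡ᵇ-refl (suc n) = ≡ᵇ-refl n

  -- Falling factorials and the second-order Bonferroni inequality

  ff : ℕ → ℕ → ℕ
  ff F  zero  = 1
  ff zero  (suc p) = 0
  ff (suc F) (suc p) = suc F * ff F p

  -- An injective tuple from a set with one extra element either avoids that element or has it in
  -- exactly one of `suc p` places.
  ff-pascal : ∀ F p → ff (suc F) (suc p) ≡ ff F (suc p) + suc p * ff F p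
  ff-pascal zero  zero  = refl
  ff-pascal zero  (suc p) = sym (*-zeroʳ p)
  ff-pascal (suc F) zero  = lem F
    where
    lem : ∀ F → suc (suc F) * 1 ≡ suc F * 1 + 1
    lem = solve-∀
  ff-pascal (suc F) (suc p) = begin
    suc (suc F) * (suc F * ff F p)  ≡⟨⟩
    suc F * ff F p + suc F * (suc F * ff F p)  ≡⟨ cong (λ z → suc F * ff F p + suc F * z) (ff-pascal F p) ⟩
    suc F * ff F p + suc F * (ff F (suc p) + suc p * ff F p)  ≡⟨ lem F p (ff F p) (ff F (suc p)) ⟩
    suc F * ff F (suc p) + suc (suc p) * (suc F * ff F p)  ∎
    where
    open ≡-Reasoning
    lem : ∀ F p a b → suc F * a + suc F * (b + suc p * a) ≡ suc F * b + suc (suc p) * (suc F * a)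
    lem = solve-∀

  ff-mono : ∀ {F G} p → F ≤ G → ff F p ≤ ff G p
  ff-mono zero  _  = ≤-refl
  ff-mono (suc p) z≤n  = z≤n
  ff-mono (suc p) (s≤s F≤G) = *-mono-≤ (s≤s F≤G) (ff-mono p F≤G)

  module Potential (p : ℕ) where
    -- The exponent of the potential is `2 + p`, so that two differences exist without truncated
    -- subtraction.
    ff₀ ff₁ ff₂ : ℕ → ℕ
    ff₀ F = ff F (2 + p)
    ff₁ F = (2 + p) * ff F (1 + p)
    ff₂ F = (2 + p) * ((1 + p) * ff F p)

    ff₀-suc : ∀ F → ff₀ (suc F) ≡ ff₀ F + ff₁ F
    ff₀-suc F = ff-pascal F (suc p)

    ff₁-suc : ∀ F → ff₁ (suc F) ≡ ff₁ F + ff₂ F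
    ff₁-suc F = trans (cong ((2 + p) *_) (ff-pascal F p)) (*-distribˡ-+ (2 + p) (ff F (1 + p)) _)

    ff₂-mono : ∀ {F G} → F ≤ G → ff₂ F ≤ ff₂ G
    ff₂-mono F≤G = *-monoʳ-≤ (2 + p) (*-monoʳ-≤ (1 + p) (ff-mono p F≤G))

    -- Counts tuples with one marked entry: first the marked element, then its place and the other
    -- entries. The next identity marks two entries. They turn total weights into multiples of the
    -- potential.
    F*ff₁ : ∀ F → F * ff₁ (F ∸ 1) ≡ (2 + p) * ff₀ F
    F*ff₁ zero  = sym (*-zeroʳ p)
    F*ff₁ (suc F) = lem (suc F) (2 + p) (ff F (1 + p))
      where
      lem : ∀ a b c → a * (b * c) ≡ b * (a * c)
      lem = solve-∀

    F²*ff₂ : ∀ F → F * (F ∸ 1) * ff₂ (F ∸ 2) ≡ (2 + p) * ((1 + p) * ff₀ F)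
    F²*ff₂ zero  = sym (trans (cong ((2 + p) *_) (*-zeroʳ p)) (*-zeroʳ p))
    F²*ff₂ (suc zero)  = sym (trans (cong ((2 + p) *_) (*-zeroʳ p)) (*-zeroʳ p))
    F²*ff₂ (suc (suc F)) = lem (suc (suc F)) (suc F) (2 + p) (1 + p) (ff F p)
      where
      lem : ∀ a b c d e → a * b * (c * (d * e)) ≡ c * (d * (a * (b * e)))
      lem = solve-∀

    -- ff₀ F counts the (2 + p)-tuples of distinct elements of a set of size F, and ff₁, ff₂ are its successive differences;
    -- deleting the elements marked by x destroys at least as many tuples as inclusion–exclusion of order two predicts.
    bonferroni : ∀ {r} (x : Fin r → Bool) F →
      ff₀ F + ∑ (λ i → bit (x i)) * ff₁ (F + ∑ (λ i → bit (x i)) ∸ 1) ≤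
      ff₀ (F + ∑ (λ i → bit (x i))) + pairSum (λ i j → bit (x i) * bit (x j)) * ff₂ (F + ∑ (λ i → bit (x i)) ∸ 2)
    bonferroni {zero}  x F = ≤-reflexive (lem (ff₀ F) (ff₀ (F + 0)) (cong ff₀ (sym (+-identityʳ F))))
      where
      lem : ∀ a b → a ≡ b → a + 0 ≡ b + 0
      lem a b a≡b = cong (_+ 0) a≡b
    bonferroni {suc r} x F with x zero
    ... | false = subst (λ z → ff₀ F + S * ff₁ (F + S ∸ 1) ≤ ff₀ (F + S) + z * ff₂ (F + S ∸ 2)) (cong (_+ R) (sym (∑-0 r))) (bonferroni x′ F)
      where
      x′ = λ i → x (suc i)
      S = ∑ λ i → bit (x′ i)
      R = pairSum λ i j → bit (x′ i) * bit (x′ j)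
    ... | true = subst (λ z → ff₀ F + suc S * ff₁ (F + suc S ∸ 1) ≤ ff₀ (F + suc S) + z * ff₂ (F + suc S ∸ 2))
          (cong (_+ R) (∑-cong λ m → sym (+-identityʳ (bit (x′ m)))))
          (subst (λ z → ff₀ F + suc S * ff₁ (z ∸ 1) ≤ ff₀ z + (S + R) * ff₂ (z ∸ 2)) (sym (+-suc F S)) (step S refl))
      where
      x′ = λ i → x (suc i)
      S = ∑ λ i → bit (x′ i)
      R = pairSum λ i j → bit (x′ i) * bit (x′ j)
      step : ∀ s → S ≡ s → ff₀ F + suc S * ff₁ (F + S) ≤ ff₀ (suc (F + S)) + (S + R) * ff₂ (F + S ∸ 1)
      -- Without a further marked element the claim is the difference identity itself; the other
      -- case needs `F + S` to be a successor.
      step zero S≡0 = begin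
        ff₀ F + suc S * ff₁ (F + S)  ≡⟨ cong₂ (λ a b → ff₀ a + suc b * ff₁ (F + S)) (sym (trans (cong (F +_) S≡0) (+-identityʳ F))) S≡0 ⟩
        ff₀ (F + S) + 1 * ff₁ (F + S)  ≡⟨ cong (ff₀ (F + S) +_) (*-identityˡ _) ⟩
        ff₀ (F + S) + ff₁ (F + S)  ≡⟨ sym (ff₀-suc (F + S)) ⟩
        ff₀ (suc (F + S))  ≤⟨ m≤m+n _ _ ⟩
        _  ∎
        where open ≤-Reasoning
      step (suc s) S≡ = subst (λ z → ff₀ F + suc S * ff₁ z ≤ ff₀ (suc z) + (S + R) * ff₂ (z ∸ 1)) (sym G≡) (begin
        -- Lowering the argument in `S` copies of `ff₁` costs `S * ff₂ G`, which the `S` new pairs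
        -- containing the head pay for.
        ff₀ F + suc S * ff₁ (suc G)  ≡⟨ cong (λ z → ff₀ F + (ff₁ (suc G) + S * z)) (ff₁-suc G) ⟩
        ff₀ F + (ff₁ (suc G) + S * (ff₁ G + ff₂ G))  ≡⟨ lem (ff₀ F) (ff₁ (suc G)) S (ff₁ G) (ff₂ G) ⟩
        (ff₀ F + S * ff₁ G) + (ff₁ (suc G) + S * ff₂ G)  ≤⟨ +-monoˡ-≤ (ff₁ (suc G) + S * ff₂ G) ih ⟩
        (ff₀ (suc G) + R * ff₂ (G ∸ 1)) + (ff₁ (suc G) + S * ff₂ G)
          ≤⟨ +-monoˡ-≤ (ff₁ (suc G) + S * ff₂ G) (+-monoʳ-≤ (ff₀ (suc G)) (*-monoʳ-≤ R (ff₂-mono (m∸n≤m G 1)))) ⟩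
        (ff₀ (suc G) + R * ff₂ G) + (ff₁ (suc G) + S * ff₂ G)  ≡⟨ lem′ (ff₀ (suc G)) R (ff₂ G) (ff₁ (suc G)) S ⟩
        (ff₀ (suc G) + ff₁ (suc G)) + (S + R) * ff₂ G  ≡⟨ cong (_+ (S + R) * ff₂ G) (sym (ff₀-suc (suc G))) ⟩
        ff₀ (suc (suc G)) + (S + R) * ff₂ G  ∎)
        where
        open ≤-Reasoning
        G = F + s
        G≡ : F + S ≡ suc G
        G≡ = trans (cong (F +_) S≡) (+-suc F s)
        ih : ff₀ F + S * ff₁ G ≤ ff₀ (suc G) + R * ff₂ (G ∸ 1)
        ih = subst (λ z → ff₀ F + S * ff₁ (z ∸ 1) ≤ ff₀ z + R * ff₂ (z ∸ 2)) G≡ (bonferroni x′ F)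
        lem : ∀ a b s c d → a + (b + s * (c + d)) ≡ (a + s * c) + (b + s * d)
        lem = solve-∀
        lem′ : ∀ a r q b s → (a + r * q) + (b + s * q) ≡ (a + b) + (s + r) * q
        lem′ = solve-∀

    -- Natural numbers satisfy `s i ≤ s i * s i`, so even twice the left side obeys this bound. The
    -- product on the right is the one that `F²*ff₂` absorbs.
    ∑-pairs : ∀ {r} (s : Fin r → ℕ) → pairSum (λ i j → s i * s j) ≤ ∑ s * (∑ s ∸ 1)
    ∑-pairs {zero}  s = z≤n
    ∑-pairs {suc r} s = begin
      ∑ (λ m → s zero * s (suc m)) + pairSum (λ i j → s (suc i) * s (suc j))  ≤⟨ +-mono-≤ (≤-reflexive (∑-*ˡ (s zero) λ m → s (suc m))) (∑-pairs λ i → s (suc i)) ⟩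
      s zero * S + S * (S ∸ 1)  ≤⟨ lem (s zero) S ⟩
      (s zero + S) * (s zero + S ∸ 1)  ∎
      where
      open ≤-Reasoning
      S = ∑ λ i → s (suc i)
      lem : ∀ a b → a * b + b * (b ∸ 1) ≤ (a + b) * (a + b ∸ 1)
      lem zero  b = ≤-refl
      lem (suc a) zero rewrite *-zeroʳ a = z≤n
      lem (suc a) (suc b) = subst (suc a * suc b + suc b * b ≤_) (lem′ a b) (m≤m+n _ _)
        where
        lem′ : ∀ a b → suc a * suc b + suc b * b + (suc a * suc b + suc a * a) ≡ (suc a + suc b) * (a + suc b)
        lem′ = solve-∀

    -- The potential of a family of tests and its loss under deletion

    module Tests {T k n : ℕ} (e : Fin T → Fin k → Fin n → Bool) where
      Alive : Set
      Alive = Fin k → Fin n → Bool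

      remove : Alive → (Fin k → Fin n) → Alive
      remove a K j y = a j y ∧ not (does (y Fin.≟ K j))

      hit : Alive → Fin T → Fin k → Fin n → ℕ
      hit a t j y = bit (a j y) * bit (e t j y)

      size : Alive → Fin T → ℕ
      size a t = ∑ λ j → ∑ λ y → hit a t j y

      Φ : Alive → ℕ
      Φ a = ∑ λ t → ff₀ (size a t)

      -- The number of counted tuples through a vertex, that is, the exact drop of `Φ` if this
      -- surviving vertex alone is deleted.
      weight : Alive → Fin k → Fin n → ℕ
      weight a j y = ∑ λ t → hit a t j y * ff₁ (size a t ∸ 1)

      -- The number of counted tuples through two vertices, which the sum of their weights counts
      -- twice.
      weight₂ : Alive → Fin k → Fin n → Fin k → Fin n → ℕ
      weight₂ a i y j z = ∑ λ t → hit a t i y * hit a t j z * ff₂ (size a t ∸ 2)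

      remove-count : ∀ (a : Fin n → Bool) (c : Fin n → ℕ) v → a v ≡ true →
        ∑ (λ y → bit (a y) * c y) ≡ ∑ (λ y → bit (a y ∧ not (does (y Fin.≟ v))) * c y) + c v
      remove-count a c v av = trans (∑-cong pointwise) (trans (∑-+ (λ y → bit (a y ∧ not (does (y Fin.≟ v))) * c y) (λ y → c y * bit (does (y Fin.≟ v))))
          (cong (∑ (λ y → bit (a y ∧ not (does (y Fin.≟ v))) * c y) +_) (∑-delta v c)))
        where
        pointwise : ∀ y → bit (a y) * c y ≡ bit (a y ∧ not (does (y Fin.≟ v))) * c y + c y * bit (does (y Fin.≟ v))
        pointwise y with y Fin.≟ v
        ... | yes refl rewrite av = trans (*-identityˡ (c y)) (sym (*-identityʳ (c y)))
        ... | no _ with a y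
        ...  | true  = sym (trans (cong (1 * c y +_) (*-zeroʳ (c y))) (+-identityʳ _))
        ...  | false = sym (*-zeroʳ (c y))

      module _ (a : Alive) (K : Fin k → Fin n) (alive : ∀ j → a j (K j) ≡ true) where
        hit-K : ∀ t j → hit a t j (K j) ≡ bit (e t j (K j))
        hit-K t j = trans (cong (λ z → bit z * bit (e t j (K j))) (alive j)) (*-identityˡ _)

        size-remove : ∀ t → size a t ≡ size (remove a K) t + ∑ (λ j → bit (e t j (K j)))
        size-remove t = trans (∑-cong λ j → remove-count (a j) (λ y → bit (e t j y)) (K j) (alive j))
          (∑-+ (λ j → ∑ λ y → hit (remove a K) t j y) (λ j → bit (e t j (K j))))

        -- Bonferroni summed over the tests. From here on the choice of a clique depends on vertex
        -- and pair weights only.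
        Φ-remove : Φ (remove a K) + ∑ (λ j → weight a j (K j)) ≤ Φ a + pairSum (λ i j → weight₂ a i (K i) j (K j))
        Φ-remove = begin
          Φ (remove a K) + ∑ (λ j → weight a j (K j))
            ≡⟨ cong (Φ (remove a K) +_) (∑-swap λ j t → hit a t j (K j) * ff₁ (size a t ∸ 1)) ⟩
          Φ (remove a K) + ∑ (λ t → ∑ λ j → hit a t j (K j) * ff₁ (size a t ∸ 1))
            ≡⟨ sym (∑-+ (λ t → ff₀ (size (remove a K) t)) (λ t → ∑ λ j → hit a t j (K j) * ff₁ (size a t ∸ 1))) ⟩
          ∑ (λ t → ff₀ (size (remove a K) t) + ∑ λ j → hit a t j (K j) * ff₁ (size a t ∸ 1))
            ≤⟨ ∑-mono per-test ⟩
          ∑ (λ t → ff₀ (size a t) + pairSum λ i j → hit a t i (K i) * hit a t j (K j) * ff₂ (size a t ∸ 2))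
            ≡⟨ ∑-+ (λ t → ff₀ (size a t)) (λ t → pairSum λ i j → hit a t i (K i) * hit a t j (K j) * ff₂ (size a t ∸ 2)) ⟩
          Φ a + ∑ (λ t → pairSum λ i j → hit a t i (K i) * hit a t j (K j) * ff₂ (size a t ∸ 2))
            ≡⟨ cong (Φ a +_) (sym (pairSum-∑ λ t i j → hit a t i (K i) * hit a t j (K j) * ff₂ (size a t ∸ 2))) ⟩
          Φ a + pairSum (λ i j → weight₂ a i (K i) j (K j)) ∎
          where
          open ≤-Reasoning
          per-test : ∀ t → ff₀ (size (remove a K) t) + ∑ (λ j → hit a t j (K j) * ff₁ (size a t ∸ 1)) ≤
            ff₀ (size a t) + pairSum (λ i j → hit a t i (K i) * hit a t j (K j) * ff₂ (size a t ∸ 2))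
          per-test t = begin
            ff₀ F + ∑ (λ j → hit a t j (K j) * ff₁ (size a t ∸ 1))
              ≡⟨ cong (ff₀ F +_) (trans (∑-*ʳ (ff₁ (size a t ∸ 1)) (λ j → hit a t j (K j))) (cong₂ (λ u v → u * ff₁ (v ∸ 1)) (∑-cong (hit-K t)) (size-remove t))) ⟩
            ff₀ F + S * ff₁ (F + S ∸ 1)
              ≤⟨ bonferroni (λ j → e t j (K j)) F ⟩
            ff₀ (F + S) + pairSum (λ i j → bit (e t i (K i)) * bit (e t j (K j))) * ff₂ (F + S ∸ 2)
              ≡⟨ cong₂ (λ u v → ff₀ u + v * ff₂ (u ∸ 2)) (sym (size-remove t)) (pairSum-cong λ i j → sym (cong₂ _*_ (hit-K t i) (hit-K t j))) ⟩
            ff₀ (size a t) + pairSum (λ i j → hit a t i (K i) * hit a t j (K j)) * ff₂ (size a t ∸ 2)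
              ≡⟨ cong (ff₀ (size a t) +_) (sym (pairSum-*ʳ (ff₂ (size a t ∸ 2)) (λ i j → hit a t i (K i) * hit a t j (K j)))) ⟩
            _ ∎
            where
            F = size (remove a K) t
            S = ∑ λ j → bit (e t j (K j))

      -- Every counted tuple has `2 + p` entries. With parts of size `N`, independent uniform
      -- choices of one survivor per part would thus have mean weight `(2 + p) * Φ a / N`, the
      -- benchmark for a clique.
      weight-total : ∀ a → ∑ (λ j → ∑ λ y → weight a j y) ≡ (2 + p) * Φ a
      weight-total a = begin
        ∑ (λ j → ∑ λ y → ∑ λ t → hit a t j y * ff₁ (size a t ∸ 1))  ≡⟨ ∑-cong (λ j → ∑-swap λ y t → hit a t j y * ff₁ (size a t ∸ 1)) ⟩
        ∑ (λ j → ∑ λ t → ∑ λ y → hit a t j y * ff₁ (size a t ∸ 1))  ≡⟨ ∑-swap (λ j t → ∑ λ y → hit a t j y * ff₁ (size a t ∸ 1)) ⟩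
        ∑ (λ t → ∑ λ j → ∑ λ y → hit a t j y * ff₁ (size a t ∸ 1))  ≡⟨ ∑-cong (λ t → trans (∑-cong λ j → ∑-*ʳ (ff₁ (size a t ∸ 1)) (hit a t j)) (∑-*ʳ (ff₁ (size a t ∸ 1)) (λ j → ∑ (hit a t j)))) ⟩
        ∑ (λ t → size a t * ff₁ (size a t ∸ 1))  ≡⟨ ∑-cong (λ t → F*ff₁ (size a t)) ⟩
        ∑ (λ t → (2 + p) * ff₀ (size a t))  ≡⟨ ∑-*ˡ (2 + p) (λ t → ff₀ (size a t)) ⟩
        (2 + p) * Φ a  ∎
        where open ≡-Reasoning

      weight₂-total : ∀ a → pairSum (λ i j → ∑ λ y → ∑ λ z → weight₂ a i y j z) ≤ (2 + p) * ((1 + p) * Φ a)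
      weight₂-total a = begin
        pairSum (λ i j → ∑ λ y → ∑ λ z → weight₂ a i y j z)
          ≡⟨ pairSum-cong (λ i j → trans (∑-cong λ y → ∑-swap λ z t → c t i y j z) (trans (∑-swap λ y t → ∑ λ z → c t i y j z) (∑-cong λ t → factor t i j))) ⟩
        pairSum (λ i j → ∑ λ t → s t i * s t j * ff₂ (size a t ∸ 2))
          ≡⟨ trans (pairSum-∑ (λ t i j → s t i * s t j * ff₂ (size a t ∸ 2))) (∑-cong λ t → pairSum-*ʳ (ff₂ (size a t ∸ 2)) (λ i j → s t i * s t j)) ⟩
        ∑ (λ t → pairSum (λ i j → s t i * s t j) * ff₂ (size a t ∸ 2))
          ≤⟨ ∑-mono (λ t → *-monoˡ-≤ (ff₂ (size a t ∸ 2)) (∑-pairs (s t))) ⟩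
        ∑ (λ t → size a t * (size a t ∸ 1) * ff₂ (size a t ∸ 2))
          ≡⟨ ∑-cong (λ t → F²*ff₂ (size a t)) ⟩
        ∑ (λ t → (2 + p) * ((1 + p) * ff₀ (size a t)))
          ≡⟨ trans (∑-*ˡ (2 + p) (λ t → (1 + p) * ff₀ (size a t))) (cong ((2 + p) *_) (∑-*ˡ (1 + p) (λ t → ff₀ (size a t)))) ⟩
        (2 + p) * ((1 + p) * Φ a) ∎
        where
        open ≤-Reasoning
        c : Fin T → Fin k → Fin n → Fin k → Fin n → ℕ
        c t i y j z = hit a t i y * hit a t j z * ff₂ (size a t ∸ 2)
        s : Fin T → Fin k → ℕ
        s t j = ∑ (hit a t j)
        factor : ∀ t i j → ∑ (λ y → ∑ λ z → c t i y j z) ≡ s t i * s t j * ff₂ (size a t ∸ 2)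
        factor t i j = trans (∑-cong λ y → trans (∑-*ʳ (ff₂ (size a t ∸ 2)) (λ z → hit a t i y * hit a t j z)) (cong (_* ff₂ (size a t ∸ 2)) (∑-*ˡ (hit a t i y) (hit a t j))))
          (trans (∑-*ʳ (ff₂ (size a t ∸ 2)) (λ y → hit a t i y * s t j)) (cong (_* ff₂ (size a t ∸ 2)) (∑-*ʳ (s t j) (hit a t i))))

  -- Conflicts and the tests given by blocks of parts

  bit-∧ : ∀ b c → bit (b ∧ c) ≡ bit b * bit c
  bit-∧ true  c = sym (+-identityʳ (bit c))
  bit-∧ false c = refl

  -- cf i x j y means that the x-th vertex of part i and the y-th vertex of part j ≠ i are not adjacent.
  record Conflicts (k n : ℕ) : Set where
    field
      cf  : Fin k → Fin n → Fin k → Fin n → Bool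
      cf-sym  : ∀ i x j y → cf i x j y ≡ cf j y i x

  module BlockTests {k n : ℕ} (G : Conflicts k n) (B : ℕ) {{_ : NonZero B}} where
    open Conflicts G

    -- A part, a vertex of it, and a block number. Numbers in `Fin k` suffice for every `B`, since
    -- `toℕ j / B < k`; surplus numbers give empty tests.
    decode : Fin (k * (n * k)) → Fin k × (Fin n × Fin k)
    decode t = map₂ (remQuot k) (remQuot (n * k) t)

    blockTest : Fin (k * (n * k)) → Fin k → Fin n → Bool
    blockTest t j y = cf (proj₁ (decode t)) (proj₁ (proj₂ (decode t))) j y ∧ (toℕ j / B ≡ᵇ toℕ (proj₂ (proj₂ (decode t))))

    index : Fin k → Fin n → Fin k → Fin (k * (n * k))
    index i x b = combine i (combine x b)

    blockTest-index : ∀ i x b j y → blockTest (index i x b) j y ≡ cf i x j y ∧ (toℕ j / B ≡ᵇ toℕ b)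
    blockTest-index i x b j y = cong (λ t → cf (proj₁ t) (proj₁ (proj₂ t)) j y ∧ (toℕ j / B ≡ᵇ toℕ (proj₂ (proj₂ t))))
      (trans (cong (map₂ (remQuot k)) (Fin.remQuot-combine i (combine x b))) (cong (i ,_) (Fin.remQuot-combine x b)))

    deg : (Fin k → Fin n → Bool) → Fin k → Fin k → Fin n → ℕ
    deg a j i x = ∑ λ y → bit (a j y) * bit (cf i x j y)

    module _ (p : ℕ) where
      open Potential p
      open Tests blockTest

      size-index : ∀ a i x b → size a (index i x b) ≡ ∑ (λ j → bit (toℕ j / B ≡ᵇ toℕ b) * deg a j i x)
      size-index a i x b = ∑-cong λ j → trans (∑-cong λ y → trans (cong (λ c → bit (a j y) * bit c) (blockTest-index i x b j y))
        (trans (cong (bit (a j y) *_) (bit-∧ (cf i x j y) _)) (lem (bit (a j y)) (bit (cf i x j y)) _))) (∑-*ˡ (bit (toℕ j / B ≡ᵇ toℕ b)) (λ y → bit (a j y) * bit (cf i x j y)))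
        where
        lem : ∀ a c d → a * (c * d) ≡ d * (a * c)
        lem = solve-∀

      block-deg≤ : ∀ a F → (∀ t → size a t ≤ F) → ∀ b i x → ∑ (λ j → bit (toℕ j / B ≡ᵇ b) * deg a j i x) ≤ F
      block-deg≤ a F size≤F b i x with b <? k
      ... | yes b<k = subst (λ c → ∑ (λ j → bit (toℕ j / B ≡ᵇ c) * deg a j i x) ≤ F) (Fin.toℕ-fromℕ< b<k)
            (≤-trans (≤-reflexive (sym (size-index a i x (fromℕ< b<k)))) (size≤F (index i x (fromℕ< b<k))))
      ... | no b≮k = ≤-trans (≤-reflexive (trans (∑-cong none) (∑-0 k))) z≤n
        where
        none : ∀ j → bit (toℕ j / B ≡ᵇ b) * deg a j i x ≡ 0
        none j with toℕ j / B ≡ᵇ b in eq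
        ... | false = refl
        ... | true  = contradiction (subst (_< k) (≡ᵇ⇒≡ (toℕ j / B) b (subst T (sym eq) tt)) (≤-<-trans (m/n≤m (toℕ j) B) (Fin.toℕ<n j))) b≮k

      weight-alive : ∀ a j y → a j y ≡ false → weight a j y ≡ 0
      weight-alive a j y dead = trans (∑-cong λ t → cong (λ b → bit b * bit (blockTest t j y) * ff₁ (size a t ∸ 1)) dead) (∑-0 (k * (n * k)))

      -- Covers steps with `Φ a ≡ 0`, where the estimate for the random clique says nothing.
      Φ-mono : ∀ a K → Φ (remove a K) ≤ Φ a
      Φ-mono a K = ∑-mono λ t → ff-mono (2 + p) (∑-mono λ j → ∑-mono λ y → *-monoˡ-≤ (bit (blockTest t j y)) (lem (a j y) _))
        where
        lem : ∀ b c → bit (b ∧ c) ≤ bit b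
        lem true  c = bit≤1 c
        lem false c = z≤n

      -- The last component says Φ (remove a K) ≤ (1 − p′/N) Φ a.
      GoodStep : (Fin k → Fin n → Bool) → ℕ → ℕ → Set
      GoodStep a N p′ = ∃ λ (K : Fin k → Fin n) → (∀ j → a j (K j) ≡ true) ×
        (∀ i j → i ≢ j → cf i (K i) j (K j) ≡ false) × (Φ (remove a K) * N + p′ * Φ a ≤ Φ a * N)

      good-removal : ∀ a N p′ (K : Fin k → Fin n) → (∀ j → a j (K j) ≡ true) →
        p′ * Φ a + N * pairSum (λ i j → weight₂ a i (K i) j (K j)) ≤ N * ∑ (λ j → weight a j (K j)) →
        Φ (remove a K) * N + p′ * Φ a ≤ Φ a * N
      good-removal a N p′ K alive gain = +-cancelʳ-≤ (N * W₂) _ _ (begin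
        Φ (remove a K) * N + p′ * Φ a + N * W₂  ≡⟨ +-assoc (Φ (remove a K) * N) (p′ * Φ a) (N * W₂) ⟩
        Φ (remove a K) * N + (p′ * Φ a + N * W₂)  ≤⟨ +-monoʳ-≤ (Φ (remove a K) * N) gain ⟩
        Φ (remove a K) * N + N * W  ≡⟨ lem₁ (Φ (remove a K)) N W ⟩
        N * (Φ (remove a K) + W)  ≤⟨ *-monoʳ-≤ N (Φ-remove a K alive) ⟩
        N * (Φ a + W₂)  ≡⟨ lem₂ N (Φ a) W₂ ⟩
        Φ a * N + N * W₂  ∎)
        where
        open ≤-Reasoning
        W = ∑ λ j → weight a j (K j)
        W₂ = pairSum λ i j → weight₂ a i (K i) j (K j)
        lem₁ : ∀ a b c → a * b + b * c ≡ b * (a + c)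
        lem₁ = solve-∀
        lem₂ : ∀ a b c → a * (b + c) ≡ b * a + a * c
        lem₂ = solve-∀

  -- Reindexing and cyclic orders of the parts

  ∑-reindex : ∀ {k} (π π⁻¹ : Fin k → Fin k) → (∀ i → π⁻¹ (π i) ≡ i) → (∀ i → π (π⁻¹ i) ≡ i) →
    (f : Fin k → ℕ) → ∑ (λ i → f (π i)) ≡ ∑ f
  ∑-reindex π π⁻¹ left right f = begin
    ∑ (λ i → f (π i))  ≡⟨ ∑-cong (λ i → sym (∑-delta (π i) f)) ⟩
    ∑ (λ i → ∑ λ j → f j * bit (does (j Fin.≟ π i)))  ≡⟨ ∑-swap (λ i j → f j * bit (does (j Fin.≟ π i))) ⟩
    ∑ (λ j → ∑ λ i → f j * bit (does (j Fin.≟ π i)))  ≡⟨ ∑-cong (λ j → ∑-cong λ i → cong (λ b → f j * bit b) (flip j i)) ⟩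
    ∑ (λ j → ∑ λ i → f j * bit (does (i Fin.≟ π⁻¹ j)))  ≡⟨ ∑-cong (λ j → ∑-delta (π⁻¹ j) (λ _ → f j)) ⟩
    ∑ f  ∎
    where
    open ≡-Reasoning
    flip : ∀ j i → does (j Fin.≟ π i) ≡ does (i Fin.≟ π⁻¹ j)
    flip j i with j Fin.≟ π i | i Fin.≟ π⁻¹ j
    ... | yes _ | yes _ = refl
    ... | no _  | no _  = refl
    ... | yes j≡ | no i≢ = contradiction (trans (sym (left i)) (cong π⁻¹ (sym j≡))) i≢
    ... | no j≢ | yes i≡ = contradiction (trans (sym (right j)) (cong π (sym i≡))) j≢

  -- diff s is the reflection i ↦ s − i of ℤ/k; (i , j) ↦ i ⊕ j is addition.
  module Cyclic (k : ℕ) where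
    diff : Fin k → Fin k → Fin k
    diff s i with toℕ i ≤? toℕ s
    ... | yes i≤s = fromℕ< {toℕ s ∸ toℕ i} (≤-<-trans (m∸n≤m (toℕ s) (toℕ i)) (toℕ<n s))
    ... | no i≰s = fromℕ< {toℕ s + (k ∸ toℕ i)} (subst (toℕ s + (k ∸ toℕ i) <_) (m+[n∸m]≡n (<⇒≤ (toℕ<n i))) (+-monoˡ-< (k ∸ toℕ i) (≰⇒> i≰s)))

    _⊕_ : Fin k → Fin k → Fin k
    i ⊕ j with toℕ i + toℕ j <? k
    ... | yes i+j<k = fromℕ< i+j<k
    ... | no i+j≮k = fromℕ< {toℕ i + toℕ j ∸ k} (subst (toℕ i + toℕ j ∸ k <_) (m+n∸n≡m k k) (∸-monoˡ-< (+-mono-<-≤ (toℕ<n i) (<⇒≤ (toℕ<n j))) (≮⇒≥ i+j≮k)))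

    data Diff (s i : Fin k) : Set where
      direct : toℕ (diff s i) + toℕ i ≡ toℕ s → Diff s i
      wrap  : toℕ (diff s i) + toℕ i ≡ toℕ s + k → Diff s i

    diff-spec : ∀ s i → Diff s i
    diff-spec s i with toℕ i ≤? toℕ s in eq
    ... | yes i≤s = direct (trans (cong (λ d → toℕ d + toℕ i) d≡) (trans (cong (_+ toℕ i) (toℕ-fromℕ< _)) (m∸n+n≡m i≤s)))
      where
      d≡ : diff s i ≡ fromℕ< {toℕ s ∸ toℕ i} (≤-<-trans (m∸n≤m (toℕ s) (toℕ i)) (toℕ<n s))
      d≡ rewrite eq = refl
    ... | no i≰s = wrap (trans (cong (λ d → toℕ d + toℕ i) d≡) (trans (cong (_+ toℕ i) (toℕ-fromℕ< _))
            (trans (+-assoc (toℕ s) (k ∸ toℕ i) (toℕ i)) (cong (toℕ s +_) (m∸n+n≡m (<⇒≤ (toℕ<n i)))))))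
      where
      d≡ : diff s i ≡ fromℕ< {toℕ s + (k ∸ toℕ i)} (subst (toℕ s + (k ∸ toℕ i) <_) (m+[n∸m]≡n (<⇒≤ (toℕ<n i))) (+-monoˡ-< (k ∸ toℕ i) (≰⇒> i≰s)))
      d≡ rewrite eq = refl

    -- Addition modulo `k` is cancellative. In the mixed cases the equation without wrap-around
    -- gives `b ≤ s`, and then the other one forces its summand up to `k`.
    unique : ∀ {a b s a′ : Fin k} → (toℕ a + toℕ b ≡ toℕ s) ⊎ (toℕ a + toℕ b ≡ toℕ s + k) →
      (toℕ a′ + toℕ b ≡ toℕ s) ⊎ (toℕ a′ + toℕ b ≡ toℕ s + k) → a ≡ a′
    unique {a} {b} {s} {a′} (inj₁ p) (inj₁ q) = toℕ-injective (+-cancelʳ-≡ (toℕ b) _ _ (trans p (sym q)))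
    unique {a} {b} {s} {a′} (inj₂ p) (inj₂ q) = toℕ-injective (+-cancelʳ-≡ (toℕ b) _ _ (trans p (sym q)))
    unique {a} {b} {s} {a′} (inj₁ p) (inj₂ q) = contradiction (toℕ<n a′) (≤⇒≯ (+-cancelʳ-≤ (toℕ b) k (toℕ a′)
      (subst (k + toℕ b ≤_) (sym q) (subst (k + toℕ b ≤_) (+-comm k (toℕ s)) (+-monoʳ-≤ k (subst (toℕ b ≤_) p (m≤n+m (toℕ b) (toℕ a))))))))
    unique {a} {b} {s} {a′} (inj₂ p) (inj₁ q) = contradiction (toℕ<n a) (≤⇒≯ (+-cancelʳ-≤ (toℕ b) k (toℕ a)
      (subst (k + toℕ b ≤_) (sym p) (subst (k + toℕ b ≤_) (+-comm k (toℕ s)) (+-monoʳ-≤ k (subst (toℕ b ≤_) q (m≤n+m (toℕ b) (toℕ a′))))))))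

    diff-eq : ∀ s i → (toℕ (diff s i) + toℕ i ≡ toℕ s) ⊎ (toℕ (diff s i) + toℕ i ≡ toℕ s + k)
    diff-eq s i with diff-spec s i
    ... | direct p = inj₁ p
    ... | wrap p  = inj₂ p

    ⊕-eq : ∀ i j → (toℕ i + toℕ j ≡ toℕ (i ⊕ j)) ⊎ (toℕ i + toℕ j ≡ toℕ (i ⊕ j) + k)
    ⊕-eq i j with toℕ i + toℕ j <? k
    ... | yes i+j<k = inj₁ (sym (toℕ-fromℕ< i+j<k))
    ... | no i+j≮k = inj₂ (sym (trans (cong (_+ k) (toℕ-fromℕ< _)) (m∸n+n≡m (≮⇒≥ i+j≮k))))

    diff-involutive : ∀ s i → diff s (diff s i) ≡ i
    diff-involutive s i = unique (diff-eq s (diff s i)) (comm (toℕ (diff s i)) (toℕ i) (diff-eq s i))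
      where
      comm : ∀ a b {c d} → (a + b ≡ c) ⊎ (a + b ≡ d) → (b + a ≡ c) ⊎ (b + a ≡ d)
      comm a b (inj₁ p) = inj₁ (trans (+-comm b a) p)
      comm a b (inj₂ p) = inj₂ (trans (+-comm b a) p)

    diff-⊕ : ∀ i j → diff (i ⊕ j) j ≡ i
    diff-⊕ i j = unique (diff-eq (i ⊕ j) j) (⊕-eq i j)

    ⊕-diff : ∀ s j → diff s j ⊕ j ≡ s
    ⊕-diff s j with diff-eq s j | ⊕-eq (diff s j) j
    ... | inj₁ p | inj₁ q = toℕ-injective (trans (sym q) p)
    ... | inj₂ p | inj₂ q = toℕ-injective (+-cancelʳ-≡ k _ _ (trans (sym q) p))
    ... | inj₁ p | inj₂ q = contradiction (toℕ<n s) (≤⇒≯ (subst (k ≤_) (trans (sym q) p) (m≤n+m k _)))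
    ... | inj₂ p | inj₁ q = contradiction (toℕ<n (diff s j ⊕ j)) (≤⇒≯ (subst (k ≤_) (trans (sym p) q) (m≤n+m k _)))

  -- Greedy cliques of at least average weight

  argmax : ∀ {n} (p : Fin n → Bool) (w : Fin n → ℕ) →
    (∀ y → p y ≡ false) ⊎ (∃ λ x → (p x ≡ true) × (∀ y → p y ≡ true → w y ≤ w x))
  argmax {zero}  p w = inj₁ λ ()
  argmax {suc n} p w with argmax (p ∘ suc) (w ∘ suc) | p zero in p₀
  ... | inj₁ none | false = inj₁ λ { zero → p₀ ; (suc y) → none y }
  ... | inj₁ none | true  = inj₂ (zero , p₀ , λ { zero _ → ≤-refl ; (suc y) py → contradiction (trans (sym (none y)) py) λ () })
  ... | inj₂ (x , px , max) | false = inj₂ (suc x , px , λ { zero py → contradiction (trans (sym p₀) py) λ () ; (suc y) py → max y py })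
  ... | inj₂ (x , px , max) | true with ≤-total (w zero) (w (suc x))
  ...  | inj₁ w₀≤ = inj₂ (suc x , px , λ { zero _ → w₀≤ ; (suc y) py → max y py })
  ...  | inj₂ ≤w₀ = inj₂ (zero , p₀ , λ { zero _ → ≤-refl ; (suc y) py → ≤-trans (max y py) ≤w₀ })

  ∑-below : ∀ B w → ∑ {B} (λ t → bit (toℕ t <ᵇ w)) ≡ B ⊓ w
  ∑-below zero  w  = refl
  ∑-below (suc B) zero  = ∑-0 B
  ∑-below (suc B) (suc w) = cong suc (∑-below B w)

  module LayerCake {n : ℕ} (a : Fin n → Bool) (w : Fin n → ℕ) where
    above : ℕ → ℕ
    above t = ∑ λ y → bit (a y) * bit (t <ᵇ w y)

    above-antimono : ∀ {s t} → s ≤ t → above t ≤ above s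
    above-antimono {s} {t} s≤t = ∑-mono λ y → *-monoʳ-≤ (bit (a y)) (lem (w y))
      where
      lem : ∀ v → bit (t <ᵇ v) ≤ bit (s <ᵇ v)
      lem v with t <ᵇ v in t<v | s <ᵇ v in s<v
      ... | false | _  = z≤n
      ... | true  | true  = ≤-refl
      ... | true  | false = contradiction (<⇒<ᵇ (≤-<-trans s≤t (<ᵇ⇒< t v (subst T (sym t<v) tt)))) (λ h → subst T s<v h)

    above-total : ∀ t → above t ≤ ∑ (λ y → bit (a y))
    above-total t = ∑-mono λ y → ≤-trans (*-monoʳ-≤ (bit (a y)) (bit≤1 (t <ᵇ w y))) (≤-reflexive (*-identityʳ (bit (a y))))

    -- The first `i` with `M i ≤ t` bounds `above t` by `(o + i) * g`, and all indices before it are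
    -- counted on the right, so `M` need not be sorted. The offset `o` counts indices already
    -- passed.
    above-bound : ∀ g {k} (M : Fin k → ℕ) o t → (∀ i → above (M i) ≤ (o + toℕ i) * g) → ∑ (λ y → bit (a y)) ≤ (o + k) * g →
      above t ≤ (o + ∑ (λ i → bit (t <ᵇ M i))) * g
    above-bound g {zero}  M o t ranks size = ≤-trans (above-total t) size
    above-bound g {suc k} M o t ranks size with t <ᵇ M zero in t<M
    ... | true  = subst (λ z → above t ≤ z * g) (sym (+-suc o _))
          (above-bound g (M ∘ suc) (suc o) t (λ i → subst (λ z → above (M (suc i)) ≤ z * g) (+-suc o (toℕ i)) (ranks (suc i)))
            (subst (λ z → ∑ (λ y → bit (a y)) ≤ z * g) (+-suc o k) size))
    ... | false = ≤-trans (above-antimono (≮⇒≥ λ t<M₀ → subst T t<M (<⇒<ᵇ t<M₀)))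
          (≤-trans (ranks zero) (*-monoˡ-≤ g (+-monoʳ-≤ o z≤n)))

    -- The previous bound, summed over all thresholds `t`. With `M i` the weight chosen from this
    -- part when it is served in position `i`, the choices over all positions capture the total
    -- weight divided by `g`.
    sum-bound : ∀ g {k} (M : Fin k → ℕ) → (∀ i → above (M i) ≤ toℕ i * g) → ∑ (λ y → bit (a y)) ≤ k * g →
      ∑ (λ y → bit (a y) * w y) ≤ ∑ M * g
    sum-bound g {k} M ranks size = begin
      ∑ (λ y → bit (a y) * w y)
        ≡⟨ ∑-cong (λ y → cong (bit (a y) *_) (sym (trans (∑-below B (w y)) (m≥n⇒m⊓n≡n (term≤∑ w y))))) ⟩
      ∑ (λ y → bit (a y) * ∑ {B} (λ t → bit (toℕ t <ᵇ w y)))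
        ≡⟨ ∑-cong (λ y → sym (∑-*ˡ (bit (a y)) (λ (t : Fin B) → bit (toℕ t <ᵇ w y)))) ⟩
      ∑ (λ y → ∑ {B} (λ t → bit (a y) * bit (toℕ t <ᵇ w y)))
        ≡⟨ ∑-swap (λ y (t : Fin B) → bit (a y) * bit (toℕ t <ᵇ w y)) ⟩
      ∑ {B} (λ t → above (toℕ t))
        ≤⟨ ∑-mono {B} (λ t → above-bound g M 0 (toℕ t) ranks size) ⟩
      ∑ {B} (λ t → ∑ (λ i → bit (toℕ t <ᵇ M i)) * g)
        ≡⟨ ∑-*ʳ g (λ (t : Fin B) → ∑ (λ i → bit (toℕ t <ᵇ M i))) ⟩
      ∑ {B} (λ t → ∑ (λ i → bit (toℕ t <ᵇ M i))) * g
        ≡⟨ cong (_* g) (∑-swap (λ (t : Fin B) i → bit (toℕ t <ᵇ M i))) ⟩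
      ∑ (λ i → ∑ {B} (λ t → bit (toℕ t <ᵇ M i))) * g
        ≤⟨ *-monoˡ-≤ g (∑-mono λ i → ≤-trans (≤-reflexive (∑-below B (M i))) (m⊓n≤n B (M i))) ⟩
      ∑ M * g ∎
      where
      open ≤-Reasoning
      B = ∑ w

  module Greedy {k n : ℕ} (cf : Fin k → Fin n → Fin k → Fin n → Bool) (a : Fin k → Fin n → Bool) (w : Fin k → Fin n → ℕ)
    (N q : ℕ) (0<N : 0 < N) (kq≤N : k * q ≤ N)
    (size : ∀ j → ∑ (λ y → bit (a j y)) ≡ N)
    (few : ∀ i x j → ∑ (λ y → bit (a j y) * bit (cf i x j y)) ≤ q) where

    open LayerCake

    mq<N : ∀ {m} → m < k → m * q < N
    mq<N {m} m<k = aux q kq≤N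
      where
      aux : ∀ q → k * q ≤ N → m * q < N
      aux zero  _  = subst (_< N) (sym (*-zeroʳ m)) 0<N
      aux (suc q) kq≤N = <-≤-trans (*-monoˡ-< (suc q) m<k) kq≤N

    -- Parts are served from the end of `pt` to its front. When `pt l` is served, `m ∸ suc l`
    -- vertices are fixed, each excluding at most `q` candidates; only excluded candidates can be
    -- heavier than the one taken, whence `rank`.
    record Chain {m} (pt : Fin m → Fin k) : Set where
      field
        x  : Fin m → Fin n
        alive  : ∀ l → a (pt l) (x l) ≡ true
        compatible : ∀ l l′ → toℕ l < toℕ l′ → cf (pt l′) (x l′) (pt l) (x l) ≡ false
        rank  : ∀ l → above (a (pt l)) (w (pt l)) (w (pt l) (x l)) ≤ (m ∸ suc (toℕ l)) * q

    bit-∧-not : ∀ b c → (b ∧ not c ≡ false) → bit b ≤ bit b * bit c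
    bit-∧-not true  true  _ = ≤-refl
    bit-∧-not false c  _ = z≤n

    chain : ∀ {m} (pt : Fin m → Fin k) → m ≤ k → Chain pt
    chain {zero} pt _ = record { x = λ () ; alive = λ () ; compatible = λ () ; rank = λ () }
    chain {suc m} pt m<k = extend (argmax free (w j))
      where
      rest : Chain (pt ∘ suc)
      rest = chain (pt ∘ suc) (<⇒≤ m<k)
      open Chain rest renaming (x to x′)
      j = pt zero
      killers : Fin n → ℕ
      killers y = ∑ λ l → bit (cf (pt (suc l)) (x′ l) j y)
      free : Fin n → Bool
      free y = a j y ∧ not (0 <ᵇ killers y)
      positive : ∀ y → bit (0 <ᵇ killers y) ≤ killers y
      positive y with killers y
      ... | zero  = z≤n
      ... | suc _ = s≤s z≤n
      killed≤ : ∑ (λ y → bit (a j y) * killers y) ≤ m * q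
      killed≤ = begin
        ∑ (λ y → bit (a j y) * killers y)  ≡⟨ ∑-cong (λ y → sym (∑-*ˡ (bit (a j y)) (λ l → bit (cf (pt (suc l)) (x′ l) j y)))) ⟩
        ∑ (λ y → ∑ λ l → bit (a j y) * bit (cf (pt (suc l)) (x′ l) j y))  ≡⟨ ∑-swap (λ y l → bit (a j y) * bit (cf (pt (suc l)) (x′ l) j y)) ⟩
        ∑ (λ l → ∑ λ y → bit (a j y) * bit (cf (pt (suc l)) (x′ l) j y))  ≤⟨ ∑-mono (λ l → few (pt (suc l)) (x′ l) j) ⟩
        ∑ {m} (λ _ → q)  ≡⟨ ∑-const m q ⟩
        m * q  ∎
        where open ≤-Reasoning
      free-split : ∀ y → free y ≡ true → (a j y ≡ true) × (killers y ≡ 0)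
      free-split y fy with a j y | killers y
      ... | true | zero = refl , refl
      ∑≡0 : ∀ {r} (f : Fin r → ℕ) → ∑ f ≡ 0 → ∀ i → f i ≡ 0
      ∑≡0 f f≡0 i = n≤0⇒n≡0 (subst (f i ≤_) f≡0 (term≤∑ f i))
      bit≡0 : ∀ b → bit b ≡ 0 → b ≡ false
      bit≡0 false _ = refl
      extend : (∀ y → free y ≡ false) ⊎ (∃ λ v → (free v ≡ true) × (∀ y → free y ≡ true → w j y ≤ w j v)) → Chain pt
      -- If nothing is free, the `m < k` vertices fixed so far exclude all `N` survivors of the
      -- part.
      extend (inj₁ none) = contradiction (≤-<-trans N≤ (mq<N m<k)) (<-irrefl refl)
        where
        N≤ : N ≤ m * q
        N≤ = ≤-trans (≤-reflexive (sym (size j))) (≤-trans (∑-mono λ y → ≤-trans (bit-∧-not (a j y) (0 <ᵇ killers y) (none y)) (*-monoʳ-≤ (bit (a j y)) (positive y))) killed≤)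
      extend (inj₂ (v , fv , max)) = record
        { x = λ { zero → v ; (suc l) → x′ l }
        ; alive = λ { zero → proj₁ (free-split v fv) ; (suc l) → alive l }
        ; compatible = λ { zero (suc l) _ → bit≡0 _ (∑≡0 (λ l → bit (cf (pt (suc l)) (x′ l) j v)) (proj₂ (free-split v fv)) l)
                         ; (suc l) (suc l′) (s≤s l<l′) → compatible l l′ l<l′ }
        ; rank = λ { zero → ≤-trans (∑-mono better-killed) killed≤ ; (suc l) → rank l }
        }
        where
        better-killed : ∀ y → bit (a j y) * bit (w j v <ᵇ w j y) ≤ bit (a j y) * killers y
        better-killed y with free y in fy
        ... | false = ≤-trans (*-monoʳ-≤ (bit (a j y)) (bit≤1 (w j v <ᵇ w j y)))
                        (≤-trans (≤-reflexive (*-identityʳ (bit (a j y)))) (≤-trans (bit-∧-not (a j y) (0 <ᵇ killers y) fy) (*-monoʳ-≤ (bit (a j y)) (positive y))))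
        ... | true with w j v <ᵇ w j y in lt
        ...  | false = ≤-trans (≤-reflexive (*-zeroʳ (bit (a j y)))) z≤n
        ...  | true  = contradiction (<ᵇ⇒< (w j v) (w j y) (subst T (sym lt) tt)) (≤⇒≯ (max y fy))

    module _ (cf-sym : ∀ i x j y → cf i x j y ≡ cf j y i x) (0<k : 0 < k) (g : ℕ) (q≤g : q ≤ g) (N≤kg : N ≤ k * g) where
      open Cyclic k

      clique : ∀ (s : Fin k) → ∃ λ (K : Fin k → Fin n) → (∀ j → a j (K j) ≡ true) ×
        (∀ i j → i ≢ j → cf i (K i) j (K j) ≡ false) × (∀ j → above (a j) (w j) (w j (K j)) ≤ toℕ (diff s j) * g)
      clique s = K , (λ j → subst (λ z → a z (K j) ≡ true) (pt-at j) (alive (at j))) , no-conflict ,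
        λ j → ≤-trans (subst₂ (λ z r → above (a z) (w z) (w z (K j)) ≤ r * q) (pt-at j) (rank-at j) (rank (at j))) (*-monoʳ-≤ (toℕ (diff s j)) q≤g)
        where
        pt : Fin k → Fin k
        -- `Chain` serves the last index first; `opposite` undoes this, so that part `diff s i` is
        -- served after exactly `i` others.
        pt l = diff s (opposite l)
        open Chain (chain pt ≤-refl)
        at : Fin k → Fin k
        at j = opposite (diff s j)
        K : Fin k → Fin n
        K j = x (at j)
        pt-at : ∀ j → pt (at j) ≡ j
        pt-at j = trans (cong (diff s) (opposite-involutive (diff s j))) (diff-involutive s j)
        rank-at : ∀ j → k ∸ suc (toℕ (at j)) ≡ toℕ (diff s j)
        rank-at j = trans (sym (opposite-prop (at j))) (cong toℕ (opposite-involutive (diff s j)))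
        later : ∀ i j → toℕ (at i) < toℕ (at j) → cf j (K j) i (K i) ≡ false
        later i j lt = subst₂ (λ u v → cf v (K j) u (K i) ≡ false) (pt-at i) (pt-at j) (compatible (at i) (at j) lt)
        no-conflict : ∀ i j → i ≢ j → cf i (K i) j (K j) ≡ false
        no-conflict i j i≢j with <-cmp (toℕ (at i)) (toℕ (at j))
        ... | tri< lt _ _ = trans (cf-sym i (K i) j (K j)) (later i j lt)
        ... | tri> _ _ gt = later j i gt
        ... | tri≈ _ eq _ = contradiction (trans (sym (pt-at i)) (trans (cong pt (toℕ-injective eq)) (pt-at j))) i≢j

      -- The k cyclic orders put every part once at every position.
      heavy-clique : ∃ λ (K : Fin k → Fin n) → (∀ j → a j (K j) ≡ true) × (∀ i j → i ≢ j → cf i (K i) j (K j) ≡ false) ×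
        (∑ (λ j → ∑ λ y → bit (a j y) * w j y) ≤ k * g * ∑ (λ j → w j (K j)))
      heavy-clique with argmax {k} (λ _ → true) (λ s → ∑ λ j → w j (proj₁ (clique s) j))
      ... | inj₁ none = contradiction (none (fromℕ< 0<k)) λ ()
      ... | inj₂ (s , _ , max) = K s , proj₁ (proj₂ (clique s)) , proj₁ (proj₂ (proj₂ (clique s))) , (begin
        ∑ (λ j → ∑ λ y → bit (a j y) * w j y)  ≤⟨ ∑-mono per-part ⟩
        ∑ (λ j → ∑ (λ s → w j (K s j)) * g)  ≡⟨ ∑-*ʳ g (λ j → ∑ λ s → w j (K s j)) ⟩
        ∑ (λ j → ∑ λ s → w j (K s j)) * g  ≡⟨ cong (_* g) (∑-swap λ j s → w j (K s j)) ⟩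
        ∑ (λ s → ∑ λ j → w j (K s j)) * g  ≤⟨ *-monoˡ-≤ g (≤-trans (∑-mono λ s′ → max s′ refl) (≤-reflexive (∑-const k (∑ λ j → w j (K s j))))) ⟩
        k * ∑ (λ j → w j (K s j)) * g  ≡⟨ lem k (∑ λ j → w j (K s j)) g ⟩
        k * g * ∑ (λ j → w j (K s j))  ∎)
        where
        open ≤-Reasoning
        K : Fin k → Fin k → Fin n
        K s = proj₁ (clique s)
        lem : ∀ a b c → a * b * c ≡ a * c * b
        lem = solve-∀
        per-part : ∀ j → ∑ (λ y → bit (a j y) * w j y) ≤ ∑ (λ s → w j (K s j)) * g
        -- `i ⊕ j` is the order in which part `j` has position `i`.
        per-part j = ≤-trans (sum-bound (a j) (w j) g (λ i → w j (K (i ⊕ j) j))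
            (λ i → subst (λ z → above (a j) (w j) (w j (K (i ⊕ j) j)) ≤ toℕ z * g) (diff-⊕ i j) (proj₂ (proj₂ (proj₂ (clique (i ⊕ j)))) j))
            (≤-trans (≤-reflexive (size j)) N≤kg))
          (≤-reflexive (cong (_* g) (∑-reindex (_⊕ j) (λ s → diff s j) (λ i → diff-⊕ i j) (λ s → ⊕-diff s j) (λ s → w j (K s j)))))

  -- Decay of the potential and repeated extraction

  bernoulli : ∀ M q → suc M * suc M ^ q ≤ suc M * M ^ q + q * suc M ^ q
  bernoulli M zero  = ≤-reflexive (sym (+-identityʳ _))
  bernoulli M (suc q) = begin
    suc M * (suc M * suc M ^ q)  ≤⟨ *-monoʳ-≤ (suc M) (bernoulli M q) ⟩
    suc M * (suc M * M ^ q + q * suc M ^ q)  ≡⟨ lem M q (M ^ q) (suc M ^ q) ⟩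
    suc M * (M * M ^ q) + (suc M * M ^ q + q * (suc M * suc M ^ q))  ≤⟨ +-monoʳ-≤ (suc M * (M * M ^ q)) (+-monoˡ-≤ (q * (suc M * suc M ^ q)) (*-monoʳ-≤ (suc M) (^-monoˡ-≤ q (n≤1+n M)))) ⟩
    suc M * (M * M ^ q) + (suc M * suc M ^ q + q * (suc M * suc M ^ q)) ∎
    where
    open ≤-Reasoning
    lem : ∀ M q a b → suc M * (suc M * a + q * b) ≡ suc M * (M * a) + (suc M * a + q * (suc M * b))
    lem = solve-∀

  -- Bernoulli's inequality turns the factor 1 − q/N into (1 − 1/N) ^ q.
  decay : ∀ M q Φ Φ′ → Φ′ * suc M + q * Φ ≤ Φ * suc M → Φ′ * suc M ^ q ≤ Φ * M ^ q
  decay M q Φ Φ′ h = *-cancelˡ-≤ (suc M) (+-cancelʳ-≤ (q * Φ * suc M ^ q) _ _ (begin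
    suc M * (Φ′ * X) + q * Φ * X  ≡⟨ lem₁ (suc M) Φ′ X (q * Φ) ⟩
    (Φ′ * suc M + q * Φ) * X  ≤⟨ *-monoˡ-≤ X h ⟩
    Φ * suc M * X  ≡⟨ *-assoc Φ (suc M) X ⟩
    Φ * (suc M * X)  ≤⟨ *-monoʳ-≤ Φ (bernoulli M q) ⟩
    Φ * (suc M * M ^ q + q * X)  ≡⟨ lem₂ Φ (suc M) (M ^ q) q X ⟩
    suc M * (Φ * M ^ q) + q * Φ * X  ∎))
    where
    open ≤-Reasoning
    X = suc M ^ q
    lem₁ : ∀ a b c d → a * (b * c) + d * c ≡ (b * a + d) * c
    lem₁ = solve-∀
    lem₂ : ∀ a b c d e → a * (b * c + d * e) ≡ b * (a * c) + d * a * e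
    lem₂ = solve-∀

  module Extraction {k n : ℕ} (G : Conflicts k n) (B : ℕ) {{_ : NonZero B}} (p p′ E Φ₀ : ℕ) where
    open Conflicts G
    open BlockTests G B
    open Potential p
    open Tests blockTest

    Parts : (Fin k → Fin n → Bool) → ℕ → Set
    Parts a N = ∀ j → ∑ (λ y → bit (a j y)) ≡ N

    record Packing (a : Fin k → Fin n → Bool) (N : ℕ) : Set where
      field
        m  : ℕ
        m≤N  : m ≤ N
        leftover  : E * (N ∸ m) ≤ n
        f  : Fin m → Fin k → Fin n
        alive  : ∀ c j → a j (f c j) ≡ true
        clique  : ∀ c i j → i ≢ j → cf i (f c i) j (f c j) ≡ false
        disjoint  : ∀ c c′ j → f c j ≡ f c′ j → c ≡ c′

    module _ (step : ∀ a N → 0 < N → Parts a N → n < E * N → Φ a * n ^ p′ ≤ Φ₀ * N ^ p′ → GoodStep p a N p′) where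
      -- The inequality between `Φ a` and `Φ₀` is all that is remembered of the past: `step` must
      -- succeed for any survivors that satisfy it. `decay` restores it for `N ∸ 1`, and the
      -- recursion stops once `E * N ≤ n`.
      packing : ∀ a N → Parts a N → Φ a * n ^ p′ ≤ Φ₀ * N ^ p′ → Packing a N
      packing a zero parts inv = record
        { m = 0 ; m≤N = z≤n ; leftover = subst (_≤ n) (sym (*-zeroʳ E)) z≤n ; f = λ () ; alive = λ () ; clique = λ () ; disjoint = λ () }
      packing a (suc M) parts inv with E * suc M ≤? n
      ... | yes small = record
        { m = 0 ; m≤N = z≤n ; leftover = small ; f = λ () ; alive = λ () ; clique = λ () ; disjoint = λ () }
      ... | no large = record
        { m = suc (Packing.m rest)
        ; m≤N = s≤s (Packing.m≤N rest)
        ; leftover = Packing.leftover rest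
        ; f = f
        ; alive = λ { zero j → alive j ; (suc c) j → proj₁ (survivor j (Packing.f rest c j) (Packing.alive rest c j)) }
        ; clique = λ { zero → compatible ; (suc c) → Packing.clique rest c }
        ; disjoint = disjoint
        }
        where
        good : GoodStep p a (suc M) p′
        good = step a (suc M) (s≤s z≤n) parts (≰⇒> large) inv
        K = proj₁ good
        alive = proj₁ (proj₂ good)
        compatible = proj₁ (proj₂ (proj₂ good))
        a′ = remove a K
        survivor : ∀ j y → a′ j y ≡ true → (a j y ≡ true) × (y ≢ K j)
        survivor j y alive′ with a j y | y Fin.≟ K j
        ... | true | no y≢ = refl , y≢
        parts′ : Parts a′ M
        parts′ j = suc-injective (begin
          suc (∑ λ y → bit (a′ j y))  ≡⟨ +-comm 1 _ ⟩
          ∑ (λ y → bit (a′ j y)) + 1  ≡⟨ cong (_+ 1) (∑-cong λ y → sym (*-identityʳ (bit (a′ j y)))) ⟩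
          ∑ (λ y → bit (a′ j y) * 1) + 1  ≡⟨ sym (remove-count (a j) (λ _ → 1) (K j) (alive j)) ⟩
          ∑ (λ y → bit (a j y) * 1)  ≡⟨ ∑-cong (λ y → *-identityʳ (bit (a j y))) ⟩
          ∑ (λ y → bit (a j y))  ≡⟨ parts j ⟩
          suc M  ∎)
          where open ≡-Reasoning
        inv′ : Φ a′ * n ^ p′ ≤ Φ₀ * M ^ p′
        inv′ = *-cancelˡ-≤ (suc M ^ p′) {{m^n≢0 (suc M) p′}} (begin
          suc M ^ p′ * (Φ a′ * n ^ p′)  ≡⟨ lem (suc M ^ p′) (Φ a′) (n ^ p′) ⟩
          Φ a′ * suc M ^ p′ * n ^ p′  ≤⟨ *-monoˡ-≤ (n ^ p′) (decay M p′ (Φ a) (Φ a′) (proj₂ (proj₂ (proj₂ good)))) ⟩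
          Φ a * M ^ p′ * n ^ p′  ≡⟨ lem′ (Φ a) (M ^ p′) (n ^ p′) ⟩
          M ^ p′ * (Φ a * n ^ p′)  ≤⟨ *-monoʳ-≤ (M ^ p′) inv ⟩
          M ^ p′ * (Φ₀ * suc M ^ p′)  ≡⟨ lem″ (M ^ p′) Φ₀ (suc M ^ p′) ⟩
          suc M ^ p′ * (Φ₀ * M ^ p′)  ∎)
          where
          open ≤-Reasoning
          lem : ∀ a b c → a * (b * c) ≡ b * a * c
          lem = solve-∀
          lem′ : ∀ a b c → a * b * c ≡ b * (a * c)
          lem′ = solve-∀
          lem″ : ∀ a b c → a * (b * c) ≡ c * (b * a)
          lem″ = solve-∀
        rest : Packing a′ M
        rest = packing a′ M parts′ inv′
        f : Fin (suc (Packing.m rest)) → Fin k → Fin n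
        f zero  = K
        f (suc c) = Packing.f rest c
        fresh : ∀ c j → Packing.f rest c j ≢ K j
        fresh c j = proj₂ (survivor j (Packing.f rest c j) (Packing.alive rest c j))
        disjoint : ∀ c c′ j → f c j ≡ f c′ j → c ≡ c′
        disjoint zero  zero  j _  = refl
        disjoint zero  (suc c′) j eq = contradiction (sym eq) (fresh c′ j)
        disjoint (suc c) zero  j eq = contradiction eq (fresh c j)
        disjoint (suc c) (suc c′) j eq = cong suc (Packing.disjoint rest c c′ j eq)

  -- From the potential back to a single test

  ^-* : ∀ a b q → (a * b) ^ q ≡ a ^ q * b ^ q
  ^-* a b zero  = refl
  ^-* a b (suc q) = trans (cong (a * b *_) (^-* a b q)) (lem a b (a ^ q) (b ^ q))
    where
    lem : ∀ a b c d → a * b * (c * d) ≡ a * c * (b * d)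
    lem = solve-∀

  ff-lower : ∀ F p → (F ∸ p) ^ p ≤ ff F p
  ff-lower F zero  = ≤-refl
  ff-lower zero (suc p) = z≤n
  ff-lower (suc F) (suc p) = *-mono-≤ (≤-trans (m∸n≤m F p) (n≤1+n F)) (ff-lower F p)

  ff-upper : ∀ F p → ff F p ≤ F ^ p
  ff-upper F zero  = ≤-refl
  ff-upper zero (suc p) = z≤n
  ff-upper (suc F) (suc p) = *-monoʳ-≤ (suc F) (≤-trans (ff-upper F p) (^-monoˡ-≤ p (n≤1+n F)))

  -- If F were too large, then ff F p ≥ (F − p) ^ p would contradict the bound on Φ, because 2 ^ q exceeds the number R of tests.
  module Moment (l k B n N D E s q p p′ R Φ Φ₀ F : ℕ)
    (p≡ : p ≡ s * q) (p≡′ : p ≡ p′ + q) (0<N : 0 < N) (0<n : 0 < n) (0<B : 0 < B) (0<E : 0 < E) (0<l : 0 < l)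
    (R<2^q : R < 2 ^ q) (s-large : 2 * (E * (4 * l) ^ s) ≤ (4 * l + 1) ^ s)
    (n≤EN : n ≤ E * N) (D-bound : suc l * k * D ≤ l * n)
    (Φ₀≤ : Φ₀ ≤ R * (B * D) ^ p) (inv : Φ * n ^ p′ ≤ Φ₀ * N ^ p′) (ff≤Φ : ff F p ≤ Φ) (p-small : 4 * (suc l * k) * p ≤ B * N) where

    u : ℕ
    u = suc l * k

    -- `D-bound` accounts for the share `4 * l`. Of the two extra units, one absorbs the factor
    -- `(2 * E) ^ (1/s)` lost in taking a `p`-th root, the other the shift from `F` to `F ∸ p` in
    -- the lower bound for `ff F p`.
    4uF≤ : 4 * u * F ≤ (4 * l + 2) * (B * N)
    4uF≤ = ≮⇒≥ λ violated → contradiction (2^q≤R violated) (<⇒≱ R<2^q)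
      where
      module _ (violated : (4 * l + 2) * (B * N) < 4 * u * F) where
        base : (4 * l + 1) * (B * N) ≤ 4 * (u * (F ∸ p))
        base = begin
          (4 * l + 1) * (B * N)  ≡⟨ sym (m+n∸n≡m _ (B * N)) ⟩
          (4 * l + 1) * (B * N) + B * N ∸ B * N  ≡⟨ cong (_∸ B * N) (lem l (B * N)) ⟩
          (4 * l + 2) * (B * N) ∸ B * N  ≤⟨ ∸-mono (<⇒≤ violated) p-small ⟩
          4 * u * F ∸ 4 * u * p  ≡⟨ sym (*-distribˡ-∸ (4 * u) F p) ⟩
          4 * u * (F ∸ p)  ≡⟨ *-assoc 4 u (F ∸ p) ⟩
          4 * (u * (F ∸ p))  ∎
          where
          open ≤-Reasoning
          lem : ∀ l x → (4 * l + 1) * x + x ≡ (4 * l + 2) * x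
          lem = solve-∀

        ^≢0 : ∀ {x} → 0 < x → ∀ r → NonZero (x ^ r)
        ^≢0 {x} 0<x r = m^n≢0 x r {{>-nonZero 0<x}}

        chain : ((4 * l + 1) * (B * N)) ^ p * n ^ p′ ≤ R * (4 * (B * (l * n))) ^ p * N ^ p′
        chain = begin
          ((4 * l + 1) * (B * N)) ^ p * n ^ p′  ≤⟨ *-monoˡ-≤ (n ^ p′) (^-monoˡ-≤ p base) ⟩
          (4 * (u * (F ∸ p))) ^ p * n ^ p′  ≡⟨ cong (_* n ^ p′) (trans (cong (_^ p) (sym (*-assoc 4 u (F ∸ p)))) (^-* (4 * u) (F ∸ p) p)) ⟩
          (4 * u) ^ p * (F ∸ p) ^ p * n ^ p′  ≡⟨ *-assoc ((4 * u) ^ p) _ _ ⟩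
          (4 * u) ^ p * ((F ∸ p) ^ p * n ^ p′)  ≤⟨ *-monoʳ-≤ ((4 * u) ^ p) (≤-trans (*-monoˡ-≤ (n ^ p′) (≤-trans (ff-lower F p) ff≤Φ)) (≤-trans inv (*-monoˡ-≤ (N ^ p′) Φ₀≤))) ⟩
          (4 * u) ^ p * (R * (B * D) ^ p * N ^ p′)  ≡⟨ lem ((4 * u) ^ p) R ((B * D) ^ p) (N ^ p′) ⟩
          R * ((4 * u) ^ p * (B * D) ^ p) * N ^ p′  ≡⟨ cong (λ z → R * z * N ^ p′) (trans (sym (^-* (4 * u) (B * D) p)) (cong (_^ p) (lem′ u B D))) ⟩
          R * (4 * (B * (u * D))) ^ p * N ^ p′  ≤⟨ *-monoˡ-≤ (N ^ p′) (*-monoʳ-≤ R (^-monoˡ-≤ p (*-monoʳ-≤ 4 (*-monoʳ-≤ B D-bound)))) ⟩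
          R * (4 * (B * (l * n))) ^ p * N ^ p′  ∎
          where
          open ≤-Reasoning
          lem : ∀ a b c d → a * (b * c * d) ≡ b * (a * c) * d
          lem = solve-∀
          lem′ : ∀ u B D → 4 * u * (B * D) ≡ 4 * (B * (u * D))
          lem′ = solve-∀

        -- Once the `p′`-th powers cancel, the shrinking from `n` to `N` enters with exponent `q`
        -- only.
        reduced : (4 * l + 1) ^ p * N ^ q ≤ R * (4 * l) ^ p * n ^ q
        reduced = *-cancelˡ-≤ (B ^ p) {{^≢0 0<B p}} (*-cancelˡ-≤ (N ^ p′) {{^≢0 0<N p′}} (*-cancelˡ-≤ (n ^ p′) {{^≢0 0<n p′}} (begin
          n ^ p′ * (N ^ p′ * (B ^ p * ((4 * l + 1) ^ p * N ^ q)))  ≡⟨ lem₁ (n ^ p′) (N ^ p′) (B ^ p) ((4 * l + 1) ^ p) (N ^ q) ⟩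
          (4 * l + 1) ^ p * (B ^ p * (N ^ p′ * N ^ q)) * n ^ p′  ≡⟨ cong (λ z → (4 * l + 1) ^ p * (B ^ p * z) * n ^ p′) (sym (split N)) ⟩
          (4 * l + 1) ^ p * (B ^ p * N ^ p) * n ^ p′  ≡⟨ cong (_* n ^ p′) (sym (trans (^-* (4 * l + 1) (B * N) p) (cong ((4 * l + 1) ^ p *_) (^-* B N p)))) ⟩
          ((4 * l + 1) * (B * N)) ^ p * n ^ p′  ≤⟨ chain ⟩
          R * (4 * (B * (l * n))) ^ p * N ^ p′  ≡⟨ cong (λ z → R * z * N ^ p′) (trans (cong (_^ p) (lem₂ B l n)) (trans (^-* (4 * l) (B * n) p) (cong ((4 * l) ^ p *_) (^-* B n p)))) ⟩
          R * ((4 * l) ^ p * (B ^ p * n ^ p)) * N ^ p′  ≡⟨ cong (λ z → R * ((4 * l) ^ p * (B ^ p * z)) * N ^ p′) (split n) ⟩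
          R * ((4 * l) ^ p * (B ^ p * (n ^ p′ * n ^ q))) * N ^ p′  ≡⟨ lem₃ R ((4 * l) ^ p) (B ^ p) (n ^ p′) (n ^ q) (N ^ p′) ⟩
          n ^ p′ * (N ^ p′ * (B ^ p * (R * (4 * l) ^ p * n ^ q)))  ∎)))
          where
          open ≤-Reasoning
          split : ∀ x → x ^ p ≡ x ^ p′ * x ^ q
          split x = trans (cong (x ^_) p≡′) (^-distribˡ-+-* x p′ q)
          lem₁ : ∀ a b c d e → a * (b * (c * (d * e))) ≡ d * (c * (b * e)) * a
          lem₁ = solve-∀
          lem₂ : ∀ B l n → 4 * (B * (l * n)) ≡ 4 * l * (B * n)
          lem₂ = solve-∀
          lem₃ : ∀ a b c d e f → a * (b * (c * (d * e))) * f ≡ d * (f * (c * (a * b * e)))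
          lem₃ = solve-∀

        X : ℕ
        X = (E * (4 * l) ^ s) ^ q

        2^q≤R : 2 ^ q ≤ R
        2^q≤R = *-cancelʳ-≤ (2 ^ q) R X {{X≢0}} (*-cancelʳ-≤ (2 ^ q * X) (R * X) (N ^ q) {{^≢0 0<N q}} (begin
          2 ^ q * X * N ^ q  ≡⟨ cong (_* N ^ q) (sym (^-* 2 (E * (4 * l) ^ s) q)) ⟩
          -- The `q`-th power of `s-large` produces the factor `2 ^ q`, and its `E ^ q` makes up for
          -- `(n / N) ^ q`.
          (2 * (E * (4 * l) ^ s)) ^ q * N ^ q  ≤⟨ *-monoˡ-≤ (N ^ q) (^-monoˡ-≤ q s-large) ⟩
          ((4 * l + 1) ^ s) ^ q * N ^ q  ≡⟨ cong (_* N ^ q) (power (4 * l + 1)) ⟩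
          (4 * l + 1) ^ p * N ^ q  ≤⟨ reduced ⟩
          R * (4 * l) ^ p * n ^ q  ≤⟨ *-monoʳ-≤ (R * (4 * l) ^ p) (≤-trans (^-monoˡ-≤ q n≤EN) (≤-reflexive (^-* E N q))) ⟩
          R * (4 * l) ^ p * (E ^ q * N ^ q)  ≡⟨ lem R ((4 * l) ^ p) (E ^ q) (N ^ q) ⟩
          R * (E ^ q * (4 * l) ^ p) * N ^ q  ≡⟨ cong (λ z → R * z * N ^ q) (trans (cong (E ^ q *_) (sym (power (4 * l)))) (sym (^-* E ((4 * l) ^ s) q))) ⟩
          R * X * N ^ q  ∎))
          where
          open ≤-Reasoning
          power : ∀ x → (x ^ s) ^ q ≡ x ^ p
          power x = trans (^-*-assoc x s q) (cong (x ^_) (sym p≡))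
          lem : ∀ a b c d → a * b * (c * d) ≡ a * (c * b) * d
          lem = solve-∀
          X≢0 : NonZero X
          X≢0 = m^n≢0 (E * (4 * l) ^ s) q {{m*n≢0 E ((4 * l) ^ s) {{>-nonZero 0<E}} {{m^n≢0 (4 * l) s {{m*n≢0 4 l {{_}} {{>-nonZero 0<l}}}}}}}}

  -- The step with single parts as blocks

  pairSum-zero : ∀ {r} (f : Fin r → Fin r → ℕ) → (∀ i j → i ≢ j → f i j ≡ 0) → pairSum f ≡ 0
  pairSum-zero {zero}  f h = refl
  pairSum-zero {suc r} f h = cong₂ _+_ (trans (∑-cong λ m → h zero (suc m) λ ()) (∑-0 r))
    (pairSum-zero (λ i j → f (suc i) (suc j)) λ i j i≢j → h (suc i) (suc j) λ eq → i≢j (Fin.suc-injective eq))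

  module Small {k n : ℕ} (G : Conflicts k n) (p : ℕ) (a : Fin k → Fin n → Bool) (N F p′ : ℕ) {{_ : NonZero k}}
    (0<N : 0 < N) (part-size : ∀ j → ∑ (λ y → bit (a j y)) ≡ N)
    (size≤F : ∀ t → Potential.Tests.size p (BlockTests.blockTest G 1) a t ≤ F) (kF≤N : k * F ≤ N)
    (p′-small : p′ * (N + k) ≤ (2 + p) * N) where

    open Conflicts G
    open BlockTests G 1
    open Potential p
    open Tests blockTest

    -- For blocks of one part, the conflicts of `x` with part `j` form a test of their own.
    few : ∀ i x j → ∑ (λ y → bit (a j y) * bit (cf i x j y)) ≤ F
    few i x j = ≤-trans (≤-reflexive (sym own)) (≤-trans (term≤∑ (λ j′ → bit (toℕ j′ / 1 ≡ᵇ toℕ j) * deg a j′ i x) j) (block-deg≤ p a F size≤F (toℕ j) i x))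
      where
      own : bit (toℕ j / 1 ≡ᵇ toℕ j) * deg a j i x ≡ deg a j i x
      own = trans (cong (λ z → bit (z ≡ᵇ toℕ j) * deg a j i x) (n/1≡n (toℕ j))) (trans (cong (λ b → bit b * deg a j i x) (≡ᵇ-refl (toℕ j))) (*-identityˡ _))

    -- At least `N / k` rounded up. The rounding, `k * g ≤ N + k`, loses a factor `1 + k / N`, which
    -- `p′-small` provides for.
    g : ℕ
    g = suc (N / k)

    F≤g : F ≤ g
    F≤g = m≤n⇒m≤1+n (≤-trans (≤-reflexive (sym (m*n/m≡n k F))) (/-monoˡ-≤ k kF≤N))
      where
      m*n/m≡n : ∀ m n {{_ : NonZero m}} → m * n / m ≡ n
      m*n/m≡n m n = trans (cong (_/ m) (*-comm m n)) (m*n/n≡m n m)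

    N≤kg : N ≤ k * g
    N≤kg = begin
      N  ≡⟨ m≡m%n+[m/n]*n N k ⟩
      N % k + N / k * k  ≤⟨ +-mono-≤ (<⇒≤ (m%n<n N k)) (≤-reflexive (*-comm (N / k) k)) ⟩
      k + k * (N / k)  ≡⟨ sym (*-suc k (N / k)) ⟩
      k * g  ∎
      where open ≤-Reasoning

    kg≤N+k : k * g ≤ N + k
    kg≤N+k = begin
      k * g  ≡⟨ *-suc k (N / k) ⟩
      k + k * (N / k)  ≤⟨ +-monoʳ-≤ k (≤-trans (≤-reflexive (*-comm k (N / k))) (m/n*n≤m N k)) ⟩
      k + N  ≡⟨ +-comm k N ⟩
      N + k  ∎
      where open ≤-Reasoning

    heavy : ∃ λ (K : Fin k → Fin n) → (∀ j → a j (K j) ≡ true) × (∀ i j → i ≢ j → cf i (K i) j (K j) ≡ false) ×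
      (∑ (λ j → ∑ λ y → bit (a j y) * weight a j y) ≤ k * g * ∑ (λ j → weight a j (K j)))
    heavy = Greedy.heavy-clique cf a (weight a) N F 0<N kF≤N part-size few cf-sym (>-nonZero⁻¹ k) g F≤g N≤kg

    K : Fin k → Fin n
    K = proj₁ heavy

    alive : ∀ j → a j (K j) ≡ true
    alive = proj₁ (proj₂ heavy)

    W : ℕ
    W = ∑ λ j → weight a j (K j)

    pΦ≤ : (2 + p) * Φ a ≤ (N + k) * W
    pΦ≤ = begin
      (2 + p) * Φ a  ≡⟨ sym (weight-total a) ⟩
      ∑ (λ j → ∑ λ y → weight a j y)  ≤⟨ ∑-mono (λ j → ∑-mono λ y → absorb j y (a j y) refl) ⟩
      ∑ (λ j → ∑ λ y → bit (a j y) * weight a j y)  ≤⟨ proj₂ (proj₂ (proj₂ heavy)) ⟩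
      k * g * W  ≤⟨ *-monoˡ-≤ W kg≤N+k ⟩
      (N + k) * W  ∎
      where
      open ≤-Reasoning
      absorb : ∀ j y c → a j y ≡ c → weight a j y ≤ bit c * weight a j y
      absorb j y true  _  = ≤-reflexive (sym (*-identityˡ _))
      absorb j y false dead = ≤-reflexive (weight-alive p a j y dead)

    -- Each test lies inside one part, so no counted tuple contains two vertices of a clique and the
    -- second-order loss vanishes.
    no-pairs : pairSum (λ i j → weight₂ a i (K i) j (K j)) ≡ 0
    no-pairs = pairSum-zero _ λ i j i≢j → trans (∑-cong λ t → vanish i j i≢j t) (∑-0 (k * (n * k)))
      where
      disjoint : ∀ u v c i j (x y : Bool) → i ≢ j → u * bit (x ∧ (i ≡ᵇ c)) * (v * bit (y ∧ (j ≡ᵇ c))) ≡ 0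
      disjoint u v c i j false y i≢j = cong (_* (v * bit (y ∧ (j ≡ᵇ c)))) (*-zeroʳ u)
      disjoint u v c i j true false i≢j = trans (cong (u * bit (i ≡ᵇ c) *_) (*-zeroʳ v)) (*-zeroʳ (u * bit (i ≡ᵇ c)))
      disjoint u v c i j true true i≢j with i ≡ᵇ c in ic | j ≡ᵇ c in jc
      ... | false | w  = cong (_* (v * bit w)) (*-zeroʳ u)
      ... | true  | false = trans (cong (u * 1 *_) (*-zeroʳ v)) (*-zeroʳ (u * 1))
      ... | true  | true  = contradiction (trans (≡ᵇ⇒≡ i c (subst T (sym ic) tt)) (sym (≡ᵇ⇒≡ j c (subst T (sym jc) tt)))) i≢j
      vanish : ∀ i j → i ≢ j → ∀ t → hit a t i (K i) * hit a t j (K j) * ff₂ (size a t ∸ 2) ≡ 0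
      vanish i j i≢j t = cong (_* ff₂ (size a t ∸ 2)) (disjoint (bit (a i (K i))) (bit (a j (K j))) (toℕ (proj₂ (proj₂ (decode t)))) (toℕ i / 1) (toℕ j / 1) _ _
        λ eq → i≢j (Fin.toℕ-injective (trans (sym (n/1≡n (toℕ i))) (trans eq (n/1≡n (toℕ j))))))

    good-step : GoodStep p a N p′
    good-step = K , alive , proj₁ (proj₂ (proj₂ heavy)) , good-removal p a N p′ K alive
        (≤-trans (≤-reflexive (trans (cong (λ z → p′ * Φ a + N * z) no-pairs) (trans (cong (p′ * Φ a +_) (*-zeroʳ N)) (+-identityʳ _)))) p′Φ≤NW)
      where
      instance
        N+k≢0 : NonZero (N + k)
        N+k≢0 = >-nonZero (≤-trans 0<N (m≤m+n N k))
      p′Φ≤NW : p′ * Φ a ≤ N * W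
      p′Φ≤NW = *-cancelˡ-≤ (N + k) (begin
        (N + k) * (p′ * Φ a)  ≡⟨ lem₁ (N + k) p′ (Φ a) ⟩
        p′ * (N + k) * Φ a  ≤⟨ *-monoˡ-≤ (Φ a) p′-small ⟩
        (2 + p) * N * Φ a  ≡⟨ lem₂ (2 + p) N (Φ a) ⟩
        N * ((2 + p) * Φ a)  ≤⟨ *-monoʳ-≤ N pΦ≤ ⟩
        N * ((N + k) * W)  ≡⟨ lem₁ N (N + k) W ⟩
        (N + k) * N * W  ≡⟨ *-assoc (N + k) N W ⟩
        (N + k) * (N * W)  ∎)
        where
        open ≤-Reasoning
        lem₁ : ∀ a b c → a * (b * c) ≡ b * a * c
        lem₁ = solve-∀
        lem₂ : ∀ a b c → a * b * c ≡ b * (a * c)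
        lem₂ = solve-∀

-- Rational arithmetic, averaging and casts

module RationalArgument where
  open import Defs using (ℕtoℚ)
  open import Data.Nat as ℕ using (ℕ; zero; suc; _≡ᵇ_; _<ᵇ_; NonZero; _∸_)
  import Data.Nat.Properties as ℕ
  import Data.Nat.DivMod as ℕ
  import Data.Nat.Tactic.RingSolver as ℕ-Solver
  open import Data.Fin as Fin using (Fin; zero; suc; toℕ)
  import Data.Fin.Properties as Fin
  open import Data.Bool as Bool using (Bool; true; false; _∧_)
  open import Data.Unit using (tt)
  open import Data.Product using (∃; _×_; _,_; proj₁; proj₂)
  open import Data.Sum using (inj₁; inj₂)
  import Data.Integer as ℤ
  import Data.Integer.Properties as ℤ
  open import Data.Rational as ℚ hiding (NonZero)
  open import Data.Rational.Properties
  import Data.Rational.Unnormalised as ℚᵘ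
  import Data.Rational.Unnormalised.Properties as ℚᵘ
  open import Algebra.Bundles using (CommutativeRing)
  open import Relation.Binary.PropositionalEquality
  open import Relation.Binary.Definitions using (tri<; tri≈; tri>)
  open import Relation.Nullary using (does; yes; no; contradiction)
  open import Relation.Nullary.Decidable using (dec⇒maybe)
  open import Tactic.RingSolver using (solve-∀)
  open import Tactic.RingSolver.Core.AlmostCommutativeRing using (AlmostCommutativeRing; fromCommutativeRing)
  open Combinatorics using (bit; ∑-delta; bit≤1; bit-∧; <ᵇ-true; ≡ᵇ-refl; Conflicts; module Conflicts; module BlockTests; module Potential)
    renaming (∑ to ∑ℕ; ∑-mono to ∑ℕ-mono; ∑-+ to ∑ℕ-+; ∑-cong to ∑ℕ-cong; ∑-0 to ∑ℕ-0; pairSum to pairSumℕ)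

  open Summation _+_ _*_ 0ℚ 1ℚ (CommutativeRing.isCommutativeSemiring +-*-commutativeRing) public

  ℚring : AlmostCommutativeRing _ _
  ℚring = fromCommutativeRing +-*-commutativeRing (λ x → dec⇒maybe (0ℚ ≟ x))

  ≤-diff : ∀ {p q} → p ≤ q → 0ℚ ≤ q - p
  ≤-diff {p} {q} p≤q = subst (_≤ q - p) (+-inverseʳ p) (+-monoˡ-≤ (- p) p≤q)

  -- The form of most polynomial inequalities below: an explicit nonnegative difference `r`, and an
  -- identity left to the ring solver.
  ≤-cert : ∀ {p q} r → 0ℚ ≤ r → q ≡ p + r → p ≤ q
  ≤-cert {p} {q} r 0≤r q≡ = subst₂ _≤_ (+-identityʳ p) (sym q≡) (+-monoʳ-≤ p 0≤r)

  diff-≤ : ∀ {p q} → 0ℚ ≤ q - p → p ≤ q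
  diff-≤ {p} {q} h = ≤-cert (q - p) h (lem p q)
    where
    lem : ∀ p q → q ≡ p + (q - p)
    lem = solve-∀ ℚring

  0≤+ : ∀ {p q} → 0ℚ ≤ p → 0ℚ ≤ q → 0ℚ ≤ p + q
  0≤+ = +-mono-≤

  *-monoˡ : ∀ {r p q} → 0ℚ ≤ r → p ≤ q → r * p ≤ r * q
  *-monoˡ {r} 0≤r = *-monoˡ-≤-nonNeg r {{nonNegative 0≤r}}

  *-monoʳ : ∀ {r p q} → 0ℚ ≤ r → p ≤ q → p * r ≤ q * r
  *-monoʳ {r} 0≤r = *-monoʳ-≤-nonNeg r {{nonNegative 0≤r}}

  0≤* : ∀ {p q} → 0ℚ ≤ p → 0ℚ ≤ q → 0ℚ ≤ p * q
  0≤* {p} {q} 0≤p 0≤q = subst (_≤ p * q) (*-zeroʳ p) (*-monoˡ 0≤p 0≤q)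

  *-mono : ∀ {p q r s} → 0ℚ ≤ p → 0ℚ ≤ s → p ≤ q → r ≤ s → p * r ≤ q * s
  *-mono 0≤p 0≤s p≤q r≤s = ≤-trans (*-monoˡ 0≤p r≤s) (*-monoʳ 0≤s p≤q)

  0<* : ∀ {p q} → 0ℚ < p → 0ℚ < q → 0ℚ < p * q
  0<* {p} {q} 0<p 0<q = subst (_< p * q) (*-zeroʳ p) (*-monoʳ-<-pos p {{positive 0<p}} 0<q)

  *-cancelˡ : ∀ {r p q} → 0ℚ < r → r * p ≤ r * q → p ≤ q
  *-cancelˡ {r} 0<r = *-cancelˡ-≤-pos r {{positive 0<r}}

  0≤sq : ∀ p → 0ℚ ≤ p * p
  0≤sq p with ≤-total 0ℚ p
  ... | inj₁ 0≤p = 0≤* 0≤p 0≤p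
  ... | inj₂ p≤0 = subst (0ℚ ≤_) (lem p) (0≤* 0≤-p 0≤-p)
    where
    0≤-p : 0ℚ ≤ - p
    0≤-p = neg-antimono-≤ p≤0
    lem : ∀ p → (- p) * (- p) ≡ p * p
    lem = solve-∀ ℚring

  sq-cancel-≤ : ∀ {p q} → 0ℚ ≤ q → p * p ≤ q * q → p ≤ q
  sq-cancel-≤ {p} {q} 0≤q h with p ≤? q
  ... | yes p≤q = p≤q
  ... | no p≰q = contradiction (<-≤-trans (≤-<-trans (*-monoˡ 0≤q (<⇒≤ q<p)) (*-monoˡ-<-pos p {{positive (≤-<-trans 0≤q q<p)}} q<p)) h) (<-irrefl refl)
    where q<p = ≰⇒> p≰q

  cube-cancel-≤ : ∀ {p q} → 0ℚ ≤ q → p * p * p ≤ q * q * q → p ≤ q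
  cube-cancel-≤ {p} {q} 0≤q h with p ≤? q
  ... | yes p≤q = p≤q
  ... | no p≰q = contradiction (<-≤-trans (≤-<-trans (*-monoʳ 0≤q (*-mono 0≤q 0≤p q≤p q≤p)) (*-monoʳ-<-pos (p * p) {{positive (0<* 0<p 0<p)}} q<p)) h) (<-irrefl refl)
    where
    q<p = ≰⇒> p≰q
    q≤p = <⇒≤ q<p
    0<p = ≤-<-trans 0≤q q<p
    0≤p = <⇒≤ 0<p

  recip : ∀ p → 0ℚ < p → ∃ λ g → (0ℚ < g) × (g * p ≡ 1ℚ)
  recip p 0<p = 1/ p , positive⁻¹ (1/ p) {{1/pos⇒pos p}} , *-inverseˡ p
    where instance
      p>0 : Positive p
      p>0 = positive 0<p
      p≢0 : ℚ.NonZero p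
      p≢0 = pos⇒nonZero p

  𝟙 : Bool → ℚ
  𝟙 true  = 1ℚ
  𝟙 false = 0ℚ

  0≤1 : 0ℚ ≤ 1ℚ
  0≤1 = nonNegative⁻¹ 1ℚ

  0≤𝟙 : ∀ b → 0ℚ ≤ 𝟙 b
  0≤𝟙 true  = 0≤1
  0≤𝟙 false = ≤-refl

  𝟙≤1 : ∀ b → 𝟙 b ≤ 1ℚ
  𝟙≤1 true  = ≤-refl
  𝟙≤1 false = 0≤1

  ∑-mono : ∀ {n} {f g : Fin n → ℚ} → (∀ i → f i ≤ g i) → ∑ f ≤ ∑ g
  ∑-mono {zero}  f≤g = ≤-refl
  ∑-mono {suc n} f≤g = +-mono-≤ (f≤g zero) (∑-mono λ i → f≤g (suc i))

  0≤∑ : ∀ {n} {f : Fin n → ℚ} → (∀ i → 0ℚ ≤ f i) → 0ℚ ≤ ∑ f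
  0≤∑ {zero}  h = ≤-refl
  0≤∑ {suc n} h = 0≤+ (h zero) (0≤∑ λ i → h (suc i))

  term≤∑ : ∀ {n} {f : Fin n → ℚ} → (∀ i → 0ℚ ≤ f i) → ∀ i → f i ≤ ∑ f
  term≤∑ {suc n} {f} h zero  = ≤-cert _ (0≤∑ λ i → h (suc i)) refl
  term≤∑ {suc n} {f} h (suc i) = ≤-trans (term≤∑ (λ i → h (suc i)) i) (≤-cert _ (h zero) (+-comm (f zero) _))

  ∑-- : ∀ {n} (f g : Fin n → ℚ) → ∑ (λ i → f i - g i) ≡ ∑ f - ∑ g
  ∑-- {zero}  f g = refl
  ∑-- {suc n} f g = trans (cong (λ z → (f zero - g zero) + z) (∑-- (λ i → f (suc i)) (λ i → g (suc i)))) (lem (f zero) (g zero) _ _)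
    where
    lem : ∀ a b c d → (a - b) + (c - d) ≡ (a + c) - (b + d)
    lem = solve-∀ ℚring

  -- The derandomisation: some outcome is at least as good as the mean. Positivity of `ρ y` is asked
  -- for because a positive weight later certifies that a vertex survives and avoids conflicts.
  ∃-above-average : ∀ {n} (ρ f : Fin n → ℚ) V → (∀ y → 0ℚ ≤ ρ y) → 0ℚ < ∑ ρ →
    ∑ ρ * V ≤ ∑ (λ y → ρ y * f y) → ∃ λ y → (0ℚ < ρ y) × (V ≤ f y)
  ∃-above-average {zero} ρ f V 0≤ρ 0<P _ = contradiction 0<P (<-irrefl refl)
  ∃-above-average {suc n} ρ f V 0≤ρ 0<P avg with 0ℚ <? ρ zero
  ∃-above-average {suc n} ρ f V 0≤ρ 0<P avg | no ρ₀≯0 =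
    let y , 0<y , V≤ = ∃-above-average (λ i → ρ (suc i)) (λ i → f (suc i)) V (λ i → 0≤ρ (suc i))
           (subst (0ℚ <_) P≡ 0<P) (subst₂ _≤_ (cong (_* V) P≡) avg≡ avg)
    in suc y , 0<y , V≤
    where
    ρ₀≡0 : ρ zero ≡ 0ℚ
    ρ₀≡0 = ≤-antisym (≮⇒≥ ρ₀≯0) (0≤ρ zero)
    P≡ = trans (cong (_+ ∑ λ i → ρ (suc i)) ρ₀≡0) (+-identityˡ _)
    avg≡ = trans (cong (λ z → z * f zero + ∑ λ i → ρ (suc i) * f (suc i)) ρ₀≡0)
                 (trans (cong (_+ ∑ λ i → ρ (suc i) * f (suc i)) (*-zeroˡ (f zero))) (+-identityˡ _))
  ∃-above-average {suc n} ρ f V 0≤ρ 0<P avg | yes 0<ρ₀ with V ≤? f zero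
  ... | yes V≤ = zero , 0<ρ₀ , V≤
  ... | no V≰ with 0ℚ <? ∑ (λ i → ρ (suc i))
  ...  | yes 0<P′ =
    let y , 0<y , V≤ = ∃-above-average (λ i → ρ (suc i)) (λ i → f (suc i)) V (λ i → 0≤ρ (suc i)) 0<P′ rest
    in suc y , 0<y , V≤
    where
    f₀<V = ≰⇒> V≰
    rest : ∑ (λ i → ρ (suc i)) * V ≤ ∑ (λ i → ρ (suc i) * f (suc i))
    rest = diff-≤ (≤-trans (≤-diff (≤-trans avg (+-monoˡ-≤ _ (*-monoˡ (0≤ρ zero) (<⇒≤ f₀<V)))))
                           (≤-reflexive (lem (ρ zero) _ V _)))
      where
      lem : ∀ a b V d → a * V + d - (a + b) * V ≡ d - b * V
      lem = solve-∀ ℚring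
  ...  | no P′≯0 = contradiction (<-≤-trans (*-monoʳ-<-pos (ρ zero) {{positive 0<ρ₀}} (≰⇒> V≰)) ρ₀V≤) (<-irrefl refl)
    where
    P′≡0 : ∑ (λ i → ρ (suc i)) ≡ 0ℚ
    P′≡0 = ≤-antisym (≮⇒≥ P′≯0) (0≤∑ λ i → 0≤ρ (suc i))
    ρ≡0 : ∀ i → ρ (suc i) ≡ 0ℚ
    ρ≡0 i = ≤-antisym (≤-trans (term≤∑ (λ i → 0≤ρ (suc i)) i) (≤-reflexive P′≡0)) (0≤ρ (suc i))
    ρf≡0 : ∑ (λ i → ρ (suc i) * f (suc i)) ≡ 0ℚ
    ρf≡0 = trans (∑-cong λ i → trans (cong (_* f (suc i)) (ρ≡0 i)) (*-zeroˡ (f (suc i)))) (∑-0 n)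
    ρ₀V≤ : ρ zero * V ≤ ρ zero * f zero
    ρ₀V≤ = subst₂ _≤_ (cong (_* V) (trans (cong (ρ zero +_) P′≡0) (+-identityʳ (ρ zero))))
      (trans (cong (ρ zero * f zero +_) ρf≡0) (+-identityʳ (ρ zero * f zero))) avg

  abstract
    -- Opaque, so that casts move by the homomorphism laws and do not unfold into normalised
    -- fractions.
    ι : ℕ → ℚ
    ι = ℕtoℚ

    toℚᵘ-ι : ∀ n → toℚᵘ (ι n) ℚᵘ.≃ ℚᵘ.mkℚᵘ (ℤ.+ n) 0
    toℚᵘ-ι n = toℚᵘ-fromℚᵘ (ℚᵘ.mkℚᵘ (ℤ.+ n) 0)

    ι-+ : ∀ m n → ι (m ℕ.+ n) ≡ ι m + ι n
    ι-+ m n = toℚᵘ-injective (ℚᵘ.≃-trans (toℚᵘ-ι (m ℕ.+ n)) (ℚᵘ.≃-trans (ℚᵘ.*≡* eq)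
        (ℚᵘ.≃-sym (ℚᵘ.≃-trans (toℚᵘ-homo-+ (ι m) (ι n)) (ℚᵘ.+-cong (toℚᵘ-ι m) (toℚᵘ-ι n))))))
      where
      eq : (ℤ.+ (m ℕ.+ n)) ℤ.* ℤ.1ℤ ≡ ((ℤ.+ m) ℤ.* ℤ.1ℤ ℤ.+ (ℤ.+ n) ℤ.* ℤ.1ℤ) ℤ.* ℤ.1ℤ
      eq = cong (ℤ._* ℤ.1ℤ) (trans (ℤ.pos-+ m n) (sym (cong₂ ℤ._+_ (ℤ.*-identityʳ (ℤ.+ m)) (ℤ.*-identityʳ (ℤ.+ n)))))

    ι-* : ∀ m n → ι (m ℕ.* n) ≡ ι m * ι n
    ι-* m n = toℚᵘ-injective (ℚᵘ.≃-trans (toℚᵘ-ι (m ℕ.* n)) (ℚᵘ.≃-trans (ℚᵘ.*≡* (cong (ℤ._* ℤ.1ℤ) (ℤ.pos-* m n)))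
        (ℚᵘ.≃-sym (ℚᵘ.≃-trans (toℚᵘ-homo-* (ι m) (ι n)) (ℚᵘ.*-cong (toℚᵘ-ι m) (toℚᵘ-ι n))))))

    ι-mono : ∀ {m n} → m ℕ.≤ n → ι m ≤ ι n
    ι-mono {m} {n} m≤n = toℚᵘ-cancel-≤ (ℚᵘ.≤-respˡ-≃ (ℚᵘ.≃-sym (toℚᵘ-ι m)) (ℚᵘ.≤-respʳ-≃ (ℚᵘ.≃-sym (toℚᵘ-ι n))
      (ℚᵘ.*≤* (ℤ.*-monoʳ-≤-nonNeg ℤ.1ℤ (ℤ.+≤+ m≤n)))))

    ι-mono-< : ∀ {m n} → m ℕ.< n → ι m < ι n
    ι-mono-< {m} {n} m<n = toℚᵘ-cancel-< (ℚᵘ.<-respˡ-≃ (ℚᵘ.≃-sym (toℚᵘ-ι m)) (ℚᵘ.<-respʳ-≃ (ℚᵘ.≃-sym (toℚᵘ-ι n))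
      (ℚᵘ.*<* (ℤ.*-monoʳ-<-pos ℤ.1ℤ (ℤ.+<+ m<n)))))

    ι≡ℕtoℚ : ∀ n → ι n ≡ ℕtoℚ n
    ι≡ℕtoℚ n = refl

    ι0≡0 : ι 0 ≡ 0ℚ
    ι0≡0 = refl

    ι1≡1 : ι 1 ≡ 1ℚ
    ι1≡1 = refl

  ι-cancel : ∀ {m n} → ι m ≤ ι n → m ℕ.≤ n
  ι-cancel {m} {n} ιm≤ιn = ℕ.≮⇒≥ λ n<m → <-irrefl refl (<-≤-trans (ι-mono-< {n} {m} n<m) ιm≤ιn)

  0≤ι : ∀ n → 0ℚ ≤ ι n
  0≤ι n = subst (_≤ ι n) ι0≡0 (ι-mono ℕ.z≤n)

  ι-bit : ∀ b → ι (bit b) ≡ 𝟙 b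
  ι-bit true  = ι1≡1
  ι-bit false = ι0≡0

  ι-∑ : ∀ {n} (f : Fin n → ℕ) → ι (∑ℕ f) ≡ ∑ (λ i → ι (f i))
  ι-∑ {zero}  f = ι0≡0
  ι-∑ {suc n} f = trans (ι-+ (f zero) (∑ℕ λ i → f (suc i))) (cong (ι (f zero) +_) (ι-∑ λ i → f (suc i)))

  ι-pairSum : ∀ {r} (f : Fin r → Fin r → ℕ) → ι (pairSumℕ f) ≡ pairSum (λ i j → ι (f i j))
  ι-pairSum {zero}  f = ι0≡0
  ι-pairSum {suc r} f = trans (ι-+ (∑ℕ λ m → f zero (suc m)) _) (cong₂ _+_ (ι-∑ λ m → f zero (suc m)) (ι-pairSum λ i j → f (suc i) (suc j)))

  abstract
    -- Total reciprocal, with inv 0 = 0.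
    inv : ℕ → ℚ
    inv zero  = 0ℚ
    inv (suc m) = ℤ.+ 1 / suc m

    inv≡ : ∀ m → inv (suc m) ≡ ℤ.+ 1 / suc m
    inv≡ m = refl

    0≤inv : ∀ m → 0ℚ ≤ inv m
    0≤inv zero  = ≤-refl
    0≤inv (suc m) = nonNegative⁻¹ (inv (suc m)) {{normalize-nonNeg 1 (suc m)}}

    ι*inv : ∀ {m} → 0 ℕ.< m → ι m * inv m ≡ 1ℚ
    ι*inv {suc m} _ = toℚᵘ-injective (ℚᵘ.≃-trans (toℚᵘ-homo-* (ι (suc m)) (inv (suc m)))
      (ℚᵘ.≃-trans (ℚᵘ.*-cong (toℚᵘ-ι (suc m)) (toℚᵘ-fromℚᵘ (ℚᵘ.mkℚᵘ (ℤ.+ 1) m))) (ℚᵘ.*≡* eq)))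
      where
      eq : (ℤ.+ suc m ℤ.* ℤ.+ 1) ℤ.* ℤ.+ 1 ≡ ℤ.1ℤ ℤ.* (ℤ.+ (1 ℕ.* suc m))
      eq = trans (cong (ℤ._* ℤ.+ 1) (ℤ.*-identityʳ (ℤ.+ suc m))) (trans (ℤ.*-identityʳ (ℤ.+ suc m))
        (trans (cong ℤ.+_ (sym (ℕ.*-identityˡ (suc m)))) (sym (ℤ.*-identityˡ (ℤ.+ (1 ℕ.* suc m))))))

    0<inv : ∀ {m} → 0 ℕ.< m → 0ℚ < inv m
    0<inv {suc m} _ = positive⁻¹ (inv (suc m)) {{normalize-pos 1 (suc m)}}

  x*inv≤1 : ∀ {m x} → 0 ℕ.< m → x ≤ ι m → x * inv m ≤ 1ℚ
  x*inv≤1 {m} 0<m x≤ = ≤-trans (*-monoʳ (0≤inv m) x≤) (≤-reflexive (ι*inv 0<m))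

  -- Growth of a sixth moment in one step

  2ℚ 3ℚ 4ℚ 5ℚ 6ℚ 8ℚ 12ℚ : ℚ
  2ℚ = ℤ.+ 2 / 1
  3ℚ = ℤ.+ 3 / 1
  4ℚ = ℤ.+ 4 / 1
  5ℚ = ℤ.+ 5 / 1
  6ℚ = ℤ.+ 6 / 1
  8ℚ = ℤ.+ 8 / 1
  12ℚ = ℤ.+ 12 / 1

  0≤2 : 0ℚ ≤ 2ℚ
  0≤2 = nonNegative⁻¹ 2ℚ

  -- With S = X² + c and T = (X + Δ)² − X², the first-order term of (S + T)³ is 3S²T, and
  -- T² ≤ Δ²(8S + 2β), T ≤ S + 2β control the rest.
  sixth-moment-step : ∀ X c β Δ → 0ℚ ≤ c → 0ℚ ≤ β → Δ * Δ ≤ β →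
    ((X + Δ) * (X + Δ) + c) * ((X + Δ) * (X + Δ) + c) * ((X + Δ) * (X + Δ) + c) ≤
    (X * X + (c + 12ℚ * β)) * (X * X + (c + 12ℚ * β)) * (X * X + (c + 12ℚ * β)) +
      6ℚ * X * (X * X + c) * (X * X + c) * Δ
  sixth-moment-step X c β Δ 0≤c 0≤β Δ²≤β = begin
    ((X + Δ) * (X + Δ) + c) * ((X + Δ) * (X + Δ) + c) * ((X + Δ) * (X + Δ) + c)
      ≡⟨ cong (λ z → z * z * z) (e₁ X c Δ) ⟩
    (S + T) * (S + T) * (S + T)
      ≤⟨ ≤-cert _ (0≤+ (0≤+ (≤-diff T²[3S+T]≤) linear) remainder)
           (e₂ S T β (12ℚ * β) (β * (8ℚ * S + 2ℚ * β) * (4ℚ * S + 2ℚ * β)) (6ℚ * X * S * S * Δ)) ⟩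
    (S + 12ℚ * β) * (S + 12ℚ * β) * (S + 12ℚ * β) + 6ℚ * X * S * S * Δ
      ≡⟨ cong (λ z → z * z * z + 6ℚ * X * S * S * Δ) (+-assoc (X * X) c (12ℚ * β)) ⟩
    _ ∎
    where
    open ≤-Reasoning
    S = X * X + c
    T = 2ℚ * X * Δ + Δ * Δ
    35ℚ : ℚ
    35ℚ = ℤ.+ 35 / 1
    0≤S : 0ℚ ≤ S
    0≤S = 0≤+ (0≤sq X) 0≤c
    e₁ : ∀ X c Δ → (X + Δ) * (X + Δ) + c ≡ (X * X + c) + (2ℚ * X * Δ + Δ * Δ)
    e₁ = solve-∀ ℚring
    e₂ : ∀ S T β y R L → (S + y) * (S + y) * (S + y) + L ≡
      (S + T) * (S + T) * (S + T) + ((R - T * T * (3ℚ * S + T)) + (L + 3ℚ * S * S * β - 3ℚ * S * S * T) +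
        (3ℚ * (S * S) * (y - β) + 3ℚ * S * (y * y) + y * y * y - R))
    e₂ = solve-∀ ℚring
    y = 12ℚ * β
    -- Compared by powers of `S`. The coefficient of `S²` needs `3y ≥ 3β + 32β`, so `12` is the
    -- least integer multiple of `β` that works; the other two coefficients have room to spare.
    remainder : 0ℚ ≤ 3ℚ * (S * S) * (y - β) + 3ℚ * S * (y * y) + y * y * y - β * (8ℚ * S + 2ℚ * β) * (4ℚ * S + 2ℚ * β)
    remainder = subst (0ℚ ≤_) (lem S y β) (0≤+ (0≤+ (0≤* (0≤* 0≤S 0≤S) (≤-diff 35β≤3y)) (0≤* (0≤* (nonNegative⁻¹ 3ℚ) 0≤S) (≤-diff 8β²≤y²)))
                  (0≤+ (≤-diff (*-mono (0≤* (0≤* (nonNegative⁻¹ 8ℚ) 0≤β) 0≤β) 0≤y 8β²≤y² β≤y)) (0≤* (nonNegative⁻¹ 4ℚ) (0≤* (0≤* 0≤β 0≤β) 0≤β))))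
      where
      0≤y : 0ℚ ≤ y
      0≤y = 0≤* (nonNegative⁻¹ 12ℚ) 0≤β
      β≤y : β ≤ y
      β≤y = ≤-cert (11ℚ * β) (0≤* (nonNegative⁻¹ 11ℚ) 0≤β) (lem₁ β)
        where
        11ℚ = ℤ.+ 11 / 1
        lem₁ : ∀ β → 12ℚ * β ≡ β + 11ℚ * β
        lem₁ = solve-∀ ℚring
      8β²≤y² : 8ℚ * β * β ≤ y * y
      8β²≤y² = *-mono (0≤* (nonNegative⁻¹ 8ℚ) 0≤β) 0≤y (*-monoʳ {p = 8ℚ} {q = 12ℚ} 0≤β (≤ᵇ⇒≤ _)) β≤y
      35β≤3y : 35ℚ * β ≤ 3ℚ * y
      35β≤3y = ≤-cert β 0≤β (lem₁ β)
        where
        lem₁ : ∀ β → 3ℚ * (12ℚ * β) ≡ 35ℚ * β + β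
        lem₁ = solve-∀ ℚring
      lem : ∀ S y β → S * S * (3ℚ * y - 35ℚ * β) + 3ℚ * S * (y * y - 8ℚ * β * β) + ((y * y * y - 8ℚ * β * β * β) + 4ℚ * (β * β * β)) ≡
        3ℚ * (S * S) * (y - β) + 3ℚ * S * (y * y) + y * y * y - β * (8ℚ * S + 2ℚ * β) * (4ℚ * S + 2ℚ * β)
      lem = solve-∀ ℚring
    linear : 0ℚ ≤ 6ℚ * X * S * S * Δ + 3ℚ * S * S * β - 3ℚ * S * S * T
    linear = subst (0ℚ ≤_) (lem S X β Δ) (0≤* (0≤* (0≤* (nonNegative⁻¹ 3ℚ) 0≤S) 0≤S) (≤-diff Δ²≤β))
      where
      lem : ∀ S X β Δ → 3ℚ * S * S * (β - Δ * Δ) ≡ 6ℚ * X * S * S * Δ + 3ℚ * S * S * β - 3ℚ * S * S * (2ℚ * X * Δ + Δ * Δ)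
      lem = solve-∀ ℚring
    -- `T = Δ * (2X + Δ)`, and adding the square of `2X − Δ` to that of `2X + Δ` gives `8X² + 2Δ²`.
    T²≤ : T * T ≤ β * (8ℚ * S + 2ℚ * β)
    T²≤ = subst (_≤ β * (8ℚ * S + 2ℚ * β)) (lem X Δ)
      (*-mono (0≤sq Δ) (0≤+ (0≤* (nonNegative⁻¹ 8ℚ) 0≤S) (0≤* 0≤2 0≤β)) Δ²≤β
        (≤-cert _ (0≤+ (0≤+ (0≤* (nonNegative⁻¹ 8ℚ) 0≤c) (0≤sq (2ℚ * X - Δ))) (0≤* 0≤2 (≤-diff Δ²≤β))) (lem′ X c β Δ)))
      where
      lem : ∀ X Δ → Δ * Δ * ((2ℚ * X + Δ) * (2ℚ * X + Δ)) ≡ (2ℚ * X * Δ + Δ * Δ) * (2ℚ * X * Δ + Δ * Δ)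
      lem = solve-∀ ℚring
      lem′ : ∀ X c β Δ → 8ℚ * (X * X + c) + 2ℚ * β ≡
        (2ℚ * X + Δ) * (2ℚ * X + Δ) + (8ℚ * c + (2ℚ * X - Δ) * (2ℚ * X - Δ) + 2ℚ * (β - Δ * Δ))
      lem′ = solve-∀ ℚring
    3S+T≤ : 3ℚ * S + T ≤ 4ℚ * S + 2ℚ * β
    3S+T≤ = ≤-cert _ (0≤+ (0≤+ 0≤c (0≤sq (X - Δ))) (0≤* 0≤2 (≤-diff Δ²≤β))) (lem X c β Δ)
      where
      lem : ∀ X c β Δ → 4ℚ * (X * X + c) + 2ℚ * β ≡
        3ℚ * (X * X + c) + (2ℚ * X * Δ + Δ * Δ) + (c + (X - Δ) * (X - Δ) + 2ℚ * (β - Δ * Δ))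
      lem = solve-∀ ℚring
    T²[3S+T]≤ : T * T * (3ℚ * S + T) ≤ β * (8ℚ * S + 2ℚ * β) * (4ℚ * S + 2ℚ * β)
    T²[3S+T]≤ = *-mono (0≤sq T) (0≤+ (0≤* (nonNegative⁻¹ 4ℚ) 0≤S) (0≤* 0≤2 0≤β)) T²≤ 3S+T≤

  -- slack e r is the growth of X² still allowed when r parts remain.
  slack : ℚ → ℕ → ℚ
  slack e zero  = 0ℚ
  slack e (suc r) = slack e r + e

  -- The derandomised random clique

  avg-∑ : ∀ {m n} (π : Fin n → ℚ) (f : Fin m → Fin n → ℚ) →
    ∑ (λ v → π v * ∑ (λ i → f i v)) ≡ ∑ (λ i → ∑ (λ v → π v * f i v))
  avg-∑ π f = trans (∑-cong λ v → sym (∑-*ˡ (π v) (λ i → f i v))) (∑-swap (λ v i → π v * f i v))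

  -- `η` is the tolerated deviation of a mass from `N`. A vertex of weight 1 is then drawn with
  -- probability at least `γ`, and no vertex of weight at most `A` with probability above `α`. `κ`
  -- is the price of the sixth moments.
  record Constants : Set where
    field
      N η γ α A D κ : ℚ
      0≤η  : 0ℚ ≤ η
      η<N  : η < N
      0≤γ  : 0ℚ ≤ γ
      0≤α  : 0ℚ ≤ α
      0≤A  : 0ℚ ≤ A
      0≤D  : 0ℚ ≤ D
      0<κ  : 0ℚ < κ
      γ-bound : γ * (N + η) ≤ 1ℚ
      α-bound : A ≤ α * (N - η)
      γA≤1  : γ * A ≤ 1ℚ

  pos-factor : ∀ {a x} → 0ℚ ≤ a → 1ℚ ≤ a * x → 0ℚ < x
  pos-factor {a} {x} 0≤a 1≤ax = ≰⇒> λ x≤0 →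
    contradiction (≤-trans 1≤ax (≤-trans (*-monoˡ 0≤a x≤0) (≤-reflexive (*-zeroʳ a)))) (λ 1≤0 → <-irrefl refl (<-≤-trans (positive⁻¹ 1ℚ) 1≤0))

  <-diff : ∀ {p q} → p < q → 0ℚ < q - p
  <-diff {p} {q} p<q = subst (_< q - p) (+-inverseʳ p) (+-monoˡ-< (- p) p<q)

  module RandomClique (n : ℕ) (constants : Constants) where
    open Constants constants

    -- `b` bounds the change of a mass in one draw; `e` is the growth that `sixth-moment-step`
    -- demands per draw.
    b β e : ℚ
    b = 2ℚ * (A * D)
    β = b * b
    e = 12ℚ * β

    -- r parts remain.  ρ m x is the weight of the vertex x of part m (its chance of being chosen, times N); 1/τ i m x caps it at
    -- the time part i is processed, and t i bounds the probability of drawing any given vertex of part i.  u collects the pair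
    -- costs w₂ with the vertices already chosen.
    record State (r : ℕ) : Set where
      field
        cf  : Fin r → Fin n → Fin r → Fin n → Bool
        w u  : Fin r → Fin n → ℚ
        w₂  : Fin r → Fin n → Fin r → Fin n → ℚ
        ρ  : Fin r → Fin n → ℚ
        τ  : ℕ → Fin r → Fin n → ℚ
        t  : Fin r → ℚ
        0≤w  : ∀ m x → 0ℚ ≤ w m x
        0≤u  : ∀ m x → 0ℚ ≤ u m x
        0≤w₂ : ∀ m x i y → 0ℚ ≤ w₂ m x i y
        0≤ρ  : ∀ m x → 0ℚ ≤ ρ m x
        0≤t  : ∀ i → 0ℚ ≤ t i
        cf≤D : ∀ m i y → ∑ (λ x → 𝟙 (cf m x i y)) ≤ D
        cap  : ∀ m x → ρ m x * τ 0 m x ≤ 1ℚ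
        τ≥  : ∀ (i : Fin r) m x → 1ℚ ≤ A * τ (toℕ i) m x
        τ-own  : ∀ i y → 1ℚ ≤ τ (toℕ i) i y * ((N - η) * t i)
        τ-step : ∀ i m x → τ (suc (toℕ i)) m x ≤ τ (toℕ i) m x * (1ℚ - t i * ∑ (λ y → 𝟙 (cf m x i y)))
        half  : ∀ i m x → t i * ∑ (λ y → 𝟙 (cf m x i y)) ≤ ½

      excess : Fin r → ℚ
      excess m = ∑ (ρ m) - N

    sixth : ℕ → ℚ → ℚ
    sixth r X = (X * X + slack e r) * (X * X + slack e r) * (X * X + slack e r)

    total : ∀ {r} → (Fin r → Fin n → ℚ) → ℚ
    total f = ∑ λ m → ∑ λ x → f m x

    total₂ : ∀ {r} → (Fin r → Fin n → Fin r → Fin n → ℚ) → ℚ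
    total₂ f = pairSum λ i j → ∑ λ y → ∑ λ z → f i y j z

    module _ {r} (s : State r) where
      open State s
      -- Pessimistic estimators: `gain` bounds the expected weight of the choices still to come from
      -- below, the first two terms of `cost` bound their expected pair costs from above, and the
      -- third makes states with a badly deviating mass expensive.
      gain cost : ℚ
      gain = γ * total (λ m x → ρ m x * w m x)
      cost = α * total u + α * α * total₂ w₂ + κ * ∑ (λ m → sixth r (excess m))

    0≤β : 0ℚ ≤ β
    0≤β = 0≤sq b

    0≤slack : ∀ r → 0ℚ ≤ slack e r
    0≤slack zero  = ≤-refl
    0≤slack (suc r) = 0≤+ (0≤slack r) (0≤* (nonNegative⁻¹ 12ℚ) 0≤β)

    0≤sixth : ∀ r X → 0ℚ ≤ sixth r X
    0≤sixth r X = 0≤* (0≤* h h) h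
      where h = 0≤+ (0≤sq X) (0≤slack r)

    0≤total : ∀ {r} {f : Fin r → Fin n → ℚ} → (∀ m x → 0ℚ ≤ f m x) → 0ℚ ≤ total f
    0≤total h = 0≤∑ λ m → 0≤∑ (h m)

    0≤total₂ : ∀ {r} {f : Fin r → Fin n → Fin r → Fin n → ℚ} → (∀ i y j z → 0ℚ ≤ f i y j z) → 0ℚ ≤ total₂ f
    0≤total₂ {zero}  h = ≤-refl
    0≤total₂ {suc r} h = 0≤+ (0≤∑ λ m → 0≤∑ λ y → 0≤∑ λ z → h zero y (suc m) z) (0≤total₂ λ i y j z → h (suc i) y (suc j) z)

    module Step {r} (s : State (suc r)) where
      open State s

      π : Fin n → ℚ
      π = ρ zero

      P : ℚ
      P = ∑ π

      deg : Fin (suc r) → Fin n → ℚ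
      deg m x = ∑ λ y → 𝟙 (cf m x zero y)

      0<τ : ∀ m x → 0ℚ < τ 0 m x
      0<τ m x = pos-factor 0≤A (τ≥ zero m x)

      ρ≤A : ∀ m x → ρ m x ≤ A
      ρ≤A m x = *-cancelʳ-≤-pos (τ 0 m x) {{positive (0<τ m x)}} (≤-trans (cap m x) (τ≥ zero m x))

      π≤ : ∀ y → π y ≤ (N - η) * t zero
      π≤ y = *-cancelʳ-≤-pos (τ 0 zero y) {{positive (0<τ zero y)}}
        (≤-trans (cap zero y) (≤-trans (τ-own zero y) (≤-reflexive (*-comm (τ 0 zero y) _))))

      module Bounded (P≥ : N - η ≤ P) (P≤ : P ≤ N + η) where
        0<P : 0ℚ < P
        0<P = <-≤-trans (<-diff η<N) P≥

        P⁻¹ : ℚ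
        P⁻¹ = proj₁ (recip P 0<P)

        0≤P⁻¹ : 0ℚ ≤ P⁻¹
        0≤P⁻¹ = <⇒≤ (proj₁ (proj₂ (recip P 0<P)))

        P⁻¹P≡1 : P⁻¹ * P ≡ 1ℚ
        P⁻¹P≡1 = proj₂ (proj₂ (recip P 0<P))

        h : Fin (suc r) → Fin n → ℚ
        h m x = P⁻¹ * ∑ λ y → π y * 𝟙 (cf m x zero y)

        0≤h : ∀ m x → 0ℚ ≤ h m x
        0≤h m x = 0≤* 0≤P⁻¹ (0≤∑ λ y → 0≤* (0≤ρ zero y) (0≤𝟙 (cf m x zero y)))

        -- A union bound: by its cap, each vertex of the current part is drawn with probability at
        -- most `t zero`.
        h≤tdeg : ∀ m x → h m x ≤ t zero * deg m x
        h≤tdeg m x = begin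
          P⁻¹ * ∑ (λ y → π y * 𝟙 (cf m x zero y))  ≤⟨ *-monoˡ 0≤P⁻¹ (∑-mono λ y → *-monoʳ (0≤𝟙 (cf m x zero y)) (π≤ y)) ⟩
          P⁻¹ * ∑ (λ y → (N - η) * t zero * 𝟙 (cf m x zero y))  ≡⟨ cong (P⁻¹ *_) (∑-*ˡ ((N - η) * t zero) (λ y → 𝟙 (cf m x zero y))) ⟩
          P⁻¹ * ((N - η) * t zero * deg m x)  ≡⟨ lem P⁻¹ (N - η) (t zero) (deg m x) ⟩
          P⁻¹ * (N - η) * (t zero * deg m x)  ≤⟨ *-monoʳ (0≤* (0≤t zero) (0≤∑ λ y → 0≤𝟙 (cf m x zero y))) (*-monoˡ 0≤P⁻¹ P≥) ⟩
          P⁻¹ * P * (t zero * deg m x)  ≡⟨ cong (_* (t zero * deg m x)) P⁻¹P≡1 ⟩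
          1ℚ * (t zero * deg m x)  ≡⟨ *-identityˡ (t zero * deg m x) ⟩
          t zero * deg m x  ∎
          where
          open ≤-Reasoning
          lem : ∀ a b c d → a * (b * c * d) ≡ a * b * (c * d)
          lem = solve-∀ ℚring

        ½≤1-h : ∀ m x → ½ ≤ 1ℚ - h m x
        ½≤1-h m x = ≤-cert (½ - h m x) (≤-diff (≤-trans (h≤tdeg m x) (half zero m x))) (lem (h m x))
          where
          lem : ∀ h → 1ℚ - h ≡ ½ + (½ - h)
          lem = solve-∀ ℚring

        inverse : ∀ m x → ∃ λ g → (0ℚ < g) × (g * (1ℚ - h m x) ≡ 1ℚ)
        inverse m x = recip (1ℚ - h m x) (<-≤-trans (positive⁻¹ ½) (½≤1-h m x))

        g : Fin (suc r) → Fin n → ℚ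
        g m x = proj₁ (inverse m x)

        0≤g : ∀ m x → 0ℚ ≤ g m x
        0≤g m x = <⇒≤ (proj₁ (proj₂ (inverse m x)))

        g[1-h]≡1 : ∀ m x → g m x * (1ℚ - h m x) ≡ 1ℚ
        g[1-h]≡1 m x = proj₂ (proj₂ (inverse m x))

        g≡1+gh : ∀ m x → g m x ≡ 1ℚ + g m x * h m x
        g≡1+gh m x = trans (lem (g m x) (h m x)) (cong (_+ g m x * h m x) (g[1-h]≡1 m x))
          where
          lem : ∀ g h → g ≡ g * (1ℚ - h) + g * h
          lem = solve-∀ ℚring

        1≤g : ∀ m x → 1ℚ ≤ g m x
        1≤g m x = ≤-cert (g m x * h m x) (0≤* (0≤g m x) (0≤h m x)) (g≡1+gh m x)

        g≤2 : ∀ m x → g m x ≤ 2ℚ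
        g≤2 m x = *-cancelʳ-≤-pos ½ (≤-trans (*-monoˡ (0≤g m x) (½≤1-h m x)) (≤-reflexive (g[1-h]≡1 m x)))

        -- Dividing by the survival probability 1 − h makes every ρ′ v m x a martingale in v.
        ρ′ : Fin n → Fin (suc r) → Fin n → ℚ
        ρ′ v m x = ρ m x * (1ℚ - 𝟙 (cf m x zero v)) * g m x

        0≤1-𝟙 : ∀ c → 0ℚ ≤ 1ℚ - 𝟙 c
        0≤1-𝟙 c = ≤-diff (𝟙≤1 c)

        0≤ρ′ : ∀ v m x → 0ℚ ≤ ρ′ v m x
        0≤ρ′ v m x = 0≤* (0≤* (0≤ρ m x) (0≤1-𝟙 (cf m x zero v))) (0≤g m x)

        ρ′-mean : ∀ m x → ∑ (λ v → π v * ρ′ v m x) ≡ P * ρ m x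
        ρ′-mean m x = begin
          ∑ (λ v → π v * ρ′ v m x)
            ≡⟨ ∑-cong (λ v → lem₁ (π v) (ρ m x) (𝟙 (cf m x zero v)) (g m x)) ⟩
          ∑ (λ v → ρ m x * g m x * (π v - π v * 𝟙 (cf m x zero v)))
            ≡⟨ ∑-*ˡ (ρ m x * g m x) (λ v → π v - π v * 𝟙 (cf m x zero v)) ⟩
          ρ m x * g m x * ∑ (λ v → π v - π v * 𝟙 (cf m x zero v))
            ≡⟨ cong (ρ m x * g m x *_) (∑-- π (λ v → π v * 𝟙 (cf m x zero v))) ⟩
          ρ m x * g m x * (P - H)
            ≡⟨ cong (λ z → ρ m x * g m x * (P - z)) (trans (sym (*-identityˡ H)) (cong (_* H) (sym P⁻¹P≡1))) ⟩
          ρ m x * g m x * (P - P⁻¹ * P * H)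
            ≡⟨ lem₂ (ρ m x) (g m x) P P⁻¹ H ⟩
          P * ρ m x * (g m x * (1ℚ - h m x))
            ≡⟨ cong (P * ρ m x *_) (g[1-h]≡1 m x) ⟩
          P * ρ m x * 1ℚ
            ≡⟨ *-identityʳ (P * ρ m x) ⟩
          P * ρ m x ∎
          where
          open ≡-Reasoning
          H = ∑ λ y → π y * 𝟙 (cf m x zero y)
          lem₁ : ∀ p r c g → p * (r * (1ℚ - c) * g) ≡ r * g * (p - p * c)
          lem₁ = solve-∀ ℚring
          lem₂ : ∀ r g P i H → r * g * (P - i * P * H) ≡ P * r * (g * (1ℚ - i * H))
          lem₂ = solve-∀ ℚring

        Δ : Fin (suc r) → Fin n → ℚ
        Δ m v = ∑ (λ x → ρ′ v m x) - ∑ (ρ m)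

        Δ-mean : ∀ m → ∑ (λ v → π v * Δ m v) ≡ 0ℚ
        Δ-mean m = begin
          ∑ (λ v → π v * Δ m v)  ≡⟨ ∑-cong (λ v → lem (π v) _ (∑ (ρ m))) ⟩
          ∑ (λ v → π v * ∑ (λ x → ρ′ v m x) - π v * ∑ (ρ m))  ≡⟨ ∑-- (λ v → π v * ∑ (λ x → ρ′ v m x)) (λ v → π v * ∑ (ρ m)) ⟩
          ∑ (λ v → π v * ∑ (λ x → ρ′ v m x)) - ∑ (λ v → π v * ∑ (ρ m))  ≡⟨ cong₂ _-_ (avg-∑ π (λ x v → ρ′ v m x)) (∑-*ʳ (∑ (ρ m)) π) ⟩
          ∑ (λ x → ∑ (λ v → π v * ρ′ v m x)) - P * ∑ (ρ m)  ≡⟨ cong (_- P * ∑ (ρ m)) (trans (∑-cong (ρ′-mean m)) (∑-*ˡ P (ρ m))) ⟩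
          P * ∑ (ρ m) - P * ∑ (ρ m)  ≡⟨ +-inverseʳ (P * ∑ (ρ m)) ⟩
          0ℚ  ∎
          where
          open ≡-Reasoning
          lem : ∀ a b c → a * (b - c) ≡ a * b - a * c
          lem = solve-∀ ℚring

        -- The expected number of vertices of part `m` in conflict with the draw, which is at most
        -- `D` for every outcome.
        ∑h≤D : ∀ m → ∑ (λ x → h m x) ≤ D
        ∑h≤D m = begin
          ∑ (λ x → h m x)  ≡⟨ ∑-*ˡ P⁻¹ (λ x → ∑ λ y → π y * 𝟙 (cf m x zero y)) ⟩
          P⁻¹ * ∑ (λ x → ∑ λ y → π y * 𝟙 (cf m x zero y))  ≡⟨ cong (P⁻¹ *_) (sym (avg-∑ π (λ x y → 𝟙 (cf m x zero y)))) ⟩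
          P⁻¹ * ∑ (λ y → π y * ∑ (λ x → 𝟙 (cf m x zero y)))  ≤⟨ *-monoˡ 0≤P⁻¹ (∑-mono λ y → *-monoˡ (0≤ρ zero y) (cf≤D m zero y)) ⟩
          P⁻¹ * ∑ (λ y → π y * D)  ≡⟨ cong (P⁻¹ *_) (∑-*ʳ D π) ⟩
          P⁻¹ * (P * D)  ≡⟨ sym (*-assoc P⁻¹ P D) ⟩
          P⁻¹ * P * D  ≡⟨ cong (_* D) P⁻¹P≡1 ⟩
          1ℚ * D  ≡⟨ *-identityˡ D ⟩
          D  ∎
          where open ≤-Reasoning

        -- A mass grows only through the division by `1 − h`: it adds at most `g * h ≤ 2h` times a
        -- weight bounded by `A`.
        Δ≤b : ∀ m v → Δ m v ≤ b
        Δ≤b m v = begin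
          ∑ (λ x → ρ′ v m x) - ∑ (ρ m)  ≡⟨ sym (∑-- (ρ′ v m) (ρ m)) ⟩
          ∑ (λ x → ρ′ v m x - ρ m x)  ≤⟨ ∑-mono pointwise ⟩
          ∑ (λ x → 2ℚ * A * h m x)  ≡⟨ ∑-*ˡ (2ℚ * A) (h m) ⟩
          2ℚ * A * ∑ (h m)  ≤⟨ *-monoˡ (0≤* 0≤2 0≤A) (∑h≤D m) ⟩
          2ℚ * A * D  ≡⟨ *-assoc 2ℚ A D ⟩
          b  ∎
          where
          open ≤-Reasoning
          lem₁ : ∀ r c g → r * (1ℚ - c) * g - r + r * c * g ≡ r * (g - 1ℚ)
          lem₁ = solve-∀ ℚring
          lem₂ : ∀ k → (1ℚ + k) - 1ℚ ≡ k
          lem₂ = solve-∀ ℚring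
          pointwise : ∀ x → ρ′ v m x - ρ m x ≤ 2ℚ * A * h m x
          pointwise x = begin
            ρ′ v m x - ρ m x  ≤⟨ ≤-cert _ (0≤* (0≤* (0≤ρ m x) (0≤𝟙 (cf m x zero v))) (0≤g m x)) (sym (lem₁ (ρ m x) _ (g m x))) ⟩
            ρ m x * (g m x - 1ℚ)  ≡⟨ cong (λ z → ρ m x * (z - 1ℚ)) (g≡1+gh m x) ⟩
            ρ m x * ((1ℚ + g m x * h m x) - 1ℚ) ≡⟨ cong (ρ m x *_) (lem₂ _) ⟩
            ρ m x * (g m x * h m x)  ≤⟨ *-mono (0≤ρ m x) (0≤* 0≤2 (0≤h m x)) (ρ≤A m x) (*-monoʳ (0≤h m x) (g≤2 m x)) ⟩
            A * (2ℚ * h m x)  ≡⟨ trans (sym (*-assoc A 2ℚ (h m x))) (cong (_* h m x) (*-comm A 2ℚ)) ⟩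
            2ℚ * A * h m x  ∎

        -- A mass shrinks only through the at most `D` vertices in conflict with `v`, of weight at
        -- most `A` each.
        -b≤Δ : ∀ m v → 0ℚ ≤ Δ m v + b
        -b≤Δ m v = begin
          0ℚ  ≤⟨ ≤-diff bound ⟩
          b - ∑ (λ x → ρ m x - ρ′ v m x)  ≡⟨ cong (λ z → b - z) (∑-- (ρ m) (ρ′ v m)) ⟩
          b - (∑ (ρ m) - ∑ (ρ′ v m))  ≡⟨ lem b (∑ (ρ m)) (∑ (ρ′ v m)) ⟩
          Δ m v + b  ∎
          where
          open ≤-Reasoning
          lem : ∀ b r s → b - (r - s) ≡ s - r + b
          lem = solve-∀ ℚring
          lem₁ : ∀ r c g → r * c ≡ (r - r * (1ℚ - c) * g) + r * (1ℚ - c) * (g - 1ℚ)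
          lem₁ = solve-∀ ℚring
          lem₂ : ∀ z → 2ℚ * z ≡ z + z
          lem₂ = solve-∀ ℚring
          bound : ∑ (λ x → ρ m x - ρ′ v m x) ≤ b
          bound = begin
            ∑ (λ x → ρ m x - ρ′ v m x)  ≤⟨ ∑-mono (λ x → ≤-cert _ (0≤* (0≤* (0≤ρ m x) (0≤1-𝟙 (cf m x zero v))) (≤-diff (1≤g m x))) (lem₁ (ρ m x) (𝟙 (cf m x zero v)) (g m x))) ⟩
            ∑ (λ x → ρ m x * 𝟙 (cf m x zero v))  ≤⟨ ∑-mono (λ x → *-monoʳ (0≤𝟙 (cf m x zero v)) (ρ≤A m x)) ⟩
            ∑ (λ x → A * 𝟙 (cf m x zero v))  ≡⟨ ∑-*ˡ A (λ x → 𝟙 (cf m x zero v)) ⟩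
            A * ∑ (λ x → 𝟙 (cf m x zero v))  ≤⟨ *-monoˡ 0≤A (cf≤D m zero v) ⟩
            A * D  ≤⟨ ≤-cert (A * D) (0≤* 0≤A 0≤D) (lem₂ (A * D)) ⟩
            b  ∎

        Δ²≤β : ∀ m v → Δ m v * Δ m v ≤ β
        Δ²≤β m v = ≤-cert _ (0≤* (≤-diff (Δ≤b m v)) (-b≤Δ m v)) (lem b (Δ m v))
          where
          lem : ∀ b d → b * b ≡ d * d + (b - d) * (d + b)
          lem = solve-∀ ℚring

        -- The term linear in `Δ` averages to zero by `Δ-mean`; everything else is covered by one
        -- unit of slack.
        sixth-mean : ∀ m → ∑ (λ v → π v * sixth r (∑ (ρ′ v m) - N)) ≤ P * sixth (suc r) (excess m)
        sixth-mean m = begin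
          ∑ (λ v → π v * sixth r (∑ (ρ′ v m) - N))
            ≡⟨ ∑-cong (λ v → cong (λ z → π v * sixth r z) (lem (∑ (ρ′ v m)) (∑ (ρ m)) N)) ⟩
          ∑ (λ v → π v * sixth r (X + Δ m v))
            ≤⟨ ∑-mono (λ v → *-monoˡ (0≤ρ zero v) (sixth-moment-step X (slack e r) β (Δ m v) (0≤slack r) 0≤β (Δ²≤β m v))) ⟩
          ∑ (λ v → π v * (sixth (suc r) X + L * Δ m v))
            ≡⟨ ∑-cong (λ v → lem₁ (π v) (sixth (suc r) X) L (Δ m v)) ⟩
          ∑ (λ v → π v * sixth (suc r) X + L * (π v * Δ m v))
            ≡⟨ ∑-+ (λ v → π v * sixth (suc r) X) (λ v → L * (π v * Δ m v)) ⟩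
          ∑ (λ v → π v * sixth (suc r) X) + ∑ (λ v → L * (π v * Δ m v))
            ≡⟨ cong₂ _+_ (∑-*ʳ (sixth (suc r) X) π) (trans (∑-*ˡ L (λ v → π v * Δ m v)) (trans (cong (L *_) (Δ-mean m)) (*-zeroʳ L))) ⟩
          P * sixth (suc r) X + 0ℚ
            ≡⟨ +-identityʳ _ ⟩
          P * sixth (suc r) X ∎
          where
          open ≤-Reasoning
          X = excess m
          L = 6ℚ * X * (X * X + slack e r) * (X * X + slack e r)
          lem : ∀ a b c → a - c ≡ (b - c) + (a - b)
          lem = solve-∀ ℚring
          lem₁ : ∀ p s l d → p * (s + l * d) ≡ p * s + l * (p * d)
          lem₁ = solve-∀ ℚring

        next : Fin n → State r
        next v = record
          { cf = λ m x i y → cf (suc m) x (suc i) y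
          ; w = λ m x → w (suc m) x
          ; u = λ m x → u (suc m) x + w₂ zero v (suc m) x
          ; w₂ = λ m x i y → w₂ (suc m) x (suc i) y
          ; ρ = λ m x → ρ′ v (suc m) x
          ; τ = λ i m x → τ (suc i) (suc m) x
          ; t = λ i → t (suc i)
          ; 0≤w = λ m → 0≤w (suc m)
          ; 0≤u = λ m x → 0≤+ (0≤u (suc m) x) (0≤w₂ zero v (suc m) x)
          ; 0≤w₂ = λ m x i y → 0≤w₂ (suc m) x (suc i) y
          ; 0≤ρ = λ m x → 0≤ρ′ v (suc m) x
          ; 0≤t = λ i → 0≤t (suc i)
          ; cf≤D = λ m i y → cf≤D (suc m) (suc i) y
          ; cap = λ m x → cap′ (suc m) x
          ; τ≥ = λ i m x → τ≥ (suc i) (suc m) x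
          ; τ-own = λ i y → τ-own (suc i) y
          ; τ-step = λ i m x → τ-step (suc i) (suc m) x
          ; half = λ i m x → half (suc i) (suc m) x
          }
          where
          -- Division by `1 − h` raises a weight by no more than `τ-step` lowers `τ`, because
          -- `h ≤ t * deg`.
          cap′ : ∀ m x → ρ′ v m x * τ 1 m x ≤ 1ℚ
          cap′ m x = begin
            ρ′ v m x * τ 1 m x  ≤⟨ *-monoˡ (0≤ρ′ v m x) (τ-step zero m x) ⟩
            ρ′ v m x * (τ 0 m x * (1ℚ - t zero * deg m x))  ≤⟨ *-mono (0≤ρ′ v m x) (0≤* (<⇒≤ (0<τ m x)) (≤-trans (nonNegative⁻¹ ½) (½≤1-h m x)))
                                                                       (*-monoʳ (0≤g m x) (≤-trans (*-monoˡ (0≤ρ m x) (≤-cert (𝟙 (cf m x zero v)) (0≤𝟙 (cf m x zero v)) (lem₁ (𝟙 (cf m x zero v))))) (≤-reflexive (*-identityʳ (ρ m x)))))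
                                                                       (*-monoˡ (<⇒≤ (0<τ m x)) (≤-cert (t zero * deg m x - h m x) (≤-diff (h≤tdeg m x)) (lem₂ (h m x) (t zero * deg m x)))) ⟩
            ρ m x * g m x * (τ 0 m x * (1ℚ - h m x))  ≡⟨ lem (ρ m x) (g m x) (τ 0 m x) (1ℚ - h m x) ⟩
            ρ m x * τ 0 m x * (g m x * (1ℚ - h m x))  ≡⟨ cong (ρ m x * τ 0 m x *_) (g[1-h]≡1 m x) ⟩
            ρ m x * τ 0 m x * 1ℚ  ≡⟨ *-identityʳ (ρ m x * τ 0 m x) ⟩
            ρ m x * τ 0 m x  ≤⟨ cap m x ⟩
            1ℚ  ∎
            where
            open ≤-Reasoning
            lem : ∀ a b c d → a * b * (c * d) ≡ a * c * (b * d)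
            lem = solve-∀ ℚring
            lem₁ : ∀ c → 1ℚ ≡ (1ℚ - c) + c
            lem₁ = solve-∀ ℚring
            lem₂ : ∀ h k → 1ℚ - h ≡ (1ℚ - k) + (k - h)
            lem₂ = solve-∀ ℚring

        0≤κ : 0ℚ ≤ κ
        0≤κ = <⇒≤ 0<κ

        π≤αP : ∀ y → π y ≤ α * P
        π≤αP y = ≤-trans (ρ≤A zero y) (≤-trans α-bound (*-monoˡ 0≤α P≥))

        -- Later parts keep their mean, being martingales. The drawn part was credited `γ * W₀` in
        -- advance, at most its true mean `W₀ / P` since `γ * P ≤ 1`.
        gain-mean : P * gain s ≤ ∑ (λ v → π v * (gain (next v) + w zero v))
        gain-mean = begin
          P * (γ * (W₀ + W₁))
            ≡⟨ lem₁ P γ W₀ W₁ ⟩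
          γ * (P * W₁) + γ * P * W₀
            ≤⟨ +-monoʳ-≤ (γ * (P * W₁)) (≤-trans (*-monoʳ 0≤W₀ (≤-trans (*-monoˡ 0≤γ P≤) γ-bound)) (≤-reflexive (*-identityˡ W₀))) ⟩
          γ * (P * W₁) + W₀
            ≡⟨ cong (λ z → γ * z + W₀) (sym tail-mean) ⟩
          γ * ∑ (λ v → π v * G v) + W₀
            ≡⟨ cong (_+ W₀) (sym (∑-*ˡ γ (λ v → π v * G v))) ⟩
          ∑ (λ v → γ * (π v * G v)) + W₀
            ≡⟨ sym (∑-+ (λ v → γ * (π v * G v)) (λ v → π v * w zero v)) ⟩
          ∑ (λ v → γ * (π v * G v) + π v * w zero v)
            ≡⟨ ∑-cong (λ v → lem₂ γ (π v) (G v) (w zero v)) ⟩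
          ∑ (λ v → π v * (gain (next v) + w zero v)) ∎
          where
          open ≤-Reasoning
          W₀ = ∑ λ x → ρ zero x * w zero x
          W₁ = total {r} λ m x → ρ (suc m) x * w (suc m) x
          G : Fin n → ℚ
          G v = total {r} λ m x → ρ′ v (suc m) x * w (suc m) x
          0≤W₀ : 0ℚ ≤ W₀
          0≤W₀ = 0≤∑ λ x → 0≤* (0≤ρ zero x) (0≤w zero x)
          lem₁ : ∀ P γ a b → P * (γ * (a + b)) ≡ γ * (P * b) + γ * P * a
          lem₁ = solve-∀ ℚring
          lem₂ : ∀ γ p G w → γ * (p * G) + p * w ≡ p * (γ * G + w)
          lem₂ = solve-∀ ℚring
          lem₃ : ∀ P r w → P * r * w ≡ P * (r * w)
          lem₃ = solve-∀ ℚring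
          cell-mean : ∀ m x → ∑ (λ v → π v * (ρ′ v m x * w m x)) ≡ P * (ρ m x * w m x)
          cell-mean m x = trans (∑-cong λ v → sym (*-assoc (π v) (ρ′ v m x) (w m x)))
            (trans (∑-*ʳ (w m x) (λ v → π v * ρ′ v m x)) (trans (cong (_* w m x) (ρ′-mean m x)) (lem₃ P (ρ m x) (w m x))))
          tail-mean : ∑ (λ v → π v * G v) ≡ P * W₁
          tail-mean = trans (avg-∑ π (λ m v → ∑ λ x → ρ′ v (suc m) x * w (suc m) x))
            (trans (∑-cong λ m → trans (avg-∑ π (λ x v → ρ′ v (suc m) x * w (suc m) x))
                     (trans (∑-cong λ x → cell-mean (suc m) x) (∑-*ˡ P (λ x → ρ (suc m) x * w (suc m) x))))
              (∑-*ˡ P (λ m → ∑ λ x → ρ (suc m) x * w (suc m) x)))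

        π-mean≤ : ∀ (f : Fin n → ℚ) → (∀ v → 0ℚ ≤ f v) → ∑ (λ v → π v * f v) ≤ P * (α * ∑ f)
        π-mean≤ f 0≤f = begin
          ∑ (λ v → π v * f v)  ≤⟨ ∑-mono (λ v → *-monoʳ (0≤f v) (π≤αP v)) ⟩
          ∑ (λ v → α * P * f v)  ≡⟨ ∑-*ˡ (α * P) f ⟩
          α * P * ∑ f  ≡⟨ lem α P (∑ f) ⟩
          P * (α * ∑ f)  ∎
          where
          open ≤-Reasoning
          lem : ∀ a P f → a * P * f ≡ P * (a * f)
          lem = solve-∀ ℚring

        -- A pair whose first vertex lies in the current part is charged `α²` before the draw and
        -- `α` after that vertex is drawn, which has probability at most `α`. Pair costs already in
        -- `u zero` are settled in the same way.
        cost-mean : ∑ (λ v → π v * (u zero v + cost (next v))) ≤ P * cost s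
        cost-mean = begin
          ∑ (λ v → π v * (u zero v + (α * total (λ m x → u (suc m) x + w₂ zero v (suc m) x) + α * α * T₂ + κ * Q v)))
            ≡⟨ ∑-cong (λ v → trans (cong (λ z → π v * (u zero v + (α * z + α * α * T₂ + κ * Q v))) (split v))
                                (lem₁ (π v) (u zero v) α U (Y v) T₂ κ (Q v))) ⟩
          ∑ (λ v → (π v * u zero v + α * (π v * Y v)) + (κ * (π v * Q v) + π v * (α * U + α * α * T₂)))
            ≡⟨ trans (∑-+ (λ v → π v * u zero v + α * (π v * Y v)) (λ v → κ * (π v * Q v) + π v * (α * U + α * α * T₂)))
                     (cong₂ _+_ (trans (∑-+ (λ v → π v * u zero v) (λ v → α * (π v * Y v))) (cong (∑ (λ v → π v * u zero v) +_) (∑-*ˡ α (λ v → π v * Y v))))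
                                (trans (∑-+ (λ v → κ * (π v * Q v)) (λ v → π v * (α * U + α * α * T₂)))
                                  (cong₂ _+_ (∑-*ˡ κ (λ v → π v * Q v)) (∑-*ʳ (α * U + α * α * T₂) π)))) ⟩
          (∑ (λ v → π v * u zero v) + α * ∑ (λ v → π v * Y v)) + (κ * ∑ (λ v → π v * Q v) + P * (α * U + α * α * T₂))
            ≤⟨ +-mono-≤ (+-mono-≤ (π-mean≤ (u zero) (0≤u zero)) (*-monoˡ 0≤α (π-mean≤ Y λ v → 0≤total λ m x → 0≤w₂ zero v (suc m) x)))
                        (+-monoˡ-≤ (P * (α * U + α * α * T₂)) (*-monoˡ 0≤κ Q-mean)) ⟩
          (P * (α * U₀) + α * (P * (α * ∑ Y))) + (κ * (P * Q₁) + P * (α * U + α * α * T₂))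
            -- The penalty of the current part is dropped: its mass has no further effect.
            ≤⟨ ≤-cert (P * (κ * sixth (suc r) (excess zero))) (0≤* (<⇒≤ 0<P) (0≤* 0≤κ (0≤sixth (suc r) (excess zero))))
                 (lem₂ P α U₀ U (∑ Y) T₂ κ (sixth (suc r) (excess zero)) Q₁) ⟩
          P * (α * (U₀ + U) + α * α * (∑ Y + T₂) + κ * (sixth (suc r) (excess zero) + Q₁))
            ≡⟨ cong (λ z → P * (α * (U₀ + U) + α * α * (z + T₂) + κ * (sixth (suc r) (excess zero) + Q₁))) (∑-swap (λ v m → ∑ λ x → w₂ zero v (suc m) x)) ⟩
          P * cost s ∎
          where
          open ≤-Reasoning
          U₀ = ∑ (u zero)
          U = total {r} λ m x → u (suc m) x
          T₂ = total₂ {r} λ m x i y → w₂ (suc m) x (suc i) y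
          Y : Fin n → ℚ
          Y v = total {r} λ m x → w₂ zero v (suc m) x
          Q : Fin n → ℚ
          Q v = ∑ λ m → sixth r (∑ (ρ′ v (suc m)) - N)
          Q₁ = ∑ λ m → sixth (suc r) (excess (suc m))
          split : ∀ v → total {r} (λ m x → u (suc m) x + w₂ zero v (suc m) x) ≡ U + Y v
          split v = trans (∑-cong λ m → ∑-+ (u (suc m)) (w₂ zero v (suc m))) (∑-+ (λ m → ∑ (u (suc m))) (λ m → ∑ (w₂ zero v (suc m))))
          Q-mean : ∑ (λ v → π v * Q v) ≤ P * Q₁
          Q-mean = ≤-trans (≤-reflexive (avg-∑ π (λ m v → sixth r (∑ (ρ′ v (suc m)) - N))))
            (≤-trans (∑-mono λ m → sixth-mean (suc m)) (≤-reflexive (∑-*ˡ P (λ m → sixth (suc r) (excess (suc m))))))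
          lem₁ : ∀ p u a U Y T k Q → p * (u + (a * (U + Y) + a * a * T + k * Q)) ≡
            (p * u + a * (p * Y)) + (k * (p * Q) + p * (a * U + a * a * T))
          lem₁ = solve-∀ ℚring
          lem₂ : ∀ P a U₀ U Y T k Q₀ Q → P * (a * (U₀ + U) + a * a * (Y + T) + k * (Q₀ + Q)) ≡
            (P * (a * U₀) + a * (P * (a * Y))) + (k * (P * Q) + P * (a * U + a * a * T)) + P * (k * Q₀)
          lem₂ = solve-∀ ℚring

        choice : ∀ V → V + cost s ≤ gain s →
          ∃ λ v → (0ℚ < π v) × ((V + u zero v - w zero v) + cost (next v) ≤ gain (next v))
        choice V V+cost≤gain = finish (∃-above-average π f V (0≤ρ zero) 0<P average)
          where
          f : Fin n → ℚ
          f v = (gain (next v) + w zero v) - (u zero v + cost (next v))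
          average : P * V ≤ ∑ (λ v → π v * f v)
          average = begin
            P * V  ≤⟨ *-monoˡ (<⇒≤ 0<P) (≤-cert _ (≤-diff V+cost≤gain) (lem₁ V (cost s) (gain s))) ⟩
            P * (gain s - cost s)  ≡⟨ lem₂ P (gain s) (cost s) ⟩
            P * gain s - P * cost s  ≤⟨ +-mono-≤ gain-mean (neg-antimono-≤ cost-mean) ⟩
            ∑ (λ v → π v * (gain (next v) + w zero v)) - ∑ (λ v → π v * (u zero v + cost (next v)))
              ≡⟨ sym (∑-- (λ v → π v * (gain (next v) + w zero v)) (λ v → π v * (u zero v + cost (next v)))) ⟩
            ∑ (λ v → π v * (gain (next v) + w zero v) - π v * (u zero v + cost (next v)))
              ≡⟨ ∑-cong (λ v → sym (lem₂ (π v) (gain (next v) + w zero v) (u zero v + cost (next v)))) ⟩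
            ∑ (λ v → π v * f v) ∎
            where
            open ≤-Reasoning
            lem₁ : ∀ V c g → g - c ≡ V + (g - (V + c))
            lem₁ = solve-∀ ℚring
            lem₂ : ∀ P g c → P * (g - c) ≡ P * g - P * c
            lem₂ = solve-∀ ℚring
          finish : (∃ λ v → (0ℚ < π v) × (V ≤ f v)) → ∃ λ v → (0ℚ < π v) × ((V + u zero v - w zero v) + cost (next v) ≤ gain (next v))
          finish (v , 0<πv , V≤) = v , 0<πv , ≤-cert _ (≤-diff V≤) (lem V (u zero v) (w zero v) (cost (next v)) (gain (next v)))
            where
            lem : ∀ V u w c g → g ≡ ((V + u - w) + c) + ((g + w - (u + c)) - V)
            lem = solve-∀ ℚring

      -- A gain is at most total w, so the bound on total w limits the sixth-moment part of the cost and thereby |P − N|.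
      module _ (V : ℚ) (V+cost≤gain : V + cost s ≤ gain s) (w≤ : total w ≤ κ * (η * η * (η * η) * (η * η)) + V) where
        gain≤ : gain s ≤ total w
        gain≤ = begin
          γ * total (λ m x → ρ m x * w m x)  ≡⟨ sym (trans (∑-cong λ m → ∑-*ˡ γ (λ x → ρ m x * w m x)) (∑-*ˡ γ (λ m → ∑ λ x → ρ m x * w m x))) ⟩
          total (λ m x → γ * (ρ m x * w m x))  ≤⟨ (∑-mono λ m → ∑-mono λ x → cell m x) ⟩
          total w  ∎
          where
          open ≤-Reasoning
          cell : ∀ m x → γ * (ρ m x * w m x) ≤ w m x
          cell m x = begin
            γ * (ρ m x * w m x)  ≡⟨ sym (*-assoc γ (ρ m x) (w m x)) ⟩
            γ * ρ m x * w m x  ≤⟨ *-monoʳ (0≤w m x) (≤-trans (*-monoˡ 0≤γ (ρ≤A m x)) γA≤1) ⟩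
            1ℚ * w m x  ≡⟨ *-identityˡ (w m x) ⟩
            w m x  ∎

        sixth≤ : sixth (suc r) (excess zero) ≤ η * η * (η * η) * (η * η)
        sixth≤ = *-cancelˡ 0<κ (begin
          κ * sixth (suc r) (excess zero)  ≤⟨ *-monoˡ (<⇒≤ 0<κ) (term≤∑ {f = λ m → sixth (suc r) (excess m)} (λ m → 0≤sixth (suc r) (excess m)) zero) ⟩
          κ * Q₁  ≤⟨ ≤-cert _ (0≤+ (0≤+ (0≤* 0≤α (0≤total 0≤u)) (0≤* (0≤* 0≤α 0≤α) (0≤total₂ 0≤w₂)))
                                                                 (0≤+ (≤-diff (≤-trans V+cost≤gain gain≤)) (≤-diff w≤)))
                                                                 (lem (κ * Q₁) (α * total u) (α * α * total₂ w₂) V (total w) (κ * (η * η * (η * η) * (η * η)))) ⟩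
          κ * (η * η * (η * η) * (η * η)) ∎)
          where
          open ≤-Reasoning
          Q₁ = ∑ λ m → sixth (suc r) (excess m)
          lem : ∀ q a b V w k → k ≡ q + ((a + b) + ((w - (V + (a + b + q))) + (k + V - w)))
          lem = solve-∀ ℚring

        excess²≤η² : excess zero * excess zero ≤ η * η
        excess²≤η² = ≤-trans (≤-cert _ (0≤slack (suc r)) refl) (cube-cancel-≤ (0≤sq η) sixth≤)

        P-upper : P ≤ N + η
        P-upper = ≤-cert (η - excess zero) (≤-diff (sq-cancel-≤ 0≤η excess²≤η²)) (lem P N η)
          where
          lem : ∀ P N η → N + η ≡ P + (η - (P - N))
          lem = solve-∀ ℚring

        P-lower : N - η ≤ P
        P-lower = ≤-cert (η - (- excess zero)) (≤-diff (sq-cancel-≤ 0≤η (subst (_≤ η * η) (lem′ (excess zero)) excess²≤η²))) (lem P N η)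
          where
          lem : ∀ P N η → P ≡ (N - η) + (η - (- (P - N)))
          lem = solve-∀ ℚring
          lem′ : ∀ x → x * x ≡ (- x) * (- x)
          lem′ = solve-∀ ℚring

    module _ {r} (s : State r) where
      open State s
      record Clique (V : ℚ) : Set where
        field
          K  : Fin r → Fin n
          alive  : ∀ i → 0ℚ < ρ i (K i)
          no-conflict : ∀ i j → toℕ i ℕ.< toℕ j → cf j (K j) i (K i) ≡ false
          value  : V + ∑ (λ i → u i (K i)) + pairSum (λ i j → w₂ i (K i) j (K j)) ≤ ∑ (λ i → w i (K i))

    -- `V` is the surplus of weight over pair costs still owed; it may become negative. The second
    -- hypothesis, needed to keep every mass near `N`, survives a draw: `V` falls by at most
    -- `w zero v`, but `total w` loses the whole current part.
    clique : ∀ {r} (s : State r) V → V + cost s ≤ gain s →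
      total (State.w s) ≤ κ * (η * η * (η * η) * (η * η)) + V → Clique s V
    clique {zero} s V V+cost≤gain _ = record
      { K = λ ()
      ; alive = λ ()
      ; no-conflict = λ ()
      ; value = subst₂ _≤_ (lem V α κ) (*-zeroʳ γ) V+cost≤gain
      }
      where
      lem : ∀ V a k → V + (a * 0ℚ + a * a * 0ℚ + k * 0ℚ) ≡ V + 0ℚ + 0ℚ
      lem = solve-∀ ℚring
    clique {suc r} s V V+cost≤gain w≤ = record
      { K = K
      ; alive = alive
      ; no-conflict = no-conflict
      ; value = ≤-trans (≤-reflexive rearrange) (≤-trans (+-monoˡ-≤ (w zero v) (Clique.value rest)) (≤-reflexive (+-comm _ (w zero v))))
      }
      where
      open State s
      open Step s
      open Bounded (P-lower V V+cost≤gain w≤) (P-upper V V+cost≤gain w≤)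
      chosen = choice V V+cost≤gain
      v = proj₁ chosen
      V′ = V + u zero v - w zero v
      w≤′ : total (λ m x → w (suc m) x) ≤ κ * (η * η * (η * η) * (η * η)) + V′
      w≤′ = ≤-cert _ (0≤+ (0≤+ (≤-diff w≤) (0≤u zero v)) (≤-diff (term≤∑ (0≤w zero) v)))
        (lem (total λ m x → w (suc m) x) (∑ (w zero)) (w zero v) (u zero v) V (κ * (η * η * (η * η) * (η * η))))
        where
        lem : ∀ t w₀ wv uv V k → k + (V + uv - wv) ≡ t + ((k + V - (w₀ + t)) + uv + (w₀ - wv))
        lem = solve-∀ ℚring
      rest : Clique (next v) V′
      rest = clique (next v) V′ (proj₂ (proj₂ chosen)) w≤′
      K : Fin (suc r) → Fin n
      K zero  = v
      K (suc i) = Clique.K rest i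
      -- A positive weight certifies the whole history, since a conflict with a chosen vertex sets
      -- the weight to 0 for good.
      compatible : ∀ c p q → 0ℚ < p * (1ℚ - 𝟙 c) * q → 0ℚ ≤ p → (c ≡ false) × (0ℚ < p)
      compatible true  p q pos 0≤p = contradiction pos (<-irrefl (sym (trans (cong (_* q) (*-zeroʳ p)) (*-zeroˡ q))))
      compatible false p q pos 0≤p = refl , ≰⇒> λ p≤0 →
        <-irrefl (sym (trans (cong (λ z → z * (1ℚ - 0ℚ) * q) (≤-antisym p≤0 0≤p)) (trans (cong (_* q) (*-zeroˡ (1ℚ - 0ℚ))) (*-zeroˡ q)))) pos
      tail-ok : ∀ i → (cf (suc i) (K (suc i)) zero v ≡ false) × (0ℚ < ρ (suc i) (K (suc i)))
      tail-ok i = compatible (cf (suc i) (K (suc i)) zero v) (ρ (suc i) (K (suc i))) (g (suc i) (K (suc i))) (Clique.alive rest i) (0≤ρ (suc i) (K (suc i)))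
      alive : ∀ i → 0ℚ < ρ i (K i)
      alive zero  = proj₁ (proj₂ chosen)
      alive (suc i) = proj₂ (tail-ok i)
      no-conflict : ∀ i j → toℕ i ℕ.< toℕ j → cf j (K j) i (K i) ≡ false
      no-conflict zero  (suc j) _ = proj₁ (tail-ok j)
      no-conflict (suc i) (suc j) (ℕ.s≤s i<j) = Clique.no-conflict rest i j i<j
      rearrange : V + ∑ (λ i → u i (K i)) + pairSum (λ i j → w₂ i (K i) j (K j)) ≡
        V′ + ∑ (λ i → u (suc i) (K (suc i)) + w₂ zero v (suc i) (K (suc i))) + pairSum (λ i j → w₂ (suc i) (K (suc i)) (suc j) (K (suc j))) + w zero v
      rearrange = trans (lem V (u zero v) (w zero v) _ _ _)
        (cong (λ z → V′ + z + pairSum (λ i j → w₂ (suc i) (K (suc i)) (suc j) (K (suc j))) + w zero v)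
          (sym (∑-+ (λ i → u (suc i) (K (suc i))) (λ i → w₂ zero v (suc i) (K (suc i))))))
        where
        lem : ∀ V uv wv U Y T → V + (uv + U) + (Y + T) ≡ (V + uv - wv) + (U + Y) + T + wv
        lem = solve-∀ ℚring

  -- Caps on the weights from conflict bounds on blocks

  module Caps {k n : ℕ} (B M : ℕ) {{_ : NonZero B}} (k≤MB : k ℕ.≤ M ℕ.* B) (d : Fin k → Fin k → Fin n → ℕ)
    (F A L : ℚ) (S t : ℕ → ℚ)
    (block≤F : ∀ b m x → ι (∑ℕ λ j → bit (toℕ j ℕ./ B ≡ᵇ b) ℕ.* d j m x) ≤ F)
    (0≤t : ∀ b → 0ℚ ≤ t b) (0≤S : ∀ b → 0ℚ ≤ S b) (S-antitone : ∀ {b c} → b ℕ.≤ c → S c ≤ S b) (S0≡1 : S 0 ≡ 1ℚ)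
    (drop : ∀ {b} → b ℕ.< M → S (suc b) ≤ S b * (1ℚ - t b * F))
    (A-bound : ∀ {b} → b ℕ.< M → 1ℚ ≤ A * S (suc b))
    (own : ∀ {b} → b ℕ.< M → 1ℚ ≤ S (suc b) * (L * t b))
    (tF≤½ : ∀ {b} → b ℕ.< M → t b * F ≤ ½)
    (0≤A : 0ℚ ≤ A) (0≤L : 0ℚ ≤ L) where

    blk : ℕ → ℕ
    blk i = i ℕ./ B

    earlier : ℕ → Fin k → ℕ
    earlier i j = bit ((toℕ j <ᵇ i) ∧ (blk (toℕ j) ≡ᵇ blk i))

    -- Within a block only the total number of conflicts is bounded, not their distribution over its
    -- parts. The cap must therefore depend on how many conflicts of `x` have been passed.
    pre : ℕ → Fin k → Fin n → ℕ
    pre i m x = ∑ℕ λ j → earlier i j ℕ.* d j m x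

    -- Within a block 1/ρ decreases linearly in the number of conflicts met so far, from S b down to S (suc b) at worst.
    τ : ℕ → Fin k → Fin n → ℚ
    τ i m x = S (blk i) * (1ℚ - t (blk i) * ι (pre i m x))

    blk<M : ∀ (i : Fin k) → blk (toℕ i) ℕ.< M
    blk<M i = ℕ.m<n*o⇒m/o<n (ℕ.<-≤-trans (Fin.toℕ<n i) k≤MB)

    same-block : ∀ i j → earlier (toℕ i) j ℕ.+ bit (does (j Fin.≟ i)) ℕ.≤ bit (blk (toℕ j) ≡ᵇ blk (toℕ i))
    same-block i j with j Fin.≟ i
    ... | yes refl rewrite ≡ᵇ-refl (blk (toℕ j)) with toℕ j <ᵇ toℕ j in lt
    ...  | false = ℕ.≤-refl
    ...  | true  = contradiction (ℕ.<ᵇ⇒< (toℕ j) (toℕ j) (subst Bool.T (sym lt) tt)) (ℕ.<-irrefl refl)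
    same-block i j | no _ with toℕ j <ᵇ toℕ i
    ...  | true  = ℕ.≤-reflexive (ℕ.+-identityʳ _)
    ...  | false = ℕ.z≤n

    split-delta : ∀ (c : Fin k → ℕ) (i m : Fin k) x →
      (∑ℕ λ j → (c j ℕ.+ bit (does (j Fin.≟ i))) ℕ.* d j m x) ≡ (∑ℕ λ j → c j ℕ.* d j m x) ℕ.+ d i m x
    split-delta c i m x = trans (∑ℕ-cong λ j → trans (ℕ.*-distribʳ-+ (d j m x) (c j) _) (cong (c j ℕ.* d j m x ℕ.+_) (ℕ.*-comm (bit (does (j Fin.≟ i))) (d j m x))))
      (trans (∑ℕ-+ (λ j → c j ℕ.* d j m x) (λ j → d j m x ℕ.* bit (does (j Fin.≟ i)))) (cong (∑ℕ (λ j → c j ℕ.* d j m x) ℕ.+_) (∑-delta i (λ j → d j m x))))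

    pre+d≤F : ∀ i m x → ι (pre (toℕ i) m x ℕ.+ d i m x) ≤ F
    pre+d≤F i m x = ≤-trans (ι-mono (subst (ℕ._≤ ∑ℕ (λ j → bit (blk (toℕ j) ≡ᵇ blk (toℕ i)) ℕ.* d j m x)) (split-delta (earlier (toℕ i)) i m x)
      (∑ℕ-mono λ j → ℕ.*-monoˡ-≤ (d j m x) (same-block i j)))) (block≤F (blk (toℕ i)) m x)

    pre≤F : ∀ i m x → ι (pre (toℕ i) m x) ≤ F
    pre≤F i m x = ≤-trans (ι-mono (ℕ.m≤m+n _ _)) (pre+d≤F i m x)

    S-drop : ∀ (i : Fin k) {z} → z ≤ F → S (suc (blk (toℕ i))) ≤ S (blk (toℕ i)) * (1ℚ - t (blk (toℕ i)) * z)
    S-drop i z≤F = ≤-trans (drop (blk<M i)) (*-monoˡ (0≤S _) (+-monoʳ-≤ 1ℚ (neg-antimono-≤ (*-monoˡ (0≤t (blk (toℕ i))) z≤F))))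

    S≤τ : ∀ i m x → S (suc (blk (toℕ i))) ≤ τ (toℕ i) m x
    S≤τ i m x = S-drop i (pre≤F i m x)

    τ≥ : ∀ i m x → 1ℚ ≤ A * τ (toℕ i) m x
    τ≥ i m x = ≤-trans (A-bound (blk<M i)) (*-monoˡ 0≤A (S≤τ i m x))

    -- A weight may have grown to `1 / S (suc b)` by the end of its block; `own` makes `t b` large
    -- enough for that case.
    τ-own : ∀ i y → 1ℚ ≤ τ (toℕ i) i y * (L * t (blk (toℕ i)))
    τ-own i y = ≤-trans (own (blk<M i)) (*-monoʳ (0≤* 0≤L (0≤t (blk (toℕ i)))) (S≤τ i i y))

    td≤½ : ∀ i m x → t (blk (toℕ i)) * ι (d i m x) ≤ ½
    td≤½ i m x = ≤-trans (*-monoˡ (0≤t (blk (toℕ i))) (≤-trans (ι-mono (ℕ.m≤n+m _ _)) (pre+d≤F i m x))) (tF≤½ (blk<M i))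

    pre-0 : ∀ m x → pre 0 m x ≡ 0
    pre-0 m x = ∑ℕ-0 k

    τ₀≡1 : ∀ m x → τ 0 m x ≡ 1ℚ
    τ₀≡1 m x = begin
      S (blk 0) * (1ℚ - t (blk 0) * ι (pre 0 m x))  ≡⟨ cong₂ (λ b z → S b * (1ℚ - t b * z)) (ℕ.0/n≡0 B) (trans (cong ι (pre-0 m x)) ι0≡0) ⟩
      S 0 * (1ℚ - t 0 * 0ℚ)  ≡⟨ cong₂ (λ s z → s * (1ℚ - z)) S0≡1 (*-zeroʳ (t 0)) ⟩
      1ℚ  ∎
      where open ≡-Reasoning

    linearise : ∀ s t p d → 0ℚ ≤ s → 0ℚ ≤ t → 0ℚ ≤ p → 0ℚ ≤ d → s * (1ℚ - t * (p + d)) ≤ s * (1ℚ - t * p) * (1ℚ - t * d)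
    linearise s t p d 0≤s 0≤t 0≤p 0≤d = ≤-cert (s * (t * p * (t * d))) (0≤* 0≤s (0≤* (0≤* 0≤t 0≤p) (0≤* 0≤t 0≤d))) (lem s t p d)
      where
      lem : ∀ s t p d → s * (1ℚ - t * p) * (1ℚ - t * d) ≡ s * (1ℚ - t * (p + d)) + s * (t * p * (t * d))
      lem = solve-∀ ℚring

    τ-step : ∀ i m x → τ (suc (toℕ i)) m x ≤ τ (toℕ i) m x * (1ℚ - t (blk (toℕ i)) * ι (d i m x))
    τ-step i m x = ≤-trans main (linearise (S b) (t b) (ι (pre (toℕ i) m x)) (ι (d i m x)) (0≤S b) (0≤t b) (0≤ι _) (0≤ι _))
      where
      b = blk (toℕ i)
      b′ = blk (suc (toℕ i))
      b≤b′ : b ℕ.≤ b′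
      b≤b′ = ℕ./-monoˡ-≤ B (ℕ.n≤1+n (toℕ i))
      main : τ (suc (toℕ i)) m x ≤ S b * (1ℚ - t b * (ι (pre (toℕ i) m x) + ι (d i m x)))
      main with b ℕ.≟ b′
      ... | yes b≡b′ = subst (λ c → S c * (1ℚ - t c * ι (pre (suc (toℕ i)) m x)) ≤ S b * (1ℚ - t b * (ι (pre (toℕ i) m x) + ι (d i m x)))) b≡b′
          (*-monoˡ (0≤S b) (+-monoʳ-≤ 1ℚ (neg-antimono-≤ (*-monoˡ (0≤t b) (subst (_≤ ι (pre (suc (toℕ i)) m x)) (ι-+ (pre (toℕ i) m x) (d i m x)) (ι-mono grow))))))
        where
        pointwise : ∀ j → earlier (toℕ i) j ℕ.+ bit (does (j Fin.≟ i)) ℕ.≤ earlier (suc (toℕ i)) j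
        pointwise j rewrite sym b≡b′ with j Fin.≟ i
        ... | yes refl rewrite ≡ᵇ-refl (blk (toℕ j)) | <ᵇ-true (ℕ.n<1+n (toℕ j)) with toℕ j <ᵇ toℕ j in lt
        ...  | false = ℕ.≤-refl
        ...  | true  = contradiction (ℕ.<ᵇ⇒< (toℕ j) (toℕ j) (subst Bool.T (sym lt) tt)) (ℕ.<-irrefl refl)
        pointwise j | no _ with toℕ j <ᵇ toℕ i in lt
        ...  | false = ℕ.z≤n
        ...  | true rewrite <ᵇ-true (ℕ.m<n⇒m<1+n (ℕ.<ᵇ⇒< (toℕ j) (toℕ i) (subst Bool.T (sym lt) tt))) = ℕ.≤-reflexive (ℕ.+-identityʳ _)
        grow : pre (toℕ i) m x ℕ.+ d i m x ℕ.≤ pre (suc (toℕ i)) m x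
        grow = subst (ℕ._≤ pre (suc (toℕ i)) m x) (split-delta (earlier (toℕ i)) i m x) (∑ℕ-mono λ j → ℕ.*-monoˡ-≤ (d j m x) (pointwise j))
      -- A new block begins: `pre` restarts at 0, and the drop from `S b` already pays for every
      -- conflict of the old block.
      ... | no b≢b′ = ≤-trans (≤-reflexive fresh) (≤-trans (S-antitone (ℕ.≤∧≢⇒< b≤b′ b≢b′))
          (S-drop i (subst (_≤ F) (ι-+ (pre (toℕ i) m x) (d i m x)) (pre+d≤F i m x))))
        where
        none : ∀ j → earlier (suc (toℕ i)) j ≡ 0
        none j with toℕ j <ᵇ suc (toℕ i) in lt | blk (toℕ j) ≡ᵇ b′ in eq
        ... | false | _  = refl
        ... | true  | false = refl
        ... | true  | true  = contradiction (ℕ.≤-antisym b≤b′ (subst (ℕ._≤ b) (ℕ.≡ᵇ⇒≡ _ b′ (subst Bool.T (sym eq) tt))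
                (ℕ./-monoˡ-≤ B (ℕ.≤-pred (ℕ.<ᵇ⇒< (toℕ j) (suc (toℕ i)) (subst Bool.T (sym lt) tt)))))) b≢b′
        fresh : τ (suc (toℕ i)) m x ≡ S b′
        fresh = trans (cong (λ z → S b′ * (1ℚ - t b′ * z)) (trans (cong ι (trans (∑ℕ-cong λ j → cong (ℕ._* d j m x) (none j)) (∑ℕ-0 k))) ι0≡0))
          (trans (cong (λ z → S b′ * (1ℚ - z)) (*-zeroʳ (t b′))) (*-identityʳ (S b′)))

  -- The step with a bounded number of blocks

  module Large {k n : ℕ} (G : Conflicts k n) (B : ℕ) {{_ : NonZero B}} (p : ℕ) (a : Fin k → Fin n → Bool)
    (N D F A Z M Θ p′ : ℕ)
    (0<N : 0 ℕ.< N) (2≤Θ : 2 ℕ.≤ Θ) (A≤N : A ℕ.≤ N) (k≤MB : k ℕ.≤ M ℕ.* B) (M<Z : M ℕ.< Z)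
    (Z≤A[Z-M] : Z ℕ.≤ A ℕ.* (Z ∸ M)) (2A≤Z : 2 ℕ.* A ℕ.≤ Z)
    (part-size : ∀ j → ∑ℕ (λ y → bit (a j y)) ≡ N)
    (deg≤D : ∀ i x j → ∑ℕ (λ y → bit (Conflicts.cf G i x j y)) ℕ.≤ D)
    (size≤F : ∀ t → Potential.Tests.size p (BlockTests.blockTest G B) a t ℕ.≤ F)
    (block-room : ∀ {b} → b ℕ.< M → (Z ∸ b) ℕ.* (F ℕ.* (Z ℕ.* Θ)) ℕ.≤ (Z ∸ suc b) ℕ.* ((Θ ∸ 1) ℕ.* N))
    (N-large : 4 ℕ.* (A ℕ.* A) ℕ.* (2 ℕ.+ p) ℕ.* Θ ℕ.≤ N)
    (k-large : 5 ℕ.* Θ ℕ.^ 7 ℕ.* (k ℕ.* (k ℕ.* (48 ℕ.* (A ℕ.* A ℕ.* (D ℕ.* D)))) ℕ.^ 3) ℕ.≤ N ℕ.^ 5)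
    (p′-small : p′ ℕ.* Θ ℕ.+ 3 ℕ.* (2 ℕ.+ p) ℕ.≤ (2 ℕ.+ p) ℕ.* Θ) where

    open Conflicts G
    open BlockTests G B
    open Potential p
    open Tests blockTest

    θ iN : ℚ
    θ = inv Θ
    iN = inv N

    0<Θ : 0 ℕ.< Θ
    0<Θ = ℕ.<-≤-trans (ℕ.s≤s ℕ.z≤n) 2≤Θ

    ιΘθ≡1 : ι Θ * θ ≡ 1ℚ
    ιΘθ≡1 = ι*inv 0<Θ

    ιNiN≡1 : ι N * iN ≡ 1ℚ
    ιNiN≡1 = ι*inv 0<N

    0≤θ : 0ℚ ≤ θ
    0≤θ = 0≤inv Θ

    0≤iN : 0ℚ ≤ iN
    0≤iN = 0≤inv N

    ι2 : ι 2 ≡ 2ℚ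
    ι2 = trans (ι-+ 1 1) (trans (cong₂ _+_ ι1≡1 ι1≡1) refl)

    θ≤½ : θ ≤ ½
    θ≤½ = *-cancelˡ {2ℚ} (positive⁻¹ 2ℚ) (subst (λ c → c * θ ≤ 1ℚ) ι2 (x*inv≤1 0<Θ (ι-mono 2≤Θ)))

    θ<1 : θ < 1ℚ
    θ<1 = ≤-<-trans θ≤½ (*<* (ℤ.+<+ (ℕ.s≤s (ℕ.s≤s ℕ.z≤n))))

    0<1-θ : 0ℚ < 1ℚ - θ
    0<1-θ = <-diff {θ} {1ℚ} θ<1

    0≤1-θ : 0ℚ ≤ 1ℚ - θ
    0≤1-θ = <⇒≤ 0<1-θ

    0<ιN : 0ℚ < ι N
    0<ιN = subst (_< ι N) ι0≡0 (ι-mono-< 0<N)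

    η P : ℚ
    η = ι N * θ
    P = ι ((2 ℕ.+ p) ℕ.* Φ a)

    0≤P : 0ℚ ≤ P
    0≤P = 0≤ι _

    -- The value of `κ * η⁶`. It has to exceed any possible gain; the `1` keeps `κ` positive when
    -- `P = 0`, and for `P ≥ 1` the whole is at most `5 * P`, which explains the factors 5 below.
    4P+1 : ℚ
    4P+1 = P + P + P + P + 1ℚ

    0<4P+1 : 0ℚ < 4P+1
    0<4P+1 = <-≤-trans (positive⁻¹ 1ℚ) (≤-cert (P + P + P + P) (0≤+ (0≤+ (0≤+ 0≤P 0≤P) 0≤P) 0≤P) (+-comm (P + P + P + P) 1ℚ))

    -- `Y` is the inverse sixth power of `η`. The choice of `γ` rests on `(1 − θ) * (1 + θ) ≤ 1`,
    -- that of `α` on `θ ≤ ½`.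
    Y κ γ α : ℚ
    Y = iN * ι Θ * (iN * ι Θ) * (iN * ι Θ * (iN * ι Θ)) * (iN * ι Θ * (iN * ι Θ))
    κ = 4P+1 * Y
    γ = (1ℚ - θ) * iN
    α = 2ℚ * ι A * iN

    0<iN : 0ℚ < iN
    0<iN = 0<inv 0<N

    0<ιΘ : 0ℚ < ι Θ
    0<ιΘ = subst (_< ι Θ) ι0≡0 (ι-mono-< 0<Θ)

    0<Y : 0ℚ < Y
    0<Y = 0<* (0<* (0<* y y) (0<* y y)) (0<* y y)
      where y = 0<* 0<iN 0<ιΘ

    constants : Constants
    constants = record
      { N = ι N ; η = η ; γ = γ ; α = α ; A = ι A ; D = ι D ; κ = κ
      ; 0≤η = 0≤* (0≤ι N) 0≤θ
      ; η<N = subst (η <_) (*-identityʳ (ι N)) (*-monoʳ-<-pos (ι N) {{positive 0<ιN}} θ<1)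
      ; 0≤γ = 0≤* 0≤1-θ 0≤iN
      ; 0≤α = 0≤* (0≤* 0≤2 (0≤ι A)) 0≤iN
      ; 0≤A = 0≤ι A
      ; 0≤D = 0≤ι D
      ; 0<κ = 0<* 0<4P+1 0<Y
      ; γ-bound = ≤-trans (≤-reflexive (trans (lem₁ (ι N) θ iN) (cong (_* (1ℚ - θ * θ)) ιNiN≡1)))
          (≤-cert (θ * θ) (0≤sq θ) (lem₆ (θ * θ)))
      ; α-bound = ≤-trans (≤-cert _ (0≤* (0≤* 0≤2 (0≤ι A)) (≤-diff θ≤½)) (lem₃ (ι A) θ))
          (≤-reflexive (trans (cong (λ z → 2ℚ * ι A * (z * (1ℚ - θ))) (sym ιNiN≡1)) (lem₄ (ι A) (ι N) iN θ)))
      ; γA≤1 = ≤-trans (≤-reflexive (lem₅ θ iN (ι A))) (≤-trans (*-mono 0≤1-θ 0≤1 (≤-cert θ 0≤θ (lem₂ θ)) (x*inv≤1 0<N (ι-mono A≤N))) (≤-reflexive (*-identityʳ 1ℚ)))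
      }
      where
      lem₁ : ∀ N θ i → (1ℚ - θ) * i * (N + N * θ) ≡ N * i * (1ℚ - θ * θ)
      lem₁ = solve-∀ ℚring
      lem₂ : ∀ x → 1ℚ ≡ (1ℚ - x) + x
      lem₂ = solve-∀ ℚring
      lem₆ : ∀ x → 1ℚ ≡ 1ℚ * (1ℚ - x) + x
      lem₆ = solve-∀ ℚring
      lem₃ : ∀ A θ → 2ℚ * A * (1ℚ * (1ℚ - θ)) ≡ A + 2ℚ * A * (½ - θ)
      lem₃ = solve-∀ ℚring
      lem₄ : ∀ A N i θ → 2ℚ * A * (N * i * (1ℚ - θ)) ≡ 2ℚ * A * i * (N - N * θ)
      lem₄ = solve-∀ ℚring
      lem₅ : ∀ θ i A → (1ℚ - θ) * i * A ≡ (1ℚ - θ) * (A * i)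
      lem₅ = solve-∀ ℚring

    -- The reciprocal cap falls linearly, by `1 / Z` per block, and after `M` blocks is still at
    -- least `1 / A`. `t b` is the solution of `S (suc b) * (N − η) * t b = 1`, so `own` is an
    -- equality, and `block-room` says that a block uses up no more than its `1 / Z`.
    S t : ℕ → ℚ
    S b = ι (Z ∸ b) * inv Z
    t b = ι (Z ℕ.* Θ) * inv ((Z ∸ suc b) ℕ.* ((Θ ∸ 1) ℕ.* N))

    0<Z : 0 ℕ.< Z
    0<Z = ℕ.≤-<-trans ℕ.z≤n M<Z

    0≤S : ∀ b → 0ℚ ≤ S b
    0≤S b = 0≤* (0≤ι (Z ∸ b)) (0≤inv Z)

    0≤t : ∀ b → 0ℚ ≤ t b
    0≤t b = 0≤* (0≤ι (Z ℕ.* Θ)) (0≤inv _)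

    S-antitone : ∀ {b c} → b ℕ.≤ c → S c ≤ S b
    S-antitone b≤c = *-monoʳ (0≤inv Z) (ι-mono (ℕ.∸-monoʳ-≤ Z b≤c))

    room>0 : ∀ {b} → b ℕ.< M → 0 ℕ.< (Z ∸ suc b) ℕ.* ((Θ ∸ 1) ℕ.* N)
    room>0 b<M = ℕ.*-mono-< (ℕ.m<n⇒0<n∸m (ℕ.≤-<-trans b<M M<Z)) (ℕ.*-mono-< (ℕ.m<n⇒0<n∸m 2≤Θ) 0<N)

    S-step : ∀ {b} → b ℕ.< M → S b ≡ S (suc b) + inv Z
    S-step {b} b<M = trans (cong (λ m → ι m * inv Z) (ℕ.+-∸-assoc 1 {Z} {suc b} (ℕ.<-trans b<M M<Z)))
      (trans (cong (_* inv Z) (trans (ι-+ 1 (Z ∸ suc b)) (cong (_+ ι (Z ∸ suc b)) ι1≡1))) (lem (ι (Z ∸ suc b)) (inv Z)))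
      where
      lem : ∀ a z → (1ℚ + a) * z ≡ a * z + z
      lem = solve-∀ ℚring

    StF≤ : ∀ {b} → b ℕ.< M → S b * (t b * ι F) ≤ inv Z
    StF≤ {b} b<M = begin
      S b * (t b * ι F)  ≡⟨ lem (ι (Z ∸ b)) (inv Z) (ι (Z ℕ.* Θ)) (inv m) (ι F) ⟩
      inv Z * (ι (Z ∸ b) * (ι F * ι (Z ℕ.* Θ)) * inv m)  ≡⟨ cong (λ z → inv Z * (z * inv m)) (trans (cong (ι (Z ∸ b) *_) (sym (ι-* F (Z ℕ.* Θ)))) (sym (ι-* (Z ∸ b) (F ℕ.* (Z ℕ.* Θ))))) ⟩
      inv Z * (ι ((Z ∸ b) ℕ.* (F ℕ.* (Z ℕ.* Θ))) * inv m)  ≤⟨ *-monoˡ (0≤inv Z) (x*inv≤1 (room>0 b<M) (ι-mono (block-room b<M))) ⟩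
      inv Z * 1ℚ  ≡⟨ *-identityʳ (inv Z) ⟩
      inv Z  ∎
      where
      open ≤-Reasoning
      m = (Z ∸ suc b) ℕ.* ((Θ ∸ 1) ℕ.* N)
      lem : ∀ s z u m f → s * z * (u * m * f) ≡ z * (s * (f * u) * m)
      lem = solve-∀ ℚring

    drop : ∀ {b} → b ℕ.< M → S (suc b) ≤ S b * (1ℚ - t b * ι F)
    drop {b} b<M = ≤-cert (inv Z - S b * (t b * ι F)) (≤-diff (StF≤ b<M))
      (trans (lem (S b) (t b * ι F)) (trans (cong (_- S b * (t b * ι F)) (S-step b<M)) (lem′ (S (suc b)) (inv Z) (S b * (t b * ι F)))))
      where
      lem : ∀ s x → s * (1ℚ - x) ≡ s - s * x
      lem = solve-∀ ℚring
      lem′ : ∀ a z x → a + z - x ≡ a + (z - x)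
      lem′ = solve-∀ ℚring

    A-bound : ∀ {b} → b ℕ.< M → 1ℚ ≤ ι A * S (suc b)
    A-bound {b} b<M = begin
      1ℚ  ≡⟨ sym (ι*inv 0<Z) ⟩
      ι Z * inv Z  ≤⟨ *-monoʳ (0≤inv Z) (ι-mono (ℕ.≤-trans Z≤A[Z-M] (ℕ.*-monoʳ-≤ A (ℕ.∸-monoʳ-≤ Z b<M)))) ⟩
      ι (A ℕ.* (Z ∸ suc b)) * inv Z  ≡⟨ cong (_* inv Z) (ι-* A (Z ∸ suc b)) ⟩
      ι A * ι (Z ∸ suc b) * inv Z  ≡⟨ *-assoc (ι A) _ _ ⟩
      ι A * S (suc b)  ∎
      where open ≤-Reasoning

    own : ∀ {b} → b ℕ.< M → 1ℚ ≤ S (suc b) * ((ι N - η) * t b)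
    own {b} b<M = ≤-reflexive (sym (begin
      S (suc b) * ((ι N - ι N * θ) * t b)
        ≡⟨ cong (λ u → S (suc b) * ((ι N - ι N * θ) * (u * inv m))) (ι-* Z Θ) ⟩
      z * inv Z * ((ι N - ι N * θ) * (ι Z * ι Θ * inv m))
        ≡⟨ lem₁ z (inv Z) (ι N) θ (ι Z) (ι Θ) (inv m) ⟩
      ι Z * inv Z * (z * ((ι Θ - ι Θ * θ) * ι N) * inv m)
        ≡⟨ cong₂ (λ u v → u * (z * ((ι Θ - v) * ι N) * inv m)) (ι*inv 0<Z) ιΘθ≡1 ⟩
      1ℚ * (z * ((ι Θ - 1ℚ) * ι N) * inv m)
        ≡⟨ cong (λ u → 1ℚ * (z * (u * ι N) * inv m)) Θ-1 ⟩
      1ℚ * (z * (ι (Θ ∸ 1) * ι N) * inv m)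
        ≡⟨ cong (λ u → 1ℚ * (u * inv m)) (trans (cong (z *_) (sym (ι-* (Θ ∸ 1) N))) (sym (ι-* (Z ∸ suc b) ((Θ ∸ 1) ℕ.* N)))) ⟩
      1ℚ * (ι m * inv m)
        ≡⟨ trans (*-identityˡ (ι m * inv m)) (ι*inv (room>0 b<M)) ⟩
      1ℚ ∎))
      where
      open ≡-Reasoning
      m = (Z ∸ suc b) ℕ.* ((Θ ∸ 1) ℕ.* N)
      z = ι (Z ∸ suc b)
      lem₁ : ∀ z iZ N θ Z Θ im → z * iZ * ((N - N * θ) * (Z * Θ * im)) ≡ Z * iZ * (z * ((Θ - Θ * θ) * N) * im)
      lem₁ = solve-∀ ℚring
      lem₂ : ∀ a → (1ℚ + a) - 1ℚ ≡ a
      lem₂ = solve-∀ ℚring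
      Θ-1 : ι Θ - 1ℚ ≡ ι (Θ ∸ 1)
      Θ-1 = trans (cong (_- 1ℚ) (trans (cong ι (sym (ℕ.m+[n∸m]≡n 0<Θ))) (trans (ι-+ 1 (Θ ∸ 1)) (cong (_+ ι (Θ ∸ 1)) ι1≡1)))) (lem₂ (ι (Θ ∸ 1)))

    tF≤½ : ∀ {b} → b ℕ.< M → t b * ι F ≤ ½
    tF≤½ {b} b<M = begin
      t b * ι F  ≡⟨ sym (*-identityˡ _) ⟩
      1ℚ * (t b * ι F)  ≤⟨ *-monoʳ (0≤* (0≤t b) (0≤ι F)) (≤-trans (A-bound b<M) (*-monoˡ (0≤ι A) (S-antitone (ℕ.n≤1+n b)))) ⟩
      ι A * S b * (t b * ι F)  ≡⟨ *-assoc (ι A) (S b) _ ⟩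
      ι A * (S b * (t b * ι F))  ≤⟨ *-monoˡ (0≤ι A) (StF≤ b<M) ⟩
      ι A * inv Z  ≤⟨ *-cancelˡ {2ℚ} (positive⁻¹ 2ℚ) (≤-trans (≤-reflexive (trans (sym (*-assoc 2ℚ (ι A) (inv Z))) (cong (_* inv Z) (trans (cong (_* ι A) (sym ι2)) (sym (ι-* 2 A))))))
                                             (x*inv≤1 0<Z (ι-mono 2A≤Z))) ⟩
      ½  ∎
      where open ≤-Reasoning

    d : Fin k → Fin k → Fin n → ℕ
    d j i x = deg a j i x

    open Caps B M k≤MB d (ι F) (ι A) (ι N - η) S t (λ b m x → ι-mono (block-deg≤ p a F size≤F b m x))
      0≤t 0≤S S-antitone (ι*inv 0<Z) drop A-bound own tF≤½ (0≤ι A) (≤-diff (<⇒≤ (Constants.η<N constants)))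

    open RandomClique n constants

    conflict : Fin k → Fin n → Fin k → Fin n → Bool
    conflict m x i y = a i y ∧ cf m x i y

    deg-ℚ : ∀ i m x → ∑ (λ y → 𝟙 (conflict m x i y)) ≡ ι (d i m x)
    deg-ℚ i m x = trans (∑-cong λ y → trans (sym (ι-bit (conflict m x i y))) (cong ι (bit-∧ (a i y) (cf m x i y)))) (sym (ι-∑ λ y → bit (a i y) ℕ.* bit (cf m x i y)))

    w₀ : Fin k → Fin n → ℚ
    w₀ m x = ι (weight a m x)

    w₂₀ : Fin k → Fin n → Fin k → Fin n → ℚ
    w₂₀ m x i y = ι (weight₂ a m x i y)

    col : ∀ b c c′ → c ≡ c′ → bit (b ∧ c) ℕ.≤ bit c′
    col true  c c′ refl = ℕ.≤-refl
    col false c c′ _  = ℕ.z≤n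

    -- A count in a single part, which the block bound `F` does not control sharply; symmetry
    -- reduces it to the degree bound of the whole graph.
    conflict≤D : ∀ m i y → ∑ (λ x → 𝟙 (conflict m x i y)) ≤ ι D
    conflict≤D m i y = begin
      ∑ (λ x → 𝟙 (conflict m x i y))  ≡⟨ ∑-cong (λ x → sym (ι-bit (conflict m x i y))) ⟩
      ∑ (λ x → ι (bit (conflict m x i y)))  ≡⟨ sym (ι-∑ λ x → bit (conflict m x i y)) ⟩
      ι (∑ℕ λ x → bit (conflict m x i y))  ≤⟨ ι-mono (ℕ.≤-trans (∑ℕ-mono λ x → col (a i y) (cf m x i y) (cf i y m x) (cf-sym m x i y)) (deg≤D i y m)) ⟩
      ι D  ∎
      where open ≤-Reasoning

    start-cap : ∀ m x → 𝟙 (a m x) * τ 0 m x ≤ 1ℚ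
    start-cap m x = begin
      𝟙 (a m x) * τ 0 m x  ≡⟨ cong (𝟙 (a m x) *_) (τ₀≡1 m x) ⟩
      𝟙 (a m x) * 1ℚ  ≡⟨ *-identityʳ (𝟙 (a m x)) ⟩
      𝟙 (a m x)  ≤⟨ 𝟙≤1 (a m x) ⟩
      1ℚ  ∎
      where open ≤-Reasoning

    start-step : ∀ i m x → τ (suc (toℕ i)) m x ≤ τ (toℕ i) m x * (1ℚ - t (blk (toℕ i)) * ∑ (λ y → 𝟙 (conflict m x i y)))
    start-step i m x = ≤-trans (τ-step i m x) (≤-reflexive (cong (λ z → τ (toℕ i) m x * (1ℚ - t (blk (toℕ i)) * z)) (sym (deg-ℚ i m x))))

    start-half : ∀ i m x → t (blk (toℕ i)) * ∑ (λ y → 𝟙 (conflict m x i y)) ≤ ½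
    start-half i m x = ≤-trans (≤-reflexive (cong (t (blk (toℕ i)) *_) (deg-ℚ i m x))) (td≤½ i m x)

    start : State k
    start = record
      { cf = conflict ; w = w₀ ; u = λ _ _ → 0ℚ ; w₂ = w₂₀
      ; ρ = λ m x → 𝟙 (a m x) ; τ = τ ; t = λ i → t (blk (toℕ i))
      ; 0≤w = λ m x → 0≤ι (weight a m x) ; 0≤u = λ m x → ≤-refl ; 0≤w₂ = λ m x i y → 0≤ι (weight₂ a m x i y)
      ; 0≤ρ = λ m x → 0≤𝟙 (a m x) ; 0≤t = λ i → 0≤t (blk (toℕ i))
      ; cf≤D = conflict≤D
      ; cap = start-cap
      ; τ≥ = τ≥ ; τ-own = τ-own
      ; τ-step = start-step
      ; half = start-half
      }

    T₂ : ℚ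
    T₂ = total₂ w₂₀

    Kn : ℕ
    Kn = k ℕ.* (k ℕ.* (48 ℕ.* (A ℕ.* A ℕ.* (D ℕ.* D)))) ℕ.^ 3

    -- `V` is the largest target that the initial state permits: gain minus pair costs `c₂` and
    -- penalty `c₃`.
    c₂ c₃ V : ℚ
    c₂ = α * α * T₂
    c₃ = κ * ι Kn
    V = γ * P - (c₂ + c₃)

    total-w₀ : total w₀ ≡ P
    total-w₀ = trans (∑-cong λ m → sym (ι-∑ (weight a m))) (trans (sym (ι-∑ λ m → ∑ℕ (weight a m))) (cong ι (weight-total a)))

    gain-start : gain start ≡ γ * P
    gain-start = cong (γ *_) (trans (∑-cong λ m → ∑-cong λ x → absorb m x (a m x) refl) total-w₀)
      where
      absorb : ∀ m x c → a m x ≡ c → 𝟙 c * w₀ m x ≡ w₀ m x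
      absorb m x true  _  = *-identityˡ (w₀ m x)
      absorb m x false dead = trans (*-zeroˡ (w₀ m x)) (trans (sym ι0≡0) (cong ι (sym (weight-alive p a m x dead))))

    ∑-const : ∀ r c → ∑ {r} (λ _ → c) ≡ ι r * c
    ∑-const zero  c = sym (trans (cong (_* c) ι0≡0) (*-zeroˡ c))
    ∑-const (suc r) c = trans (cong (c +_) (∑-const r c)) (trans (lem c (ι r)) (cong (_* c) (sym (trans (ι-+ 1 r) (cong (_+ ι r) ι1≡1)))))
      where
      lem : ∀ c r → c + r * c ≡ (1ℚ + r) * c
      lem = solve-∀ ℚring

    slack≡ : ∀ e r → slack e r ≡ ι r * e
    slack≡ e zero  = sym (trans (cong (_* e) ι0≡0) (*-zeroˡ e))
    slack≡ e (suc r) = trans (cong (_+ e) (slack≡ e r)) (trans (lem e (ι r)) (cong (_* e) (sym (trans (ι-+ 1 r) (cong (_+ ι r) ι1≡1)))))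
      where
      lem : ∀ e r → r * e + e ≡ (1ℚ + r) * e
      lem = solve-∀ ℚring

    e≡ : e ≡ ι (48 ℕ.* (A ℕ.* A ℕ.* (D ℕ.* D)))
    e≡ = begin
      12ℚ * (2ℚ * (ι A * ι D) * (2ℚ * (ι A * ι D)))  ≡⟨ cong₂ (λ u v → u * (v * v)) (sym (ι≡ℕtoℚ 12)) (trans (cong₂ _*_ (sym ι2) (sym (ι-* A D))) (sym (ι-* 2 (A ℕ.* D)))) ⟩
      ι 12 * (ι (2 ℕ.* (A ℕ.* D)) * ι (2 ℕ.* (A ℕ.* D)))  ≡⟨ trans (cong (ι 12 *_) (sym (ι-* (2 ℕ.* (A ℕ.* D)) (2 ℕ.* (A ℕ.* D))))) (sym (ι-* 12 (2 ℕ.* (A ℕ.* D) ℕ.* (2 ℕ.* (A ℕ.* D))))) ⟩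
      ι (12 ℕ.* (2 ℕ.* (A ℕ.* D) ℕ.* (2 ℕ.* (A ℕ.* D))))  ≡⟨ cong ι (lem A D) ⟩
      ι (48 ℕ.* (A ℕ.* A ℕ.* (D ℕ.* D)))  ∎
      where
      open ≡-Reasoning
      lem : ∀ A D → 12 ℕ.* (2 ℕ.* (A ℕ.* D) ℕ.* (2 ℕ.* (A ℕ.* D))) ≡ 48 ℕ.* (A ℕ.* A ℕ.* (D ℕ.* D))
      lem = ℕ-Solver.solve-∀

    excess-start : ∀ m → State.excess start m ≡ 0ℚ
    excess-start m = trans (cong (_- ι N) (trans (∑-cong λ x → sym (ι-bit (a m x))) (trans (sym (ι-∑ λ x → bit (a m x))) (cong ι (part-size m))))) (+-inverseʳ (ι N))

    sixth-start : ∑ (λ m → sixth k (State.excess start m)) ≡ ι Kn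
    sixth-start = begin
      ∑ (λ m → sixth k (State.excess start m))  ≡⟨ ∑-cong (λ m → trans (cong (sixth k) (excess-start m)) (trans (cong (λ z → z * z * z) (trans (lem (slack e k)) slack≡′)) (cube (k ℕ.* E)))) ⟩
      ∑ {k} (λ _ → ι ((k ℕ.* E) ℕ.^ 3))  ≡⟨ ∑-const k (ι ((k ℕ.* E) ℕ.^ 3)) ⟩
      ι k * ι ((k ℕ.* E) ℕ.^ 3)  ≡⟨ sym (ι-* k ((k ℕ.* E) ℕ.^ 3)) ⟩
      ι Kn  ∎
      where
      open ≡-Reasoning
      E = 48 ℕ.* (A ℕ.* A ℕ.* (D ℕ.* D))
      lem : ∀ s → 0ℚ * 0ℚ + s ≡ s
      lem s = trans (cong (_+ s) (*-zeroˡ 0ℚ)) (+-identityˡ s)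
      slack≡′ : slack e k ≡ ι (k ℕ.* E)
      slack≡′ = trans (slack≡ e k) (trans (cong (ι k *_) e≡) (sym (ι-* k E)))
      lem′ : ∀ m → m ℕ.* m ℕ.* m ≡ m ℕ.^ 3
      lem′ m = trans (ℕ.*-assoc m m m) (cong (λ z → m ℕ.* (m ℕ.* z)) (sym (ℕ.*-identityʳ m)))
      cube : ∀ m → ι m * ι m * ι m ≡ ι (m ℕ.^ 3)
      cube m = trans (cong (_* ι m) (sym (ι-* m m))) (trans (sym (ι-* (m ℕ.* m) m)) (cong ι (lem′ m)))

    cost-start : cost start ≡ c₂ + c₃
    cost-start = cong₂ _+_ (trans (cong (_+ c₂) (trans (cong (α *_) (trans (∑-cong {f = λ m → ∑ (State.u start m)} {g = λ _ → 0ℚ} λ _ → ∑-0 n) (∑-0 k))) (*-zeroʳ α))) (+-identityˡ c₂))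
      (cong (κ *_) sixth-start)

    1≤ιN : 1ℚ ≤ ι N
    1≤ιN = subst (_≤ ι N) ι1≡1 (ι-mono 0<N)

    0≤T₂ : 0ℚ ≤ T₂
    0≤T₂ = 0≤total₂ {f = w₂₀} λ i y j z → 0≤ι (weight₂ a i y j z)

    0≤c₂ : 0ℚ ≤ c₂
    0≤c₂ = 0≤* (0≤sq α) 0≤T₂

    0≤c₃ : 0ℚ ≤ c₃
    0≤c₃ = 0≤* (<⇒≤ (0<* 0<4P+1 0<Y)) (0≤ι Kn)

    T₂≤ : T₂ ≤ ι (2 ℕ.+ p) * P
    T₂≤ = begin
      T₂  ≡⟨ sym casted ⟩
      ι (pairSumℕ λ i j → ∑ℕ λ y → ∑ℕ λ z → weight₂ a i y j z)  ≤⟨ ι-mono (ℕ.≤-trans (weight₂-total a) (ℕ.*-monoʳ-≤ (2 ℕ.+ p) (ℕ.*-monoˡ-≤ (Φ a) (ℕ.n≤1+n (1 ℕ.+ p))))) ⟩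
      ι ((2 ℕ.+ p) ℕ.* ((2 ℕ.+ p) ℕ.* Φ a))  ≡⟨ ι-* (2 ℕ.+ p) _ ⟩
      ι (2 ℕ.+ p) * P  ∎
      where
      open ≤-Reasoning
      casted : ι (pairSumℕ λ i j → ∑ℕ λ y → ∑ℕ λ z → weight₂ a i y j z) ≡ T₂
      casted = trans (ι-pairSum λ i j → ∑ℕ λ y → ∑ℕ λ z → weight₂ a i y j z)
        (pairSum-cong λ i j → trans (ι-∑ λ y → ∑ℕ λ z → weight₂ a i y j z) (∑-cong λ y → ι-∑ (weight₂ a i y j)))

    -- Pair costs are of order `p * P / N²`, smaller than the gain `P / N` by the factor `p / N`,
    -- which `N-large` makes small.
    Nc₂≤ : ι N * c₂ ≤ θ * P
    Nc₂≤ = begin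
      ι N * (α * α * T₂)  ≡⟨ lem₁ (ι N) (ι A) iN T₂ ⟩
      ι N * iN * (4ℚ * (ι A * ι A) * iN * T₂)  ≡⟨ trans (cong (_* (4ℚ * (ι A * ι A) * iN * T₂)) ιNiN≡1) (*-identityˡ _) ⟩
      4ℚ * (ι A * ι A) * iN * T₂  ≤⟨ *-monoˡ (0≤* (0≤* (nonNegative⁻¹ 4ℚ) (0≤sq (ι A))) 0≤iN) T₂≤ ⟩
      4ℚ * (ι A * ι A) * iN * (ι (2 ℕ.+ p) * P)  ≡⟨ sym (trans (cong (4ℚ * (ι A * ι A) * iN * (ι (2 ℕ.+ p) * P) *_) ιΘθ≡1) (*-identityʳ _)) ⟩
      4ℚ * (ι A * ι A) * iN * (ι (2 ℕ.+ p) * P) * (ι Θ * θ) ≡⟨ lem₂ (ι A) iN (ι (2 ℕ.+ p)) P (ι Θ) θ ⟩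
      4ℚ * (ι A * ι A) * ι (2 ℕ.+ p) * ι Θ * iN * (θ * P)  ≡⟨ cong (λ z → z * iN * (θ * P)) (sym casted) ⟩
      ι (4 ℕ.* (A ℕ.* A) ℕ.* (2 ℕ.+ p) ℕ.* Θ) * iN * (θ * P) ≤⟨ *-monoʳ (0≤* 0≤θ 0≤P) (x*inv≤1 0<N (ι-mono N-large)) ⟩
      1ℚ * (θ * P)  ≡⟨ *-identityˡ (θ * P) ⟩
      θ * P  ∎
      where
      open ≤-Reasoning
      lem₁ : ∀ N A i T → N * (2ℚ * A * i * (2ℚ * A * i) * T) ≡ N * i * (4ℚ * (A * A) * i * T)
      lem₁ = solve-∀ ℚring
      lem₂ : ∀ A i q P h θ → 4ℚ * (A * A) * i * (q * P) * (h * θ) ≡ 4ℚ * (A * A) * q * h * i * (θ * P)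
      lem₂ = solve-∀ ℚring
      casted : ι (4 ℕ.* (A ℕ.* A) ℕ.* (2 ℕ.+ p) ℕ.* Θ) ≡ 4ℚ * (ι A * ι A) * ι (2 ℕ.+ p) * ι Θ
      casted = trans (ι-* (4 ℕ.* (A ℕ.* A) ℕ.* (2 ℕ.+ p)) Θ) (cong (_* ι Θ) (trans (ι-* (4 ℕ.* (A ℕ.* A)) (2 ℕ.+ p))
        (cong (_* ι (2 ℕ.+ p)) (trans (ι-* 4 (A ℕ.* A)) (cong₂ _*_ (ι≡ℕtoℚ 4) (ι-* A A))))))

    pow : ℚ → ℕ → ℚ
    pow x zero  = 1ℚ
    pow x (suc m) = x * pow x m

    ι-^ : ∀ m r → ι (m ℕ.^ r) ≡ pow (ι m) r
    ι-^ m zero  = ι1≡1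
    ι-^ m (suc r) = trans (ι-* m (m ℕ.^ r)) (cong (ι m *_) (ι-^ m r))

    -- The only use of `k-large`: the sixth moments that `k` draws can build up are negligible
    -- against `N ^ 5`, one power of `N` being spent on the comparison with a gain of order `P / N`.
    5Nc₃≤ : 5ℚ * (ι N * c₃) ≤ 4P+1 * θ
    5Nc₃≤ = begin
      5ℚ * (ι N * (4P+1 * Y * ι Kn))
        ≡⟨ sym (trans (cong (5ℚ * (ι N * (4P+1 * Y * ι Kn)) *_) ιΘθ≡1) (*-identityʳ _)) ⟩
      5ℚ * (ι N * (4P+1 * Y * ι Kn)) * (ι Θ * θ)
        ≡⟨ lem₁ (ι N) iN 4P+1 (ι Kn) (ι Θ) θ ⟩
      4P+1 * θ * (ι N * (iN * iN * (iN * iN) * (iN * iN)) * (5ℚ * pow (ι Θ) 7 * ι Kn))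
        ≡⟨ cong (λ z → 4P+1 * θ * (ι N * (iN * iN * (iN * iN) * (iN * iN)) * z)) (sym casted) ⟩
      4P+1 * θ * (ι N * (iN * iN * (iN * iN) * (iN * iN)) * ι (5 ℕ.* Θ ℕ.^ 7 ℕ.* Kn))
        ≤⟨ *-monoˡ (0≤* (<⇒≤ 0<4P+1) 0≤θ) (*-monoˡ (0≤* (0≤ι N) (0≤* (0≤* (0≤sq iN) (0≤sq iN)) (0≤sq iN))) (ι-mono k-large)) ⟩
      4P+1 * θ * (ι N * (iN * iN * (iN * iN) * (iN * iN)) * ι (N ℕ.^ 5))
        ≡⟨ cong (λ z → 4P+1 * θ * (ι N * (iN * iN * (iN * iN) * (iN * iN)) * z)) (ι-^ N 5) ⟩
      4P+1 * θ * (ι N * (iN * iN * (iN * iN) * (iN * iN)) * pow (ι N) 5)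
        ≡⟨ cong (4P+1 * θ *_) (trans (lem₂ (ι N) iN) (cong (λ u → u * u * (u * u) * (u * u)) ιNiN≡1)) ⟩
      4P+1 * θ * 1ℚ
        ≡⟨ *-identityʳ (4P+1 * θ) ⟩
      4P+1 * θ ∎
      where
      open ≤-Reasoning
      lem₁ : ∀ N i c K h θ → 5ℚ * (N * (c * (i * h * (i * h) * (i * h * (i * h)) * (i * h * (i * h))) * K)) * (h * θ) ≡
        c * θ * (N * (i * i * (i * i) * (i * i)) * (5ℚ * (h * (h * (h * (h * (h * (h * (h * 1ℚ))))))) * K))
      lem₁ = solve-∀ ℚring
      lem₂ : ∀ N i → N * (i * i * (i * i) * (i * i)) * (N * (N * (N * (N * (N * 1ℚ))))) ≡ N * i * (N * i) * (N * i * (N * i)) * (N * i * (N * i))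
      lem₂ = solve-∀ ℚring
      casted : ι (5 ℕ.* Θ ℕ.^ 7 ℕ.* Kn) ≡ 5ℚ * pow (ι Θ) 7 * ι Kn
      casted = trans (ι-* (5 ℕ.* Θ ℕ.^ 7) Kn) (cong (_* ι Kn) (trans (ι-* 5 (Θ ℕ.^ 7)) (cong₂ _*_ (ι≡ℕtoℚ 5) (ι-^ Θ 7))))

    κη⁶ : κ * (η * η * (η * η) * (η * η)) ≡ 4P+1
    κη⁶ = trans (lem 4P+1 iN (ι Θ) (ι N) θ) (trans (cong (4P+1 *_) (trans (cong₂ (λ u v → u * v * (u * v) * (u * v * (u * v)) * (u * v * (u * v))) ιNiN≡1 ιΘθ≡1) refl)) (*-identityʳ 4P+1))
      where
      lem : ∀ c i h N θ → c * (i * h * (i * h) * (i * h * (i * h)) * (i * h * (i * h))) * (N * θ * (N * θ) * (N * θ * (N * θ)) * (N * θ * (N * θ))) ≡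
        c * (N * i * (h * θ) * (N * i * (h * θ)) * (N * i * (h * θ) * (N * i * (h * θ))) * (N * i * (h * θ) * (N * i * (h * θ))))
      lem = solve-∀ ℚring

    c≤Nc : ∀ {c} → 0ℚ ≤ c → c ≤ ι N * c
    c≤Nc {c} 0≤c = ≤-trans (≤-reflexive (sym (*-identityˡ c))) (*-monoʳ 0≤c 1≤ιN)

    θP≤P : θ * P ≤ P
    θP≤P = ≤-trans (*-monoʳ 0≤P (<⇒≤ θ<1)) (≤-reflexive (*-identityˡ P))

    5c₃≤ : 5ℚ * c₃ ≤ 4P+1
    5c₃≤ = ≤-trans (*-monoˡ (nonNegative⁻¹ 5ℚ) (c≤Nc 0≤c₃)) (≤-trans 5Nc₃≤ (≤-trans (*-monoˡ (<⇒≤ 0<4P+1) (<⇒≤ θ<1)) (≤-reflexive (*-identityʳ 4P+1))))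

    0≤γP : 0ℚ ≤ γ * P
    0≤γP = 0≤* (0≤* 0≤1-θ 0≤iN) 0≤P

    -- Since `c₂ ≤ P` and `5 * c₃ ≤ 4P+1`, adding `V` to `κ * η⁶ = 4P+1` still leaves more than `P`.
    w≤ : total w₀ ≤ κ * (η * η * (η * η) * (η * η)) + V
    w≤ = subst₂ (λ u v → u ≤ v + V) (sym total-w₀) (sym κη⁶) (*-cancelˡ {5ℚ} (positive⁻¹ 5ℚ)
      (≤-cert _ (0≤+ (0≤+ (≤-diff 5c₃≤) (0≤* (nonNegative⁻¹ 5ℚ) (≤-diff (≤-trans (c≤Nc 0≤c₂) (≤-trans Nc₂≤ θP≤P)))))
                     (0≤+ (0≤* (nonNegative⁻¹ 5ℚ) 0≤γP) (0≤+ (0≤* (nonNegative⁻¹ 6ℚ) 0≤P) (nonNegative⁻¹ 4ℚ))))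
         (lem P (γ * P) c₂ c₃)))
      where
      lem : ∀ P g c₂ c₃ → 5ℚ * ((P + P + P + P + 1ℚ) + (g - (c₂ + c₃))) ≡
        5ℚ * P + (((P + P + P + P + 1ℚ) - 5ℚ * c₃) + 5ℚ * (P - c₂) + (5ℚ * g + (6ℚ * P + 4ℚ)))
      lem = solve-∀ ℚring

    balance : V + cost start ≡ gain start
    balance = trans (cong (V +_) cost-start) (trans (lem (γ * P) (c₂ + c₃)) (sym gain-start))
      where
      lem : ∀ g c → g - c + c ≡ g
      lem = solve-∀ ℚring

    abstract
      chosen : Clique start V
      chosen = clique start V (≤-reflexive balance) w≤

    open Clique chosen renaming (alive to 0<ρ)

    alive : ∀ j → a j (K j) ≡ true
    alive j = lit (a j (K j)) (0<ρ j)
      where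
      lit : ∀ c → 0ℚ < 𝟙 c → c ≡ true
      lit true  _ = refl
      lit false h = contradiction h (<-irrefl refl)

    compatible : ∀ i j → i ≢ j → cf i (K i) j (K j) ≡ false
    compatible i j i≢j with ℕ.<-cmp (toℕ i) (toℕ j)
    ... | tri< i<j _ _ = trans (cf-sym i (K i) j (K j)) (trans (cong (_∧ cf j (K j) i (K i)) (sym (alive i))) (no-conflict i j i<j))
    ... | tri> _ _ j<i = trans (cong (_∧ cf i (K i) j (K j)) (sym (alive j))) (no-conflict j i j<i)
    ... | tri≈ _ eq _  = contradiction (Fin.toℕ-injective eq) i≢j

    good-step : GoodStep p a N p′
    good-step = K , alive , compatible , bound (Φ a) refl
      where
      W = ∑ℕ λ j → weight a j (K j)
      W₂ = pairSumℕ λ i j → weight₂ a i (K i) j (K j)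
      value′ : V + ι W₂ ≤ ι W
      value′ = subst₂ _≤_ (cong₂ _+_ (trans (cong (V +_) (∑-0 k)) (+-identityʳ V)) (sym (ι-pairSum λ i j → weight₂ a i (K i) j (K j))))
        (sym (ι-∑ λ j → weight a j (K j))) value
      bound : ∀ f → Φ a ≡ f → Φ (remove a K) ℕ.* N ℕ.+ p′ ℕ.* Φ a ℕ.≤ Φ a ℕ.* N
      -- The penalty need not vanish with `P`, so the estimate of `c₃` by `θ * P` requires `P ≥ 1`;
      -- a potential of 0 just stays 0.
      bound zero Φ≡0 = ℕ.≤-trans (ℕ.+-mono-≤ (ℕ.*-monoˡ-≤ N (Φ-mono p a K)) (ℕ.≤-reflexive (trans (cong (p′ ℕ.*_) Φ≡0) (ℕ.*-zeroʳ p′)))) (ℕ.≤-reflexive (ℕ.+-identityʳ _))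
      bound (suc f) Φ≡ = good-removal p a N p′ K alive (ι-cancel (begin
        ι (p′ ℕ.* Φ a ℕ.+ N ℕ.* W₂)  ≡⟨ trans (ι-+ (p′ ℕ.* Φ a) (N ℕ.* W₂)) (cong (ι (p′ ℕ.* Φ a) +_) (ι-* N W₂)) ⟩
        ι (p′ ℕ.* Φ a) + ι N * ι W₂  ≤⟨ +-monoˡ-≤ (ι N * ι W₂) p′Φ≤NV ⟩
        ι N * V + ι N * ι W₂  ≡⟨ sym (*-distribˡ-+ (ι N) V (ι W₂)) ⟩
        ι N * (V + ι W₂)  ≤⟨ *-monoˡ (0≤ι N) value′ ⟩
        ι N * ι W  ≡⟨ sym (ι-* N W) ⟩
        ι (N ℕ.* W)  ∎))
        where
        open ≤-Reasoning
        1≤P : 1ℚ ≤ P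
        1≤P = subst (_≤ P) ι1≡1 (ι-mono (subst (λ z → 1 ℕ.≤ (2 ℕ.+ p) ℕ.* z) (sym Φ≡) (ℕ.s≤s ℕ.z≤n)))
        Nc₃≤ : ι N * c₃ ≤ θ * P
        Nc₃≤ = *-cancelˡ {5ℚ} (positive⁻¹ 5ℚ) (≤-trans 5Nc₃≤ (≤-cert (θ * (P - 1ℚ)) (0≤* 0≤θ (≤-diff 1≤P)) (lem P θ)))
          where
          lem : ∀ P θ → 5ℚ * (θ * P) ≡ (P + P + P + P + 1ℚ) * θ + θ * (P - 1ℚ)
          lem = solve-∀ ℚring
        -- Three losses of `θ * P`: from `γ = (1 − θ) / N`, from `c₂` and from `c₃`.
        room : ι (p′ ℕ.* Φ a) + 3ℚ * (θ * P) ≤ P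
        room = begin
          ι (p′ ℕ.* Φ a) + 3ℚ * (θ * P)  ≡⟨ cong (_+ 3ℚ * (θ * P)) (sym (trans (cong (ι (p′ ℕ.* Φ a) *_) ιΘθ≡1) (*-identityʳ (ι (p′ ℕ.* Φ a))))) ⟩
          ι (p′ ℕ.* Φ a) * (ι Θ * θ) + 3ℚ * (θ * P)  ≡⟨ lem₁ (ι (p′ ℕ.* Φ a)) (ι Θ) θ P ⟩
          (ι (p′ ℕ.* Φ a) * ι Θ + 3ℚ * P) * θ  ≡⟨ cong (_* θ) casted ⟩
          ι ((p′ ℕ.* Θ ℕ.+ 3 ℕ.* (2 ℕ.+ p)) ℕ.* Φ a) * θ  ≤⟨ *-monoʳ 0≤θ (ι-mono (ℕ.*-monoˡ-≤ (Φ a) p′-small)) ⟩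
          ι ((2 ℕ.+ p) ℕ.* Θ ℕ.* Φ a) * θ  ≡⟨ cong (_* θ) (trans (cong ι (lem₂ (2 ℕ.+ p) Θ (Φ a))) (ι-* ((2 ℕ.+ p) ℕ.* Φ a) Θ)) ⟩
          P * ι Θ * θ  ≡⟨ trans (*-assoc P (ι Θ) θ) (trans (cong (P *_) ιΘθ≡1) (*-identityʳ P)) ⟩
          P  ∎
          where
          lem₁ : ∀ x h θ P → x * (h * θ) + 3ℚ * (θ * P) ≡ (x * h + 3ℚ * P) * θ
          lem₁ = solve-∀ ℚring
          lem₂ : ∀ a b c → a ℕ.* b ℕ.* c ≡ a ℕ.* c ℕ.* b
          lem₂ = ℕ-Solver.solve-∀
          lem₃ : ∀ p′ Φ Θ q → p′ ℕ.* Φ ℕ.* Θ ℕ.+ 3 ℕ.* (q ℕ.* Φ) ≡ (p′ ℕ.* Θ ℕ.+ 3 ℕ.* q) ℕ.* Φ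
          lem₃ = ℕ-Solver.solve-∀
          casted : ι (p′ ℕ.* Φ a) * ι Θ + 3ℚ * P ≡ ι ((p′ ℕ.* Θ ℕ.+ 3 ℕ.* (2 ℕ.+ p)) ℕ.* Φ a)
          casted = trans (cong₂ _+_ (sym (ι-* (p′ ℕ.* Φ a) Θ)) (trans (cong (_* P) (sym (ι≡ℕtoℚ 3))) (sym (ι-* 3 ((2 ℕ.+ p) ℕ.* Φ a)))))
            (trans (sym (ι-+ (p′ ℕ.* Φ a ℕ.* Θ) (3 ℕ.* ((2 ℕ.+ p) ℕ.* Φ a)))) (cong ι (lem₃ p′ (Φ a) Θ (2 ℕ.+ p))))
        p′Φ≤NV : ι (p′ ℕ.* Φ a) ≤ ι N * V
        p′Φ≤NV = ≤-trans (≤-cert _ (0≤+ (≤-diff room) (0≤+ (≤-diff Nc₂≤) (≤-diff Nc₃≤))) (lem₁ (ι (p′ ℕ.* Φ a)) P θ (ι N) c₂ c₃))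
          (≤-reflexive (trans (cong (λ u → u * ((1ℚ - θ) * P) - (ι N * c₂ + ι N * c₃)) (sym ιNiN≡1)) (lem₂ (ι N) iN θ P c₂ c₃)))
          where
          lem₁ : ∀ x P θ N c₂ c₃ → 1ℚ * ((1ℚ - θ) * P) - (N * c₂ + N * c₃) ≡ x + ((P - (x + 3ℚ * (θ * P))) + ((θ * P - N * c₂) + (θ * P - N * c₃)))
          lem₁ = solve-∀ ℚring
          lem₂ : ∀ N i θ P c₂ c₃ → N * i * ((1ℚ - θ) * P) - (N * c₂ + N * c₃) ≡ N * ((1ℚ - θ) * i * P - (c₂ + c₃))
          lem₂ = solve-∀ ℚring

-- Numerical estimates and the logarithm of n

module Conclusion where
  open import Defs
  open import Data.Nat
  open import Data.Nat.Properties
  open import Data.Nat.DivMod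
  open import Data.Nat.Tactic.RingSolver using (solve-∀)
  open import Data.Fin as Fin using (Fin; zero; suc; toℕ)
  open import Data.Bool using (Bool; true; false; _∧_; not; T)
  open import Data.Unit using (tt)
  open import Data.Product using (∃; _×_; _,_; proj₁; proj₂; Σ)
  open import Data.Product.Properties using (,-injectiveˡ)
  open import Data.Rational using (ℚ; 0ℚ; 1ℚ)
  import Data.Rational as ℚ
  import Data.Rational.Properties as ℚ
  open import Data.Rational.Unnormalised as ℚᵘ using (mkℚᵘ)
  import Data.Rational.Unnormalised.Properties as ℚᵘ
  import Data.Integer as ℤ
  import Data.Integer.Properties as ℤ
  open import Relation.Binary.PropositionalEquality
  open import Relation.Nullary using (Dec; does; yes; no; contradiction)
  import Tactic.RingSolver as RingSolver
  open Combinatorics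
  open RationalArgument using (module Large; ℚring; ≤-cert; ≤-diff; 0≤+; 0≤*; *-monoʳ; *-cancelˡ; recip; ι; ι-+; ι-*; ι-mono; ι-mono-<; ι-cancel; 0≤ι; ι*inv; inv≡; ι0≡0; ι1≡1; ι≡ℕtoℚ; toℚᵘ-ι)

  -- Bernoulli's inequality for `(1 + 1/x) ^ s`, without denominators.
  power-gap : ∀ x s → x ^ s * (x + s) ≤ x * (x + 1) ^ s
  power-gap x zero  = ≤-reflexive (lem x)
    where
    lem : ∀ x → 1 * (x + 0) ≡ x * 1
    lem = solve-∀
  power-gap x (suc s) = begin
    x * x ^ s * (x + suc s)  ≤⟨ m≤m+n _ (x ^ s * s) ⟩
    x * x ^ s * (x + suc s) + x ^ s * s  ≡⟨ lem x s (x ^ s) ⟩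
    (x + 1) * (x ^ s * (x + s))  ≤⟨ *-monoʳ-≤ (x + 1) (power-gap x s) ⟩
    (x + 1) * (x * (x + 1) ^ s)  ≡⟨ lem′ x ((x + 1) ^ s) ⟩
    x * ((x + 1) * (x + 1) ^ s)  ∎
    where
    open ≤-Reasoning
    lem : ∀ x s a → x * a * (x + suc s) + a * s ≡ (x + 1) * (a * (x + s))
    lem = solve-∀
    lem′ : ∀ x a → (x + 1) * (x * a) ≡ x * ((x + 1) * a)
    lem′ = solve-∀

  cube≤2^ : ∀ d → (10 + d) * ((10 + d) * (10 + d)) ≤ 2 ^ (10 + d)
  cube≤2^ zero = ≤ᵇ⇒≤ 1000 1024 tt
  cube≤2^ (suc d) = begin
    (10 + suc d) * ((10 + suc d) * (10 + suc d))  ≤⟨ m≤m+n _ (d * (d * d) + 27 * (d * d) + 237 * d + 669) ⟩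
    (10 + suc d) * ((10 + suc d) * (10 + suc d)) + (d * (d * d) + 27 * (d * d) + 237 * d + 669) ≡⟨ lem d ⟩
    2 * ((10 + d) * ((10 + d) * (10 + d)))  ≤⟨ *-monoʳ-≤ 2 (cube≤2^ d) ⟩
    2 * 2 ^ (10 + d)  ≡⟨ cong (2 ^_) (sym (+-suc 10 d)) ⟩
    2 ^ (10 + suc d)  ∎
    where
    open ≤-Reasoning
    lem : ∀ d → (10 + suc d) * ((10 + suc d) * (10 + suc d)) + (d * (d * d) + 27 * (d * d) + 237 * d + 669) ≡ 2 * ((10 + d) * ((10 + d) * (10 + d)))
    lem = solve-∀

  quadratic≤2^ : ∀ C r → 10 + C ≤ r → C * (r * r) ≤ 2 ^ r
  quadratic≤2^ C r r-large = begin
    C * (r * r)  ≤⟨ *-monoˡ-≤ (r * r) (≤-trans (m≤n+m C 10) r-large) ⟩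
    r * (r * r)  ≡⟨ cong (λ z → z * (z * z)) (sym r≡) ⟩
    (10 + (r ∸ 10)) * ((10 + (r ∸ 10)) * (10 + (r ∸ 10))) ≤⟨ cube≤2^ (r ∸ 10) ⟩
    2 ^ (10 + (r ∸ 10))  ≡⟨ cong (2 ^_) r≡ ⟩
    2 ^ r  ∎
    where
    open ≤-Reasoning
    r≡ : 10 + (r ∸ 10) ≡ r
    r≡ = m+[n∸m]≡n (≤-trans (m≤m+n 10 C) r-large)

  binary-length : ∀ n → 0 < n → ∃ λ r → n < 2 ^ r × 2 ^ r ≤ 2 * n
  binary-length (suc zero) _ = 1 , ≤-refl , ≤-refl
  binary-length (suc (suc n)) _ with binary-length (suc n) (s≤s z≤n)
  ... | r , n<2^r , 2^r≤2n with suc (suc n) <? 2 ^ r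
  ...  | yes lt = r , lt , ≤-trans 2^r≤2n (*-monoʳ-≤ 2 (n≤1+n (suc n)))
  ...  | no ≮ = suc r , subst (λ z → suc (suc n) < 2 * z) eq (m<m+n (suc (suc n)) (s≤s z≤n)) , ≤-reflexive (cong (2 *_) (sym eq))
    where
    eq : suc (suc n) ≡ 2 ^ r
    eq = ≤-antisym n<2^r (≮⇒≥ ≮)

  -- Block `b` and the initial segment of length `b * B` are disjoint and fit into the initial
  -- segment of length `b * B + B`.
  block-count : ∀ k B b {{_ : NonZero B}} → ∑ {k} (λ j → bit (toℕ j / B ≡ᵇ b)) ≤ B
  block-count k B b = +-cancelʳ-≤ (k ⊓ (b * B)) _ _ (begin
    ∑ {k} (λ j → bit (toℕ j / B ≡ᵇ b)) + (k ⊓ (b * B))  ≡⟨ cong (∑ {k} (λ j → bit (toℕ j / B ≡ᵇ b)) +_) (sym (∑-below k (b * B))) ⟩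
    ∑ {k} (λ j → bit (toℕ j / B ≡ᵇ b)) + ∑ {k} (λ j → bit (toℕ j <ᵇ b * B))  ≡⟨ sym (∑-+ (λ (j : Fin k) → bit (toℕ j / B ≡ᵇ b)) (λ j → bit (toℕ j <ᵇ b * B))) ⟩
    ∑ {k} (λ j → bit (toℕ j / B ≡ᵇ b) + bit (toℕ j <ᵇ b * B))  ≤⟨ ∑-mono (λ (j : Fin k) → pointwise (toℕ j)) ⟩
    ∑ {k} (λ j → bit (toℕ j <ᵇ b * B + B))  ≡⟨ ∑-below k (b * B + B) ⟩
    k ⊓ (b * B + B)  ≤⟨ ⊓-monoˡ-≤ (b * B + B) (m≤m+n k B) ⟩
    (k + B) ⊓ (b * B + B)  ≡⟨ sym (+-distribʳ-⊓ B k (b * B)) ⟩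
    (k ⊓ (b * B)) + B  ≡⟨ +-comm _ B ⟩
    B + (k ⊓ (b * B))  ∎)
    where
    open ≤-Reasoning
    pointwise : ∀ j → bit (j / B ≡ᵇ b) + bit (j <ᵇ b * B) ≤ bit (j <ᵇ b * B + B)
    pointwise j with j / B ≡ᵇ b in eq | j <ᵇ b * B in lt
    ... | false | false = z≤n
    ... | false | true  rewrite <ᵇ-true {j} {b * B + B} (≤-trans (<ᵇ⇒< j (b * B) (subst T (sym lt) tt)) (m≤m+n (b * B) B)) = ≤-refl
    ... | true  | true  = contradiction (<ᵇ⇒< j (b * B) (subst T (sym lt) tt))
          (≤⇒≯ (subst (λ c → c * B ≤ j) (≡ᵇ⇒≡ (j / B) b (subst T (sym eq) tt)) (m/n*n≤m j B)))
    ... | true  | false rewrite <ᵇ-true {j} {b * B + B} (subst (λ c → j < c * B + B) (≡ᵇ⇒≡ (j / B) b (subst T (sym eq) tt))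
          (subst₂ _<_ (sym (m≡m%n+[m/n]*n j B)) (+-comm B (j / B * B)) (+-monoˡ-< (j / B * B) (m%n<n j B)))) = ≤-refl

  large-enough : ∀ C → ∃ λ n₀ → ∀ n → n₀ ≤ n → 0 < n × ∃ λ r → 0 < r × n < 2 ^ r × C * (r * r) ≤ n
  large-enough C = 2 ^ r₀ , λ n n₀≤n → let 0<n = ≤-trans (m^n>0 2 r₀) n₀≤n
                                           r , n<2^r , 2^r≤2n = binary-length n 0<n
                                           r₀≤r = ≮⇒≥ λ r<r₀ → contradiction (≤-<-trans n₀≤n n<2^r) (≤⇒≯ (^-monoʳ-≤ 2 (<⇒≤ r<r₀)))
                                       in 0<n , r , ≤-trans (s≤s z≤n) r₀≤r , n<2^r ,
                                          *-cancelˡ-≤ 2 (≤-trans (≤-reflexive (sym (*-assoc 2 C (r * r)))) (≤-trans (quadratic≤2^ (2 * C) r r₀≤r) 2^r≤2n))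
    where
    r₀ : ℕ
    -- `10` is where `r ^ 3 ≤ 2 ^ r` starts; `C` is doubled because `2 ^ r` is only known to be at
    -- most `2 * n`.
    r₀ = 10 + 2 * C

  -- The exponent is `x * (2 * E)` for `x = 4 * l`, so Bernoulli gives at least the factor
  -- `1 + 2 * E`.
  gap : ∀ l E → 0 < l → 2 * (E * (4 * l) ^ (4 * l * (2 * E))) ≤ (4 * l + 1) ^ (4 * l * (2 * E))
  gap l E 0<l = *-cancelˡ-≤ (4 * l) {{m*n≢0 4 l {{_}} {{>-nonZero 0<l}}}} (begin
    4 * l * (2 * (E * (4 * l) ^ s))  ≡⟨ lem (4 * l) E ((4 * l) ^ s) ⟩
    (4 * l) ^ s * (4 * l * (2 * E))  ≤⟨ *-monoʳ-≤ ((4 * l) ^ s) (m≤n+m s (4 * l)) ⟩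
    (4 * l) ^ s * (4 * l + s)  ≤⟨ power-gap (4 * l) s ⟩
    4 * l * (4 * l + 1) ^ s  ∎)
    where
    open ≤-Reasoning
    s = 4 * l * (2 * E)
    lem : ∀ x E a → x * (2 * (E * a)) ≡ a * (x * (2 * E))
    lem = solve-∀

  -- Choice of the exponents, and the two regimes

  module Instance {k n : ℕ} (G : Conflicts k n) (l E s r : ℕ) (0<l : 0 < l) (0<E : 0 < E) (2≤s : 2 ≤ s)
      (s-large : 2 * (E * (4 * l) ^ s) ≤ (4 * l + 1) ^ s) (0<n : 0 < n) (0<r : 0 < r) (n<2^r : n < 2 ^ r) (0<k : 0 < k)
      (deg-small : ∀ i x j → suc l * k * ∑ (λ y → bit (Conflicts.cf G i x j y)) ≤ l * n) where

    open Conflicts G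

    L : ℕ
    L = suc l

    instance
      k≢0 : NonZero k
      k≢0 = >-nonZero 0<k
      Lk≢0 : NonZero (L * k)
      Lk≢0 = m*n≢0 L k

    D : ℕ
    D = l * n / (L * k)

    div-intro : ∀ {d} m o {{_ : NonZero m}} → m * d ≤ o → d ≤ o / m
    div-intro {d} m o md≤o = ≤-trans (≤-reflexive (sym (trans (cong (_/ m) (*-comm m d)) (m*n/n≡m d m)))) (/-monoˡ-≤ m md≤o)

    deg≤D : ∀ i x j → ∑ (λ y → bit (cf i x j y)) ≤ D
    deg≤D i x j = div-intro (L * k) (l * n) (deg-small i x j)

    D-bound : L * k * D ≤ l * n
    D-bound = ≤-trans (≤-reflexive (*-comm (L * k) D)) (m/n*n≤m (l * n) (L * k))

    -- With `n < 2 ^ r`, `q = 3 * r` is enough for `n ^ 3` tests. The steps may waste the fraction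
    -- `q / p = 1 / s` of the ideal decrease.
    q p p₀ p′ : ℕ
    q = 3 * r
    p = s * q
    p₀ = p ∸ 2
    p′ = (s ∸ 1) * q

    s≡ : s ≡ suc (s ∸ 1)
    s≡ = sym (m+[n∸m]≡n (≤-trans (s≤s z≤n) 2≤s))

    p≡p′+q : p ≡ p′ + q
    p≡p′+q = trans (cong (_* q) s≡) (+-comm q p′)

    2≤p : 2 ≤ p
    2≤p = ≤-trans 2≤s (≤-trans (≤-reflexive (sym (*-identityʳ s))) (*-monoʳ-≤ s (≤-trans 0<r (m≤n*m r 3))))

    p≡2+p₀ : p ≡ 2 + p₀
    p≡2+p₀ = sym (m+[n∸m]≡n 2≤p)

    R : ℕ
    R = n * (n * n)

    R<2^q : R < 2 ^ q
    R<2^q = subst (R <_) (trans (lem (2 ^ r)) (trans (^-*-assoc 2 r 3) (cong (2 ^_) (*-comm r 3)))) (*-mono-< n<2^r (*-mono-< n<2^r n<2^r))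
      where
      lem : ∀ x → x * (x * x) ≡ x ^ 3
      lem x = cong (λ z → x * (x * z)) (sym (*-identityʳ x))

    full : Fin k → Fin n → Bool
    full _ _ = true

    module WithBlocks (B : ℕ) {{_ : NonZero B}} where
      open BlockTests G B public
      open Potential p₀ public
      open Tests blockTest public
      open Extraction G B p₀ p′ E (Φ full) public

      size-full : ∀ t → size full t ≤ B * D
      size-full t = begin
        ∑ {k} (λ j → ∑ λ y → 1 * bit (blockTest t j y))  ≤⟨ ∑-mono per-part ⟩
        ∑ {k} (λ j → bit (toℕ j / B ≡ᵇ toℕ b) * D)  ≡⟨ ∑-*ʳ D (λ (j : Fin k) → bit (toℕ j / B ≡ᵇ toℕ b)) ⟩
        ∑ (λ (j : Fin k) → bit (toℕ j / B ≡ᵇ toℕ b)) * D  ≤⟨ *-monoˡ-≤ D (block-count k B (toℕ b)) ⟩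
        B * D  ∎
        where
        open ≤-Reasoning
        i = proj₁ (decode t)
        x = proj₁ (proj₂ (decode t))
        b = proj₂ (proj₂ (decode t))
        per-part : ∀ j → ∑ (λ y → 1 * bit (blockTest t j y)) ≤ bit (toℕ j / B ≡ᵇ toℕ b) * D
        per-part j = begin
          ∑ (λ y → 1 * bit (blockTest t j y))  ≡⟨ ∑-cong (λ y → trans (*-identityˡ _) (trans (bit-∧ (cf i x j y) _) (*-comm (bit (cf i x j y)) _))) ⟩
          ∑ (λ y → bit (toℕ j / B ≡ᵇ toℕ b) * bit (cf i x j y))  ≡⟨ ∑-*ˡ (bit (toℕ j / B ≡ᵇ toℕ b)) (λ y → bit (cf i x j y)) ⟩
          bit (toℕ j / B ≡ᵇ toℕ b) * ∑ (λ y → bit (cf i x j y))  ≤⟨ *-monoʳ-≤ (bit (toℕ j / B ≡ᵇ toℕ b)) (deg≤D i x j) ⟩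
          bit (toℕ j / B ≡ᵇ toℕ b) * D  ∎

      -- `k` is not bounded in terms of `n` in advance. If `D` is 0 there are no conflicts and `Φ`
      -- vanishes; otherwise the degree condition gives `k ≤ n`, so that `R = n ^ 3` bounds the
      -- number of tests.
      Φ-full : Φ full ≤ R * (B * D) ^ p
      Φ-full = ≤-trans (≤-trans (∑-mono λ t → ff-mono (2 + p₀) (size-full t)) (≤-reflexive (∑-const (k * (n * k)) (ff₀ (B * D))))) (few-tests D refl)
        where
        few-tests : ∀ d → D ≡ d → k * (n * k) * ff₀ (B * D) ≤ R * (B * D) ^ p
        few-tests zero D≡0 = ≤-trans (≤-reflexive (trans (cong (λ d → k * (n * k) * ff₀ d) (trans (cong (B *_) D≡0) (*-zeroʳ B))) (*-zeroʳ (k * (n * k))))) z≤n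
        few-tests (suc d) D≡ = *-mono-≤ (*-mono-≤ k≤n (*-monoʳ-≤ n k≤n)) (subst (λ e → ff₀ (B * D) ≤ (B * D) ^ e) (sym p≡2+p₀) (ff-upper (B * D) (2 + p₀)))
          where
          k≤n : k ≤ n
          k≤n = *-cancelˡ-≤ L (≤-trans (m≤m*n (L * k) D {{subst NonZero (sym D≡) _}}) (≤-trans D-bound (*-monoˡ-≤ n (n≤1+n l))))

      -- The fraction `1 − 1/(2L)` of `B * N / k`, halfway between the initial `1 − 1/L` and the
      -- critical 1.
      F : ℕ → ℕ
      F N = (4 * l + 2) * (B * N) / (4 * (L * k))
        where instance
          4Lk≢0 : NonZero (4 * (L * k))
          4Lk≢0 = m*n≢0 4 (L * k)

      4uF≤ : ∀ N → 4 * (L * k) * F N ≤ (4 * l + 2) * (B * N)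
      4uF≤ N = ≤-trans (≤-reflexive (*-comm (4 * (L * k)) (F N))) (m/n*n≤m _ (4 * (L * k)) {{m*n≢0 4 (L * k)}})

      size≤F : ∀ a N → 0 < N → n < E * N → 4 * (L * k) * p ≤ B * N → Φ a * n ^ p′ ≤ Φ full * N ^ p′ → ∀ t → size a t ≤ F N
      size≤F a N 0<N n<EN p-small inv t = div-intro (4 * (L * k)) _ {{m*n≢0 4 (L * k)}}
        (Moment.4uF≤ l k B n N D E s q p p′ R (Φ a) (Φ full) (size a t) refl p≡p′+q 0<N 0<n (>-nonZero⁻¹ B) 0<E 0<l
          R<2^q s-large (<⇒≤ n<EN) D-bound Φ-full inv (subst (λ e → ff (size a t) e ≤ Φ a) (sym p≡2+p₀) (term≤∑ (λ t → ff₀ (size a t)) t)) p-small)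

      Result : Set
      Result = Packing full n

      packed : (∀ a N → 0 < N → Parts a N → n < E * N → (∀ t → size a t ≤ F N) → GoodStep p₀ a N p′) →
        (∀ N → n < E * N → 4 * (L * k) * p ≤ B * N) → Result
      packed step p-small = packing (λ a N 0<N parts n<EN inv → step a N 0<N parts n<EN (size≤F a N 0<N n<EN (p-small N n<EN) inv))
        full n (λ j → trans (∑-const n 1) (*-identityʳ n)) ≤-refl

    E-cancel : ∀ {x N} → E * x ≤ n → n < E * N → x ≤ N
    E-cancel Ex≤n n<EN = *-cancelˡ-≤ E {{>-nonZero 0<E}} (≤-trans Ex≤n (<⇒≤ n<EN))

    module FewParts (Cₐ C₁ : ℕ) (Cₐ≡ : Cₐ ≡ E * (4 * L * (3 * s))) (room : Cₐ * Cₐ * C₁ * (r * r) ≤ n) (k²<C₁n : k * k < C₁ * n) where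
      open WithBlocks 1

      square-cancel : ∀ {x y} → x * x ≤ y * y → x ≤ y
      square-cancel {x} {y} x²≤y² = ≮⇒≥ λ y<x → contradiction (*-mono-< y<x y<x) (≤⇒≯ x²≤y²)

      -- `k` is below `√(C₁ * n)`, so `k * log n` is far below `n`; squaring avoids the root.
      Cₐrk≤n : Cₐ * r * k ≤ n
      Cₐrk≤n = square-cancel (begin
        Cₐ * r * k * (Cₐ * r * k)  ≡⟨ lem Cₐ r k ⟩
        Cₐ * Cₐ * (r * r) * (k * k)  ≤⟨ *-monoʳ-≤ (Cₐ * Cₐ * (r * r)) (<⇒≤ k²<C₁n) ⟩
        Cₐ * Cₐ * (r * r) * (C₁ * n)  ≡⟨ lem′ (Cₐ * Cₐ) (r * r) C₁ n ⟩
        Cₐ * Cₐ * C₁ * (r * r) * n  ≤⟨ *-monoˡ-≤ n room ⟩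
        n * n  ∎)
        where
        open ≤-Reasoning
        lem : ∀ c r k → c * r * k * (c * r * k) ≡ c * c * (r * r) * (k * k)
        lem = solve-∀
        lem′ : ∀ a b c d → a * b * (c * d) ≡ a * c * b * d
        lem′ = solve-∀

      4Lkp≤N : ∀ N → n < E * N → 4 * (L * k) * p ≤ N
      4Lkp≤N N n<EN = E-cancel (subst (_≤ n) (trans (cong (λ c → c * r * k) Cₐ≡) (lem E L s r k)) Cₐrk≤n) n<EN
        where
        lem : ∀ E L s r k → E * (4 * L * (3 * s)) * r * k ≡ E * (4 * (L * k) * (s * (3 * r)))
        lem = solve-∀

      packing-few : Result
      packing-few = packed step (λ N n<EN → ≤-trans (4Lkp≤N N n<EN) (≤-reflexive (sym (*-identityˡ N))))
        where
        step : ∀ a N → 0 < N → Parts a N → n < E * N → (∀ t → size a t ≤ F N) → GoodStep p₀ a N p′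
        step a N 0<N parts n<EN size≤ = Small.good-step G p₀ a N (F N) p′ 0<N parts size≤ kF≤N p′-small
          where
          open ≤-Reasoning
          kF≤N : k * F N ≤ N
          kF≤N = *-cancelˡ-≤ (4 * L) (begin
            4 * L * (k * F N)  ≡⟨ lem L k (F N) ⟩
            4 * (L * k) * F N  ≤⟨ 4uF≤ N ⟩
            (4 * l + 2) * (1 * N)  ≤⟨ *-mono-≤ (≤-trans (+-monoʳ-≤ (4 * l) (s≤s (s≤s (z≤n {2})))) (≤-reflexive (lem′ l))) (≤-reflexive (*-identityˡ N)) ⟩
            4 * L * N  ∎)
            where
            lem : ∀ L k F → 4 * L * (k * F) ≡ 4 * (L * k) * F
            lem = solve-∀
            lem′ : ∀ l → 4 * l + 4 ≡ 4 * suc l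
            lem′ = solve-∀
          p′-small : p′ * (N + k) ≤ (2 + p₀) * N
          p′-small = begin
            p′ * (N + k)  ≡⟨ *-distribˡ-+ p′ N k ⟩
            p′ * N + (s ∸ 1) * q * k  ≤⟨ +-monoʳ-≤ (p′ * N) (≤-trans (*-monoˡ-≤ k (*-monoˡ-≤ q (m∸n≤m s 1))) (sqk≤qN)) ⟩
            p′ * N + q * N  ≡⟨ sym (*-distribʳ-+ N p′ q) ⟩
            (p′ + q) * N  ≡⟨ cong (_* N) (trans (sym p≡p′+q) p≡2+p₀) ⟩
            (2 + p₀) * N  ∎
            where
            sqk≤qN : s * q * k ≤ q * N
            sqk≤qN = begin
              s * q * k  ≤⟨ m≤n*m (s * q * k) (4 * L) ⟩
              4 * L * (s * q * k)  ≡⟨ lem L s q k ⟩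
              4 * (L * k) * (s * q)  ≤⟨ 4Lkp≤N N n<EN ⟩
              N  ≤⟨ m≤n*m N q {{m*n≢0 3 r {{_}} {{>-nonZero 0<r}}}} ⟩
              q * N  ∎
              where
              lem : ∀ L s q k → 4 * L * (s * q * k) ≡ 4 * (L * k) * (s * q)
              lem = solve-∀

    -- `a / A` equals the fraction `1 − 1/(2L)` in `F`, scaled so that `A − a = 3`. There are
    -- `M = A² − A` blocks and `Z = A²`, hence `Z − M = A` and no weight exceeds `A`.
    module ManyParts (a A M Θ C₁ : ℕ) (a≡ : a ≡ 6 * l + 3) (A≡ : A ≡ 3 + a) (M≡ : M ≡ (2 + a) * A) (Θ≡ : Θ ≡ 3 * s)
      (C₁≡ : C₁ ≡ 5 * Θ ^ 7 * (48 * (A * A)) ^ 3 * E ^ 5) (2A≤Θ : 2 * A ≤ Θ)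
      (room₁ : E * (4 * L * M * (3 * s)) * r ≤ n) (room₂ : E * (4 * (A * A) * (3 * s) * Θ) * r ≤ n) (room₃ : E * A ≤ n)
      (k-large : 2 * A * M ≤ k) (C₁n≤k² : C₁ * n ≤ k * k) where

      instance
        A≢0 : NonZero A
        A≢0 = subst NonZero (sym A≡) _
        M≢0 : NonZero M
        M≢0 = subst NonZero (sym M≡) (m*n≢0 (2 + a) A)

      B Z : ℕ
      B = suc (k / M)
      Z = A * A

      open WithBlocks B

      A≡6L : A ≡ 6 * L
      A≡6L = trans A≡ (trans (cong (3 +_) a≡) (lem l))
        where
        lem : ∀ l → 3 + (6 * l + 3) ≡ 6 * suc l
        lem = solve-∀

      k≤MB : k ≤ M * B
      k≤MB = begin
        k  ≡⟨ m≡m%n+[m/n]*n k M ⟩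
        k % M + k / M * M  ≤⟨ +-mono-≤ (<⇒≤ (m%n<n k M)) (≤-reflexive (*-comm (k / M) M)) ⟩
        M + M * (k / M)  ≡⟨ sym (*-suc M (k / M)) ⟩
        M * B  ∎
        where open ≤-Reasoning

      MB≤k+M : M * B ≤ k + M
      MB≤k+M = begin
        M * B  ≡⟨ *-suc M (k / M) ⟩
        M + M * (k / M)  ≤⟨ +-monoʳ-≤ M (≤-trans (≤-reflexive (*-comm M (k / M))) (m/n*n≤m k M)) ⟩
        M + k  ≡⟨ +-comm M k ⟩
        k + M  ∎
        where open ≤-Reasoning

      Z≡ : Z ≡ M + A
      Z≡ = trans (cong (_* A) A≡) (trans (+-comm A ((2 + a) * A)) (cong (_+ A) (sym M≡)))

      M<Z : M < Z
      M<Z = subst (M <_) (sym Z≡) (m<m+n M (>-nonZero⁻¹ A))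

      Z-M : Z ∸ M ≡ A
      Z-M = trans (cong (_∸ M) Z≡) (m+n∸m≡n M A)

      2≤A : 2 ≤ A
      2≤A = subst (2 ≤_) (sym A≡) (s≤s (s≤s z≤n))

      2≤Θ : 2 ≤ Θ
      2≤Θ = ≤-trans 2≤A (≤-trans (m≤n*m A 2) 2A≤Θ)

      Θ≡1+ : Θ ≡ suc (Θ ∸ 1)
      Θ≡1+ = sym (m+[n∸m]≡n (≤-trans (s≤s z≤n) 2≤Θ))

      AkF≤ : ∀ N → A * (k * F N) ≤ a * (B * N)
      AkF≤ N = *-cancelˡ-≤ 2 (begin
        2 * (A * (k * F N))  ≡⟨ trans (cong (λ z → 2 * (z * (k * F N))) A≡6L) (lem L k (F N)) ⟩
        3 * (4 * (L * k) * F N)  ≤⟨ *-monoʳ-≤ 3 (4uF≤ N) ⟩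
        3 * ((4 * l + 2) * (B * N))  ≡⟨ trans (lem′ l (B * N)) (cong (λ z → 2 * (z * (B * N))) (sym a≡)) ⟩
        2 * (a * (B * N))  ∎)
        where
        open ≤-Reasoning
        lem : ∀ L k F → 2 * (6 * L * (k * F)) ≡ 3 * (4 * (L * k) * F)
        lem = solve-∀
        lem′ : ∀ l x → 3 * ((4 * l + 2) * x) ≡ 2 * ((6 * l + 3) * x)
        lem′ = solve-∀

      -- `(A + 1) * a` falls short of `M = A * (A − 1)` by `A + 3`. Rounding the block size costs at
      -- most `A / 2` of this because `2 * A * M ≤ k`, and the tolerance `1 / Θ` at most another
      -- `A / 2` because `2 * A ≤ Θ`.
      margin : Θ * ((A + 1) * a) * (k + M) ≤ (Θ ∸ 1) * (k * M)
      margin = +-cancelʳ-≤ (k * M) _ _ (*-cancelˡ-≤ 2 (begin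
        2 * (Θ * ((A + 1) * a) * (k + M) + k * M)
          ≡⟨ lem₁ Θ ((A + 1) * a) k M ⟩
        2 * (Θ * ((A + 1) * a) * k) + (Θ * ((A + 1) * a) * (2 * M) + 2 * k * M)
          ≤⟨ +-monoʳ-≤ (2 * (Θ * ((A + 1) * a) * k)) (+-mono-≤ first second) ⟩
        2 * (Θ * ((A + 1) * a) * k) + (Θ * A * k + Θ * A * k)
          ≤⟨ m≤m+n _ (6 * (Θ * k)) ⟩
        2 * (Θ * ((A + 1) * a) * k) + (Θ * A * k + Θ * A * k) + 6 * (Θ * k)
          ≡⟨ trans (cong (λ A → 2 * (Θ * ((A + 1) * a) * k) + (Θ * A * k + Θ * A * k) + 6 * (Θ * k)) A≡)
              (trans (lem₂ Θ a k) (cong (λ m → 2 * (Θ * (k * m))) (trans (cong ((2 + a) *_) (sym A≡)) (sym M≡)))) ⟩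
        2 * (Θ * (k * M))
          ≡⟨ cong (2 *_) (trans (cong (_* (k * M)) Θ≡1+) (+-comm (k * M) _)) ⟩
        2 * ((Θ ∸ 1) * (k * M) + k * M) ∎))
        where
        open ≤-Reasoning
        lem₁ : ∀ Θ x k M → 2 * (Θ * x * (k + M) + k * M) ≡ 2 * (Θ * x * k) + (Θ * x * (2 * M) + 2 * k * M)
        lem₁ = solve-∀
        lem₂ : ∀ Θ a k → 2 * (Θ * ((3 + a + 1) * a) * k) + (Θ * (3 + a) * k + Θ * (3 + a) * k) + 6 * (Θ * k) ≡ 2 * (Θ * (k * ((2 + a) * (3 + a))))
        lem₂ = solve-∀
        [A+1]a≤A² : (A + 1) * a ≤ A * A
        [A+1]a≤A² = subst (λ A → (A + 1) * a ≤ A * A) (sym A≡) (≤-trans (m≤m+n _ (2 * a + 9)) (≤-reflexive (lem a)))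
          where
          lem : ∀ a → (3 + a + 1) * a + (2 * a + 9) ≡ (3 + a) * (3 + a)
          lem = solve-∀
        first : Θ * ((A + 1) * a) * (2 * M) ≤ Θ * A * k
        first = begin
          Θ * ((A + 1) * a) * (2 * M)  ≤⟨ *-monoˡ-≤ (2 * M) (*-monoʳ-≤ Θ [A+1]a≤A²) ⟩
          Θ * (A * A) * (2 * M)  ≡⟨ lem Θ A M ⟩
          Θ * A * (2 * A * M)  ≤⟨ *-monoʳ-≤ (Θ * A) k-large ⟩
          Θ * A * k  ∎
          where
          lem : ∀ Θ A M → Θ * (A * A) * (2 * M) ≡ Θ * A * (2 * A * M)
          lem = solve-∀
        second : 2 * k * M ≤ Θ * A * k
        second = begin
          2 * k * M  ≤⟨ *-monoʳ-≤ (2 * k) (<⇒≤ M<Z) ⟩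
          2 * k * (A * A)  ≡⟨ lem k A ⟩
          2 * A * (A * k)  ≤⟨ *-monoˡ-≤ (A * k) 2A≤Θ ⟩
          Θ * (A * k)  ≡⟨ sym (*-assoc Θ A k) ⟩
          Θ * A * k  ∎
          where
          lem : ∀ k A → 2 * k * (A * A) ≡ 2 * A * (A * k)
          lem = solve-∀

      block-room : ∀ N {b} → b < M → (Z ∸ b) * (F N * (Z * Θ)) ≤ (Z ∸ suc b) * ((Θ ∸ 1) * N)
      block-room N {b} b<M = *-cancelˡ-≤ (A * (A * k) * M) {{m*n≢0 (A * (A * k)) M {{m*n≢0 A (A * k) {{A≢0}} {{m*n≢0 A k}}}}}} (begin
        A * (A * k) * M * ((Z ∸ b) * (F N * (Z * Θ)))  ≡⟨ cong (λ z → A * (A * k) * M * (z * (F N * (Z * Θ)))) (+-∸-assoc 1 {Z} {suc b} (<-trans b<M M<Z)) ⟩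
        A * (A * k) * M * (suc c * (F N * (Z * Θ)))  ≡⟨ lem₁ A k M c (F N) Z Θ ⟩
        suc c * A * (A * (k * F N)) * (M * (Z * Θ))  ≤⟨ *-monoˡ-≤ (M * (Z * Θ)) (*-mono-≤ [c+1]A≤ (AkF≤ N)) ⟩
        c * (A + 1) * (a * (B * N)) * (M * (Z * Θ))  ≡⟨ lem₂ c (A + 1) a B N M Z Θ ⟩
        c * N * Z * (Θ * ((A + 1) * a) * (M * B))  ≤⟨ *-monoʳ-≤ (c * N * Z) (≤-trans (*-monoʳ-≤ (Θ * ((A + 1) * a)) MB≤k+M) margin) ⟩
        c * N * Z * ((Θ ∸ 1) * (k * M))  ≡⟨ lem₃ c N A (Θ ∸ 1) k M ⟩
        A * (A * k) * M * (c * ((Θ ∸ 1) * N))  ∎)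
        where
        open ≤-Reasoning
        c = Z ∸ suc b
        A≤c : A ≤ c
        A≤c = subst (_≤ c) Z-M (∸-monoʳ-≤ Z b<M)
        -- As `c ≥ A`, the ratio `(c + 1) / c` is at most `(A + 1) / A`, uniformly over the blocks.
        [c+1]A≤ : suc c * A ≤ c * (A + 1)
        [c+1]A≤ = subst₂ _≤_ (+-comm (c * A) A) (sym (trans (*-distribˡ-+ c A 1) (cong (c * A +_) (*-identityʳ c)))) (+-monoʳ-≤ (c * A) A≤c)
        lem₁ : ∀ A k M c F Z Θ → A * (A * k) * M * (suc c * (F * (Z * Θ))) ≡ suc c * A * (A * (k * F)) * (M * (Z * Θ))
        lem₁ = solve-∀
        lem₂ : ∀ c x a B N M Z Θ → c * x * (a * (B * N)) * (M * (Z * Θ)) ≡ c * N * Z * (Θ * (x * a) * (M * B))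
        lem₂ = solve-∀
        lem₃ : ∀ c N A θ k M → c * N * (A * A) * (θ * (k * M)) ≡ A * (A * k) * M * (c * (θ * N))
        lem₃ = solve-∀

      kD≤n : k * D ≤ n
      kD≤n = *-cancelˡ-≤ L (≤-trans (≤-reflexive (sym (*-assoc L k D))) (≤-trans D-bound (*-monoˡ-≤ n (n≤1+n l))))

      -- Multiplied by `k²`, the left side contains `(k * D) ^ 6 ≤ n ^ 6`. Five factors `n` are
      -- traded for `E * N`, and the sixth is covered by `C₁ * n ≤ k²`, which is where `C₁` comes
      -- from.
      sixth-room : ∀ N → n < E * N → 5 * Θ ^ 7 * (k * (k * (48 * (A * A * (D * D)))) ^ 3) ≤ N ^ 5
      sixth-room N n<EN = *-cancelˡ-≤ (k * k) {{m*n≢0 k k}} (begin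
        k * k * (5 * Θ ^ 7 * (k * (k * (48 * (A * A * (D * D)))) ^ 3))  ≡⟨ lem₁ k (5 * Θ ^ 7) (A * A) D ⟩
        5 * Θ ^ 7 * (48 * (A * A)) ^ 3 * (k * D) ^ 6  ≤⟨ *-monoʳ-≤ (5 * Θ ^ 7 * (48 * (A * A)) ^ 3) (≤-trans (^-monoˡ-≤ 6 kD≤n) (*-monoʳ-≤ n (^-monoˡ-≤ 5 (<⇒≤ n<EN)))) ⟩
        5 * Θ ^ 7 * (48 * (A * A)) ^ 3 * (n * (E * N) ^ 5)  ≡⟨ cong (λ z → 5 * Θ ^ 7 * (48 * (A * A)) ^ 3 * (n * z)) (^-* E N 5) ⟩
        5 * Θ ^ 7 * (48 * (A * A)) ^ 3 * (n * (E ^ 5 * N ^ 5))  ≡⟨ lem₂ (5 * Θ ^ 7 * (48 * (A * A)) ^ 3) n (E ^ 5) (N ^ 5) ⟩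
        5 * Θ ^ 7 * (48 * (A * A)) ^ 3 * E ^ 5 * n * N ^ 5  ≤⟨ *-monoˡ-≤ (N ^ 5) (subst (λ c → c * n ≤ k * k) C₁≡ C₁n≤k²) ⟩
        k * k * N ^ 5  ∎)
        where
        open ≤-Reasoning
        lem₁ : ∀ k T A² D → k * k * (T * (k * (k * (48 * (A² * (D * D))) * (k * (48 * (A² * (D * D))) * (k * (48 * (A² * (D * D))) * 1))))) ≡
          T * (48 * A² * (48 * A² * (48 * A² * 1))) * (k * D * (k * D * (k * D * (k * D * (k * D * (k * D * 1))))))
        lem₁ = solve-∀
        lem₂ : ∀ a b c d → a * (b * (c * d)) ≡ a * c * b * d
        lem₂ = solve-∀

      p-small : ∀ N → n < E * N → 4 * (L * k) * p ≤ B * N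
      p-small N n<EN = begin
        4 * (L * k) * p  ≤⟨ *-monoˡ-≤ p (*-monoʳ-≤ 4 (*-monoʳ-≤ L k≤MB)) ⟩
        4 * (L * (M * B)) * p  ≡⟨ lem L M B p ⟩
        B * (4 * L * M * p)  ≤⟨ *-monoʳ-≤ B (E-cancel (subst (_≤ n) (lem′ E (4 * L * M) s r) room₁) n<EN) ⟩
        B * N  ∎
        where
        open ≤-Reasoning
        lem : ∀ L M B p → 4 * (L * (M * B)) * p ≡ B * (4 * L * M * p)
        lem = solve-∀
        lem′ : ∀ E x s r → E * (x * (3 * s)) * r ≡ E * (x * (s * (3 * r)))
        lem′ = solve-∀

      -- The reason for `Θ = 3 * s`: three losses of `p / Θ` exhaust exactly the reserve
      -- `q = p / s`.
      p′-small : p′ * Θ + 3 * (2 + p₀) ≤ (2 + p₀) * Θ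
      p′-small = ≤-reflexive (subst (λ e → p′ * Θ + 3 * e ≡ e * Θ) p≡2+p₀ (begin
        p′ * Θ + 3 * p  ≡⟨ cong (p′ * Θ +_) (trans (sym (*-assoc 3 s q)) (trans (cong (_* q) (sym Θ≡)) (*-comm Θ q))) ⟩
        p′ * Θ + q * Θ  ≡⟨ sym (*-distribʳ-+ Θ p′ q) ⟩
        (p′ + q) * Θ  ≡⟨ cong (_* Θ) (sym p≡p′+q) ⟩
        p * Θ  ∎))
        where open ≡-Reasoning

      packing-many : Result
      packing-many = packed step p-small
        where
        step : ∀ a N → 0 < N → Parts a N → n < E * N → (∀ t → size a t ≤ F N) → GoodStep p₀ a N p′
        step a N 0<N parts n<EN size≤ = Large.good-step G B p₀ a N D (F N) A Z M Θ p′ 0<N 2≤Θ (E-cancel room₃ n<EN) k≤MB M<Z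
          (≤-reflexive (cong (A *_) (sym Z-M))) (*-monoˡ-≤ A 2≤A) parts deg≤D size≤ (block-room N)
          (E-cancel (subst (_≤ n) (trans (lem E (A * A) s Θ r) (cong (λ e → E * (4 * (A * A) * e * Θ)) p≡2+p₀)) room₂) n<EN) (sixth-room N n<EN) p′-small
          where
          lem : ∀ E x s Θ r → E * (4 * x * (3 * s) * Θ) * r ≡ E * (4 * x * (s * (3 * r)) * Θ)
          lem = solve-∀

  -- The threshold on n

  CliquePacking : ∀ {k n} → Conflicts k n → ℕ → Set
  CliquePacking {k} {n} G E = ∃ λ m → m ≤ n × E * (n ∸ m) ≤ n × ∃ λ (f : Fin m → Fin k → Fin n) →
    (∀ c i j → i ≢ j → Conflicts.cf G i (f c i) j (f c j) ≡ false) × (∀ c c′ j → f c j ≡ f c′ j → c ≡ c′)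

  module _ {k n : ℕ} (G : Conflicts k n) (B : ℕ) {{_ : NonZero B}} (p p′ E Φ₀ : ℕ) where
    open Extraction G B p p′ E Φ₀
    forget-alive : ∀ {a} → Packing a n → CliquePacking G E
    forget-alive P = m , m≤N , leftover , f , clique , disjoint
      where open Packing P

  -- The constants are variables tied by equations, so that large expressions such as `C₁` remain
  -- folded.
  module _ {k n : ℕ} (G : Conflicts k n) (l E r s Θ a A M C₁ Cₐ : ℕ) (0<l : 0 < l) (0<E : 0 < E)
    (s≡ : s ≡ 4 * l * (2 * E)) (Θ≡ : Θ ≡ 3 * s) (a≡ : a ≡ 6 * l + 3) (A≡ : A ≡ 3 + a) (M≡ : M ≡ (2 + a) * A)
    (C₁≡ : C₁ ≡ 5 * Θ ^ 7 * (48 * (A * A)) ^ 3 * E ^ 5) (Cₐ≡ : Cₐ ≡ E * (4 * suc l * (3 * s)))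
    (0<n : 0 < n) (0<r : 0 < r) (n<2^r : n < 2 ^ r)
    (n-large : (Cₐ * Cₐ * C₁ + (E * (4 * suc l * M * (3 * s)) + (E * (4 * (A * A) * (3 * s) * Θ) + (E * A + 2 * A * M * (2 * A * M))))) * (r * r) ≤ n)
    (0<k : 0 < k) (deg-small : ∀ i x j → suc l * k * ∑ (λ y → bit (Conflicts.cf G i x j y)) ≤ l * n) where

    private
      2≤s : 2 ≤ s
      2≤s = subst (2 ≤_) (sym s≡) (*-mono-≤ {1} {4 * l} (*-mono-≤ {1} {4} (s≤s z≤n) 0<l) (*-monoʳ-≤ 2 0<E))

      0<Θ : 0 < Θ
      0<Θ = subst (0 <_) (sym Θ≡) (*-mono-≤ {1} {3} (s≤s z≤n) (≤-trans (s≤s z≤n) 2≤s))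

      0<A : 0 < A
      0<A = subst (0 <_) (sym A≡) (s≤s z≤n)

      2A≤Θ : 2 * A ≤ Θ
      2A≤Θ = begin
        2 * A  ≡⟨ cong (2 *_) (trans A≡ (cong (3 +_) a≡)) ⟩
        2 * (3 + (6 * l + 3))  ≡⟨ lem l ⟩
        12 * l + 12 * 1  ≤⟨ +-monoʳ-≤ (12 * l) (*-monoʳ-≤ 12 0<l) ⟩
        12 * l + 12 * l  ≤⟨ m≤m*n (12 * l + 12 * l) E {{>-nonZero 0<E}} ⟩
        (12 * l + 12 * l) * E  ≡⟨ lem′ l E ⟩
        3 * (4 * l * (2 * E))  ≡⟨ sym (trans Θ≡ (cong (3 *_) s≡)) ⟩
        Θ  ∎
        where
        open ≤-Reasoning
        lem : ∀ l → 2 * (3 + (6 * l + 3)) ≡ 12 * l + 12 * 1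
        lem = solve-∀
        lem′ : ∀ l E → (12 * l + 12 * l) * E ≡ 3 * (4 * l * (2 * E))
        lem′ = solve-∀

      0<C₁ : 0 < C₁
      0<C₁ = subst (0 <_) (sym C₁≡) (*-mono-≤ {1} (*-mono-≤ {1} (*-mono-≤ {1} {5} (s≤s z≤n) (m^n>0 Θ {{>-nonZero 0<Θ}} 7))
        (m^n>0 (48 * (A * A)) {{>-nonZero (*-mono-≤ {1} {48} (s≤s z≤n) (*-mono-≤ {1} 0<A 0<A))}} 3)) (m^n>0 E {{>-nonZero 0<E}} 5))

      r≤r² : r ≤ r * r
      r≤r² = m≤m*n r r {{>-nonZero 0<r}}

      1≤r² : 1 ≤ r * r
      1≤r² = *-mono-≤ {1} 0<r 0<r

      term : ∀ {c C} → c ≤ C → C * (r * r) ≤ n → c * (r * r) ≤ n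
      term c≤C C≤n = ≤-trans (*-monoˡ-≤ (r * r) c≤C) C≤n

      linear-term : ∀ {c} → c * (r * r) ≤ n → c * r ≤ n
      linear-term {c} h = ≤-trans (*-monoʳ-≤ c r≤r²) h

      constant-term : ∀ {c} → c * (r * r) ≤ n → c ≤ n
      constant-term {c} h = ≤-trans (≤-trans (≤-reflexive (sym (*-identityʳ c))) (*-monoʳ-≤ c 1≤r²)) h

      x₀ = Cₐ * Cₐ * C₁
      x₁ = E * (4 * suc l * M * (3 * s))
      x₂ = E * (4 * (A * A) * (3 * s) * Θ)
      x₃ = E * A
      x₄ = 2 * A * M * (2 * A * M)

      open Instance G l E s r 0<l 0<E 2≤s (subst (λ s → 2 * (E * (4 * l) ^ s) ≤ (4 * l + 1) ^ s) (sym s≡) (gap l E 0<l)) 0<n 0<r n<2^r 0<k deg-small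

    clique-packing : CliquePacking G E
    clique-packing with C₁ * n ≤? k * k
    ... | no few = forget-alive G 1 p₀ p′ E _ (FewParts.packing-few Cₐ C₁ Cₐ≡ (term (m≤m+n x₀ _) n-large) (≰⇒> few))
    ... | yes many = forget-alive G _ p₀ p′ E _ (ManyParts.packing-many a A M Θ C₁ a≡ A≡ M≡ Θ≡ C₁≡ 2A≤Θ
        (linear-term {x₁} (term (m≤m+n x₁ _) tail₁)) (linear-term {x₂} (term (m≤m+n x₂ _) tail₂)) (constant-term (term (m≤m+n x₃ x₄) tail₃)) k-large many)
      where
      tail₁ = term (m≤n+m (x₁ + (x₂ + (x₃ + x₄))) x₀) n-large
      tail₂ = term (m≤n+m (x₂ + (x₃ + x₄)) x₁) tail₁
      tail₃ = term (m≤n+m (x₃ + x₄) x₂) tail₂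
      -- Here `k² ≥ C₁ * n ≥ n`, and the threshold contains the square of `2 * A * M` for this
      -- comparison.
      k-large : 2 * A * M ≤ k
      k-large = ≮⇒≥ λ k<x → contradiction (≤-trans (≤-trans (constant-term (term (m≤n+m x₄ x₃) tail₃)) (m≤n*m n C₁ {{>-nonZero 0<C₁}})) many) (<⇒≱ (*-mono-< k<x k<x))

  AlmostPerfectPacking : ℕ → ℕ → ℕ → Set
  AlmostPerfectPacking l E n₀ = ∀ n → n₀ ≤ n → ∀ k → 0 < k → (G : Conflicts k n) →
    (∀ i x j → suc l * k * ∑ (λ y → bit (Conflicts.cf G i x j y)) ≤ l * n) → CliquePacking G E

  -- The random process needs k² ≥ C₁ n and the greedy cliques need k Cₐ log n ≤ n; the threshold on n makes one of them available.
  almost-perfect-packing : ∀ l E → 0 < l → 0 < E → ∃ (AlmostPerfectPacking l E)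
  almost-perfect-packing l E 0<l 0<E = proj₁ threshold , λ n n₀≤n k 0<k G deg-small →
    let 0<n , r , 0<r , n<2^r , n-large = proj₂ threshold n n₀≤n
    in clique-packing G l E r s Θ a A M C₁ Cₐ 0<l 0<E refl refl refl refl refl refl refl 0<n 0<r n<2^r n-large 0<k deg-small
    where
    s Θ a A M C₁ Cₐ : ℕ
    s = 4 * l * (2 * E)
    Θ = 3 * s
    a = 6 * l + 3
    A = 3 + a
    M = (2 + a) * A
    C₁ = 5 * Θ ^ 7 * (48 * (A * A)) ^ 3 * E ^ 5
    Cₐ = E * (4 * suc l * (3 * s))
    threshold = large-enough (Cₐ * Cₐ * C₁ + (E * (4 * suc l * M * (3 * s)) + (E * (4 * (A * A) * (3 * s) * Θ) + (E * A + 2 * A * M * (2 * A * M)))))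

  -- Partite graphs and rational parameters

  count≡∑ : ∀ {n} (f : Fin n → Bool) → count f ≡ ∑ (λ y → bit (f y))
  count≡∑ {zero}  f = refl
  count≡∑ {suc n} f with f zero
  ... | true  = cong suc (count≡∑ λ y → f (suc y))
  ... | false = count≡∑ λ y → f (suc y)

  module Conflicting {k n : ℕ} (G : PartiteGraph k n) where
    -- No conflicts inside a part: a clique takes one vertex per part, and the degree bound then
    -- holds for every pair of parts, equal ones included.
    conflict : Fin k → Fin n → Fin k → Fin n → Bool
    conflict i x j y = not (adj G (i , x) (j , y)) ∧ not (does (i Fin.≟ j))

    conflict-sym : ∀ i x j y → conflict i x j y ≡ conflict j y i x
    conflict-sym i x j y = cong₂ (λ b c → not b ∧ not c) (adj-sym G (i , x) (j , y)) (flip i j)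
      where
      flip : ∀ (i j : Fin k) → does (i Fin.≟ j) ≡ does (j Fin.≟ i)
      flip i j with i Fin.≟ j | j Fin.≟ i
      ... | yes _ | yes _ = refl
      ... | no _  | no _  = refl
      ... | yes p | no ¬q = contradiction (sym p) ¬q
      ... | no ¬p | yes q = contradiction (sym q) ¬p

    conflicts : Conflicts k n
    conflicts = record { cf = conflict ; cf-sym = conflict-sym }

    adjacent : ∀ i x j y → i ≢ j → conflict i x j y ≡ false → adj G (i , x) (j , y) ≡ true
    adjacent i x j y i≢j h with adj G (i , x) (j , y) | i Fin.≟ j
    ... | true  | _  = refl
    ... | false | yes p = contradiction p i≢j

    no-own-conflicts : ∀ i x → ∑ (λ y → bit (conflict i x i y)) ≡ 0
    no-own-conflicts i x = trans (∑-cong λ y → own (adj G (i , x) (i , y))) (∑-0 n)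
      where
      own : ∀ b → bit (not b ∧ not (does (i Fin.≟ i))) ≡ 0
      own b with i Fin.≟ i
      own true  | yes _ = refl
      own false | yes _ = refl
      own b  | no ¬p = contradiction refl ¬p

    conflicts+degree : ∀ i x j → i ≢ j → ∑ (λ y → bit (conflict i x j y)) + degIn G (i , x) j ≡ n
    conflicts+degree i x j i≢j = begin
      ∑ (λ y → bit (conflict i x j y)) + degIn G (i , x) j  ≡⟨ cong (∑ (λ y → bit (conflict i x j y)) +_) (count≡∑ λ y → adj G (i , x) (j , y)) ⟩
      ∑ (λ y → bit (conflict i x j y)) + ∑ (λ y → bit (adj G (i , x) (j , y))) ≡⟨ sym (∑-+ (λ y → bit (conflict i x j y)) (λ y → bit (adj G (i , x) (j , y)))) ⟩
      ∑ (λ y → bit (conflict i x j y) + bit (adj G (i , x) (j , y)))  ≡⟨ ∑-cong (λ y → complement (adj G (i , x) (j , y))) ⟩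
      ∑ {n} (λ _ → 1)  ≡⟨ trans (∑-const n 1) (*-identityʳ n) ⟩
      n  ∎
      where
      open ≡-Reasoning
      complement : ∀ b → bit (not b ∧ not (does (i Fin.≟ j))) + bit b ≡ 1
      complement b with i Fin.≟ j
      complement b  | yes p = contradiction p i≢j
      complement true  | no _  = refl
      complement false | no _  = refl

  -- Dividing by a denominator of at least 1 cannot raise the absolute value of the numerator.
  archimedean : ∀ q → ∃ λ m → q ℚ.≤ ι m
  archimedean q = ℤ.∣ ℚ.numerator q ∣ , bound q
    where
    below : ∀ z d → z ℤ.* ℤ.+ 1 ℤ.≤ ℤ.+ ℤ.∣ z ∣ ℤ.* ℤ.+ suc d
    below (ℤ.+ m)  d = subst₂ ℤ._≤_ (ℤ.pos-* m 1) (ℤ.pos-* m (suc d)) (ℤ.+≤+ (*-monoʳ-≤ m (s≤s z≤n)))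
    below (ℤ.-[1+ m ]) d = subst (ℤ.-[1+ m ] ℤ.* ℤ.+ 1 ℤ.≤_) (ℤ.pos-* (suc m) (suc d)) (subst (ℤ._≤ ℤ.+ (suc m * suc d)) (sym (ℤ.*-identityʳ ℤ.-[1+ m ])) ℤ.-≤+)
    bound : ∀ q → q ℚ.≤ ι ℤ.∣ ℚ.numerator q ∣
    bound q@(ℚ.mkℚ z d _) = ℚ.toℚᵘ-cancel-≤ (ℚᵘ.≤-respʳ-≃ (ℚᵘ.≃-sym (toℚᵘ-ι ℤ.∣ z ∣)) (ℚᵘ.*≤* (below z d)))

  reciprocal-bound : ∀ δ → 0ℚ ℚ.< δ → ∃ λ m → ∀ m′ → m ≤ m′ → 1ℚ ℚ.≤ ι m′ ℚ.* δ
  reciprocal-bound δ 0<δ with recip δ 0<δ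
  ... | g , 0<g , gδ≡1 with archimedean g
  ...  | m , g≤m = m , λ m′ m≤m′ → ℚ.≤-trans (ℚ.≤-reflexive (sym gδ≡1)) (*-monoʳ (ℚ.<⇒≤ 0<δ) (ℚ.≤-trans g≤m (ι-mono m≤m′)))

  -- The non-neighbours number at most `(1 − δ) * n / k`, and `L * δ ≥ 1` gives `1 − δ ≤ l / L` for
  -- `L = suc l`. The certificate is `L * k` times the slack of the degree bound plus
  -- `(L * δ − 1) * n`.
  conflict-bound : ∀ (δ : ℚ) (l m n c d : ℕ) → 1ℚ ℚ.≤ ι (suc l) ℚ.* δ → c + d ≡ n → degBound δ (suc m) n ℚ.≤ ι d → suc l * suc m * c ≤ l * n
  conflict-bound δ l m n c d 1≤Lδ c+d≡n bound = ι-cancel (≤-cert _ (0≤+ (0≤* (0≤* 0≤L 0≤k) (≤-diff bound)) (0≤* (≤-diff 1≤Lδ) (0≤ι n))) (begin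
    ι (l * n)  ≡⟨ ι-* l n ⟩
    ι l ℚ.* N  ≡⟨ lem₁ (ι l) N ⟩
    ((1ℚ ℚ.+ ι l) ℚ.- 1ℚ) ℚ.* N  ≡⟨ cong (λ z → (z ℚ.- 1ℚ) ℚ.* N) (sym L≡) ⟩
    (L ℚ.- 1ℚ) ℚ.* N  ≡⟨ lem₂ L N δ ⟩
    L ℚ.* N ℚ.- 1ℚ ℚ.* (L ℚ.* δ ℚ.* N) ℚ.+ (L ℚ.* δ ℚ.- 1ℚ) ℚ.* N  ≡⟨ cong (λ z → L ℚ.* N ℚ.- z ℚ.* (L ℚ.* δ ℚ.* N) ℚ.+ (L ℚ.* δ ℚ.- 1ℚ) ℚ.* N) (sym ki≡1) ⟩
    L ℚ.* N ℚ.- (K ℚ.* i) ℚ.* (L ℚ.* δ ℚ.* N) ℚ.+ (L ℚ.* δ ℚ.- 1ℚ) ℚ.* N  ≡⟨ cong (λ z → z ℚ.- (K ℚ.* i) ℚ.* (L ℚ.* δ ℚ.* N) ℚ.+ (L ℚ.* δ ℚ.- 1ℚ) ℚ.* N) (trans (sym (ℚ.*-identityʳ (L ℚ.* N))) (cong (L ℚ.* N ℚ.*_) (sym ki≡1))) ⟩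
    L ℚ.* N ℚ.* (K ℚ.* i) ℚ.- (K ℚ.* i) ℚ.* (L ℚ.* δ ℚ.* N) ℚ.+ (L ℚ.* δ ℚ.- 1ℚ) ℚ.* N
                                                                            ≡⟨ lem₃ L K i N δ (ι d) ⟩
    L ℚ.* K ℚ.* (N ℚ.- ι d) ℚ.+ (L ℚ.* K ℚ.* (ι d ℚ.- (1ℚ ℚ.- (1ℚ ℚ.- δ) ℚ.* i) ℚ.* N) ℚ.+ (L ℚ.* δ ℚ.- 1ℚ) ℚ.* N)
                                                                            ≡⟨ cong₂ (λ u v → u ℚ.+ (L ℚ.* K ℚ.* (ι d ℚ.- v) ℚ.+ (L ℚ.* δ ℚ.- 1ℚ) ℚ.* N)) c≡ (cong ((1ℚ ℚ.- (1ℚ ℚ.- δ) ℚ.* i) ℚ.*_) (ι≡ℕtoℚ n)) ⟩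
    ι (suc l * suc m * c) ℚ.+ (L ℚ.* K ℚ.* (ι d ℚ.- degBound δ (suc m) n) ℚ.+ (L ℚ.* δ ℚ.- 1ℚ) ℚ.* N) ∎))
    where
    open ≡-Reasoning
    N L K i : ℚ
    N = ι n
    L = ι (suc l)
    K = ι (suc m)
    i = (ℤ.+ 1) ℚ./ suc m
    0≤L = 0≤ι (suc l)
    0≤k = 0≤ι (suc m)
    L≡ : L ≡ 1ℚ ℚ.+ ι l
    L≡ = trans (ι-+ 1 l) (cong (ℚ._+ ι l) ι1≡1)
    ki≡1 : K ℚ.* i ≡ 1ℚ
    ki≡1 = trans (cong (K ℚ.*_) (sym (inv≡ m))) (ι*inv {suc m} (s≤s z≤n))
    c≡ : L ℚ.* K ℚ.* (N ℚ.- ι d) ≡ ι (suc l * suc m * c)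
    c≡ = trans (cong (λ z → L ℚ.* K ℚ.* (z ℚ.- ι d)) (trans (cong ι (sym c+d≡n)) (ι-+ c d)))
      (trans (lem L K (ι c) (ι d)) (trans (cong (ℚ._* ι c) (sym (ι-* (suc l) (suc m)))) (sym (ι-* (suc l * suc m) c))))
      where
      lem : ∀ L K c d → L ℚ.* K ℚ.* ((c ℚ.+ d) ℚ.- d) ≡ L ℚ.* K ℚ.* c
      lem = RingSolver.solve-∀ ℚring
    lem₁ : ∀ l N → l ℚ.* N ≡ ((1ℚ ℚ.+ l) ℚ.- 1ℚ) ℚ.* N
    lem₁ = RingSolver.solve-∀ ℚring
    lem₂ : ∀ L N δ → (L ℚ.- 1ℚ) ℚ.* N ≡ L ℚ.* N ℚ.- 1ℚ ℚ.* (L ℚ.* δ ℚ.* N) ℚ.+ (L ℚ.* δ ℚ.- 1ℚ) ℚ.* N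
    lem₂ = RingSolver.solve-∀ ℚring
    lem₃ : ∀ L K i N δ d → L ℚ.* N ℚ.* (K ℚ.* i) ℚ.- (K ℚ.* i) ℚ.* (L ℚ.* δ ℚ.* N) ℚ.+ (L ℚ.* δ ℚ.- 1ℚ) ℚ.* N ≡
      L ℚ.* K ℚ.* (N ℚ.- d) ℚ.+ (L ℚ.* K ℚ.* (d ℚ.- (1ℚ ℚ.- (1ℚ ℚ.- δ) ℚ.* i) ℚ.* N) ℚ.+ (L ℚ.* δ ℚ.- 1ℚ) ℚ.* N)
    lem₃ = RingSolver.solve-∀ ℚring

  leftover-bound : ∀ (ε : ℚ) (E n m : ℕ) → 0 < E → 1ℚ ℚ.≤ ι E ℚ.* ε → m ≤ n → E * (n ∸ m) ≤ n → (1ℚ ℚ.- ε) ℚ.* ℕtoℚ n ℚ.≤ ℕtoℚ m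
  leftover-bound ε E n m 0<E 1≤Eε m≤n small = subst₂ ℚ._≤_ (cong ((1ℚ ℚ.- ε) ℚ.*_) (ι≡ℕtoℚ n)) (ι≡ℕtoℚ m)
    (*-cancelˡ {ι E} (subst (ℚ._< ι E) ι0≡0 (ι-mono-< 0<E))
      (≤-cert _ (0≤+ (≤-diff (ι-mono small)) (0≤* (≤-diff 1≤Eε) (0≤ι n)))
        (trans (cong (λ z → ι E ℚ.* z) (trans (lem₁ (ι m) (ι (n ∸ m))) (cong (ℚ._- ι (n ∸ m)) n≡)))
          (trans (lem₂ (ι E) (ι n) (ι (n ∸ m)) ε) (cong (λ z → ι E ℚ.* ((1ℚ ℚ.- ε) ℚ.* ι n) ℚ.+ ((ι n ℚ.- z) ℚ.+ (ι E ℚ.* ε ℚ.- 1ℚ) ℚ.* ι n)) (sym (ι-* E (n ∸ m))))))))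
    where
    n≡ : ι m ℚ.+ ι (n ∸ m) ≡ ι n
    n≡ = trans (sym (ι-+ m (n ∸ m))) (cong ι (m+[n∸m]≡n m≤n))
    lem₁ : ∀ m d → m ≡ (m ℚ.+ d) ℚ.- d
    lem₁ = RingSolver.solve-∀ ℚring
    lem₂ : ∀ E n d ε → E ℚ.* (n ℚ.- d) ≡ E ℚ.* ((1ℚ ℚ.- ε) ℚ.* n) ℚ.+ ((n ℚ.- E ℚ.* d) ℚ.+ (E ℚ.* ε ℚ.- 1ℚ) ℚ.* n)
    lem₂ = RingSolver.solve-∀ ℚring

  disjoint-cliques : ∀ {k n} (G : PartiteGraph k n) E → (P : CliquePacking (Conflicting.conflicts G) E) → DisjointCliques G (proj₁ P)
  disjoint-cliques G E (m , _ , _ , f , clique , disjoint) = record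
    { f = λ c i → i , f c i
    ; distinct = λ c c′ i j eq → distinct c c′ i j (,-injectiveˡ eq) eq
    ; clique = λ c i j i≢j → adjacent i (f c i) j (f c j) i≢j (clique c i j i≢j)
    }
    where
    open Conflicting G
    distinct : ∀ c c′ i j → i ≡ j → (i , f c i) ≡ (j , f c′ j) → (c ≡ c′) × (i ≡ j)
    distinct c c′ i .i refl eq = disjoint c c′ i (cong proj₂ eq) , refl

  transfer : ∀ (ε δ : ℚ) l E n₀ → 0 < E → 1ℚ ℚ.≤ ι (suc l) ℚ.* δ → 1ℚ ℚ.≤ ι E ℚ.* ε → AlmostPerfectPacking l E n₀ →
    ∀ n → n₀ ≤ n → ∀ k → 2 ≤ k → ∀ (G : PartiteGraph k n) → partiteMinDeg≥ G (degBound δ k n) →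
    ∃ (λ m → ((1ℚ ℚ.- ε) ℚ.* ℕtoℚ n) ℚ.≤ ℕtoℚ m × DisjointCliques G m)
  transfer ε δ l E n₀ 0<E 1≤Lδ 1≤Eε packing n n₀≤n (suc k) 2≤k G min-degree =
    proj₁ P , leftover-bound ε E n (proj₁ P) 0<E 1≤Eε (proj₁ (proj₂ P)) (proj₁ (proj₂ (proj₂ P))) , disjoint-cliques G E P
    where
    open Conflicting G
    deg-small : ∀ i x j → suc l * suc k * ∑ (λ y → bit (conflict i x j y)) ≤ l * n
    deg-small i x j = by-part (i Fin.≟ j)
      where
      by-part : Dec (i ≡ j) → suc l * suc k * ∑ (λ y → bit (conflict i x j y)) ≤ l * n
      by-part (yes refl) = ≤-trans (≤-reflexive (trans (cong (suc l * suc k *_) (no-own-conflicts i x)) (*-zeroʳ (suc l * suc k)))) z≤n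
      by-part (no i≢j) = conflict-bound δ l k n _ (degIn G (i , x) j) 1≤Lδ (conflicts+degree i x j i≢j)
        (subst (degBound δ (suc k) n ℚ.≤_) (sym (ι≡ℕtoℚ (degIn G (i , x) j))) (min-degree (i , x) j λ j≡i → i≢j (sym j≡i)))
    P : CliquePacking conflicts E
    P = packing n n₀≤n (suc k) (s≤s z≤n) conflicts deg-small

  combine : ∀ (ε δ : ℚ) → (∃ λ m → ∀ m′ → m ≤ m′ → 1ℚ ℚ.≤ ι m′ ℚ.* δ) → (∃ λ m → ∀ m′ → m ≤ m′ → 1ℚ ℚ.≤ ι m′ ℚ.* ε) →
    Σ ℕ (λ n₀ → ∀ (n : ℕ) → n₀ ≤ n → ∀ (k : ℕ) → 2 ≤ k → ∀ (G : PartiteGraph k n) → partiteMinDeg≥ G (degBound δ k n) →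
    ∃ (λ m → ((1ℚ ℚ.- ε) ℚ.* ℕtoℚ n) ℚ.≤ ℕtoℚ m × DisjointCliques G m))
  combine ε δ (a , δ-bound) (b , ε-bound) = proj₁ packing ,
    -- The successors make `l` and `E` positive; the reciprocal bounds hold for all larger integers
    -- as well.
    transfer ε δ (suc a) (suc b) (proj₁ packing) (s≤s z≤n) (δ-bound (suc (suc a)) (m≤n⇒m≤1+n (n≤1+n a))) (ε-bound (suc b) (n≤1+n b)) (proj₂ packing)
    where
    packing : ∃ (AlmostPerfectPacking (suc a) (suc b))
    packing = almost-perfect-packing (suc a) (suc b) (s≤s z≤n) (s≤s z≤n)

open import Defs
open import Data.Nat using (ℕ; _≤_)
open import Data.Product using (Σ; ∃; _×_)
open import Data.Rational using (ℚ; 0ℚ; 1ℚ; _<_; _-_; _*_)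
import Data.Rational as Q

theorem1p6 : ∀ (ε δ : ℚ) → 0ℚ < ε → ε < 1ℚ → 0ℚ < δ → δ < 1ℚ →
    Σ ℕ (λ n₀ → ∀ (n : ℕ) → n₀ ≤ n → ∀ (k : ℕ) → 2 ≤ k →
    ∀ (G : PartiteGraph k n) → partiteMinDeg≥ G (degBound δ k n) →
    ∃ (λ m → ((1ℚ - ε) * ℕtoℚ n) Q.≤ ℕtoℚ m × DisjointCliques G m))
theorem1p6 ε δ 0<ε _ 0<δ _ = Conclusion.combine ε δ (Conclusion.reciprocal-bound δ 0<δ) (Conclusion.reciprocal-bound ε 0<ε)
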